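{- For each odd integer $k \geq 7$, there exists $n_0$ such that if $n\geq n_0$ and $G$ is a $C_{k-2}$-free graph on $n$ vertices maximising the number of $k$-cycles (among all $C_{k-2}$-free graphs on $n$ vertices), then $G$ is a balanced blow-up of $C_k$. In particular, for each $n\geq n_0$, we have $\mathrm{ex}(n,C_k,C_{k-2})\leq (n/k)^k$.
   Context: $C_m$ denotes the cycle of length $m$; the number of $k$-cycles of a graph is the number of its subgraphs isomorphic to $C_k$. For graphs $T,H$, $\mathrm{ex}(n,T,H)$ is the maximum number of copies of $T$ in an $H$-free graph on $n$ vertices. A balanced blow-up of a graph $F$ on $n$ vertices is obtained by replacing the vertices of $F$ by independent sets whose sizes sum to $n$ and differ by at most one from each other, and replacing each edge of $F$ by the complete bipartite graph between the corresponding independent sets. -}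

module Defs where

open import Data.Nat using (ℕ; zero; suc; _+_; _*_; _∸_; _^_; _≤_; _≡ᵇ_; NonZero)
open import Data.Nat.DivMod using (_/_; _%_; _mod_)
open import Data.Fin using (Fin; toℕ) renaming (zero to fzero; suc to fsuc)
open import Data.List using (List; []; _∷_; map; concatMap; length; filterᵇ; allFin; [_]; foldr)
open import Data.Bool using (Bool; true; false; _∧_; _∨_; not)
open import Data.Product using (Σ; _×_; ∃-syntax)
open import Function.Definitions using (Injective)
open import Relation.Binary.PropositionalEquality using (_≡_)

record Graph (n : ℕ) : Set where
  field
    adj    : Fin n → Fin n → Bool
    sym    : ∀ i j → adj i j ≡ adj j i
    irrefl : ∀ i → adj i i ≡ false
open Graph public

next : ∀ {k} → Fin k → Fin k
next {suc m} i = suc (toℕ i) mod suc m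

HasCycle : ∀ {n} → ℕ → Graph n → Set
HasCycle {n} m G =
  Σ (Fin m → Fin n) λ f → Injective _≡_ _≡_ f × (∀ i → adj G (f i) (f (next i)) ≡ true)

CycleFree : ∀ {n} → ℕ → Graph n → Set
CycleFree m G = HasCycle m G → Data.Empty.⊥
  where import Data.Empty

cons : ∀ {k n} → Fin n → (Fin k → Fin n) → (Fin (suc k) → Fin n)
cons x f fzero    = x
cons x f (fsuc i) = f i

allFuns : ∀ k n → List (Fin k → Fin n)
allFuns zero    n = [ (λ ()) ]
allFuns (suc k) n = concatMap (λ f → map (λ x → cons x f) (allFin n)) (allFuns k n)

allB : ∀ {A : Set} → (A → Bool) → List A → Bool
allB p = foldr (λ x b → p x ∧ b) true

_==_ : ∀ {n} → Fin n → Fin n → Bool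
i == j = toℕ i ≡ᵇ toℕ j

isCycleEmbedding : ∀ {k n} → Graph n → (Fin k → Fin n) → Bool
isCycleEmbedding {k} G f =
  allB (λ i → adj G (f i) (f (next i))) (allFin k) ∧
  allB (λ i → allB (λ j → (i == j) ∨ not (f i == f j)) (allFin k)) (allFin k)

embeddings : (k : ℕ) {n : ℕ} → Graph n → ℕ
embeddings k {n} G = length (filterᵇ (isCycleEmbedding G) (allFuns k n))

-- number of k-cycles of G (subgraphs isomorphic to C_k) = embeddings / |Aut C_k| = embeddings / 2k
cycles : (k : ℕ) {n : ℕ} → Graph n → ℕ
cycles zero    G = 0
cycles (suc k) G = embeddings (suc k) G / (2 * suc k)

IsMaximiser : ∀ {n} → ℕ → ℕ → Graph n → Set
IsMaximiser {n} k m G = (H : Graph n) → CycleFree m H → cycles k H ≤ cycles k G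

partSize : ∀ {n k} → (Fin n → Fin k) → Fin k → ℕ
partSize {n} part a = length (filterᵇ (λ v → part v == a) (allFin n))

BalancedBlowUp : ∀ {n} → (k : ℕ) → Graph n → Set
BalancedBlowUp {n} k G =
  ∃[ part ] ((∀ (a b : Fin k) → partSize part a ≤ suc (partSize part b)) ×
             (∀ u v → (adj G u v ≡ true → (part v ≡ next (part u) ⊎ part u ≡ next (part v))) ×
                      ((part v ≡ next (part u) ⊎ part u ≡ next (part v)) → adj G u v ≡ true)))
  where open import Data.Sum using (_⊎_)

{-# OPTIONS --safe #-}
module Submission where

-- In a C_{k-2}-free graph the edges lying in odd cycles shorter than k − 2 contain no K_{k,k}: replacing an
-- edge of a suitable even cycle of K_{k,k} by its even detour would create C_{k-2}.  So there are o(n²) of them,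
-- and without them there is no closed odd walk shorter than k.  In such a graph choose the vertices of a k-cycle
-- one after the other, in the order z₀, z₁, z₃, z₂, z₄, …, each among the vertices that the earlier ones leave
-- possible.  A fixed vertex is possible for at most k − 2 positions over all rotations of a given k-cycle, so
-- AM-GM yields at most (n/k)^k cycles; if this is nearly attained, some k-cycle has degree sum close to 2n.
-- Almost every vertex then has two neighbours on that cycle, at distance two, and this sorts the vertices into
-- k classes between which almost all the edges of the blow-up are present.
--
-- For the exact result, call a vertex typical if it misses few vertices of the two adjacent classes.  By
-- C_{k-2}-freeness the typical neighbours of any vertex x lie in two classes at distance two, which gives x a
-- class of its own.  An edge that does not respect the classes joins two atypical vertices, one of which has at
-- most one typical neighbour in an adjacent class; such a vertex loses more k-cycles than these edges can
-- create.  Hence G has at most as many k-cycles as the blow-up on its classes, with equality only for the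
-- blow-up itself, and among blow-ups the balanced ones are optimal.

-- In a balanced blow-up each later position of the cycle has n/k candidates, but `z₁` has 2n/k,
-- because the orientation is still free. So out of a budget of 2n the choice of `z₁` is charged
-- with factor 1 and every other choice with factor 2; then all charges, and the remainder too,
-- equal 2n/k. Averaged over the k rotations of a cycle, the remainder is at least (4n - s)/k, where
-- s ≤ 2n is its degree sum; this is how the count controls s.
--
-- The order of `z₂` and `z₃` matters. Chosen right after `z₁`, `z₂` would only come with a walk of
-- length k - 2 to `z₀`, and a second neighbour on the other side of `z₀` would then close an odd
-- walk of length k, which is no contradiction. From position 4 on the same closure has length k -
-- 2.
--
-- The constants come from one comparison: d defective vertices lose at least c·d·n^(k-1) cycles,
-- with c depending on k only, while the edges against the classes create at most O(d·n^(k-1)/M). So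
-- M is fixed first, from k alone, and the errors of the stability part are then chosen small
-- compared with 1/M.

open import Defs renaming (sym to adj-sym; irrefl to adj-irrefl)
open import Data.Bool using (Bool; true; false; _∧_; _∨_; not; T)
open import Data.Empty using (⊥; ⊥-elim)
open import Data.Fin using (Fin; toℕ; fromℕ<) renaming (zero to fzero; suc to fsuc; _≟_ to _≟ᶠ_)
open import Data.Fin.Properties using (all?; any?; toℕ-injective; toℕ<n; toℕ-fromℕ<) renaming (suc-injective to fsuc-injective)
open import Data.List using (List; []; _∷_; map; concatMap; length; filterᵇ; allFin; downFrom; _++_)
open import Data.List.Properties using (map-tabulate; length-tabulate; length-downFrom)
open import Data.List.Membership.Propositional using (_∈_; _∉_)
open import Data.List.Membership.Propositional.Properties using (∈-allFin)
open import Data.List.Relation.Unary.Any using (here; there)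
open import Data.Nat using (ℕ; zero; suc; _+_; _*_; _∸_; _^_; _≤_; _<_; _%_; _/_; z≤n; s≤s; NonZero; >-nonZero; _≟_; _≤?_; _<?_)
open import Data.Nat.DivMod using (_mod_; m%n<n; m<n⇒m%n≡m; n%n≡0; [m+n]%n≡m%n; [m+kn]%n≡m%n; %-distribˡ-+; m≡m%n+[m/n]*n; m*n/n≡m; /-monoˡ-≤; m<n*o⇒m/o<n; m/n*n≤m; m%n%n≡m%n; m*n%n≡0)
open import Data.Nat.Properties
open import Data.Nat.Tactic.RingSolver using (solve-∀)
open import Data.Product using (Σ; _×_; _,_; proj₁; proj₂; ∃-syntax)
open import Data.Sum using (_⊎_; inj₁; inj₂; [_,_]′)
open import Data.Vec using (Vec; []; _∷_; lookup; _∷ʳ_; reverse)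
open import Data.Vec.Properties using (reverse-∷; reverse-involutive)
open import Function using (_∘_; id; case_of_)
open import Relation.Binary.Definitions using (tri<; tri≈; tri>)
open import Relation.Binary.PropositionalEquality using (_≡_; _≢_; refl; sym; trans; cong; cong₂; subst; subst₂; module ≡-Reasoning)
open import Relation.Nullary using (¬_; Dec; yes; no)
open import Relation.Nullary.Decidable using (_×-dec_; _⊎-dec_; ¬?; map′; ⌊_⌋)

-- Sums over lists and indicator functions

∑ : {A : Set} → List A → (A → ℕ) → ℕ
∑ []       f = 0
∑ (x ∷ xs) f = f x + ∑ xs f

∑-cong : {A : Set} (xs : List A) {f g : A → ℕ} → (∀ x → f x ≡ g x) → ∑ xs f ≡ ∑ xs g
∑-cong []       e = refl
∑-cong (x ∷ xs) e = cong₂ _+_ (e x) (∑-cong xs e)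

∑-mono : {A : Set} (xs : List A) {f g : A → ℕ} → (∀ x → f x ≤ g x) → ∑ xs f ≤ ∑ xs g
∑-mono []       e = z≤n
∑-mono (x ∷ xs) e = +-mono-≤ (e x) (∑-mono xs e)

∑-+ : {A : Set} (xs : List A) (f g : A → ℕ) → ∑ xs (λ x → f x + g x) ≡ ∑ xs f + ∑ xs g
∑-+ []       f g = refl
∑-+ (x ∷ xs) f g rewrite ∑-+ xs f g = swap (f x) (g x) (∑ xs f) (∑ xs g)
  where
  swap : ∀ a b c d → a + b + (c + d) ≡ a + c + (b + d)
  swap = solve-∀

∑-*ˡ : {A : Set} (xs : List A) (c : ℕ) (f : A → ℕ) → ∑ xs (λ x → c * f x) ≡ c * ∑ xs f
∑-*ˡ []       c f = sym (*-zeroʳ c)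
∑-*ˡ (x ∷ xs) c f rewrite ∑-*ˡ xs c f = sym (*-distribˡ-+ c (f x) (∑ xs f))

∑-*ʳ : {A : Set} (xs : List A) (c : ℕ) (f : A → ℕ) → ∑ xs (λ x → f x * c) ≡ ∑ xs f * c
∑-*ʳ []       c f = refl
∑-*ʳ (x ∷ xs) c f rewrite ∑-*ʳ xs c f = sym (*-distribʳ-+ c (f x) (∑ xs f))

∑-const : {A : Set} (xs : List A) (c : ℕ) → ∑ xs (λ _ → c) ≡ length xs * c
∑-const []       c = refl
∑-const (x ∷ xs) c = cong (c +_) (∑-const xs c)

∑-zero : {A : Set} (xs : List A) → ∑ xs (λ _ → 0) ≡ 0
∑-zero xs = trans (∑-const xs 0) (*-zeroʳ (length xs))

∑-comm : {A B : Set} (xs : List A) (ys : List B) (f : A → B → ℕ) →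
         ∑ xs (λ x → ∑ ys (f x)) ≡ ∑ ys (λ y → ∑ xs (λ x → f x y))
∑-comm []       ys f = sym (∑-zero ys)
∑-comm (x ∷ xs) ys f rewrite ∑-comm xs ys f = sym (∑-+ ys (f x) (λ y → ∑ xs (λ x → f x y)))

∑-++ : {A : Set} (xs ys : List A) (f : A → ℕ) → ∑ (xs ++ ys) f ≡ ∑ xs f + ∑ ys f
∑-++ []       ys f = refl
∑-++ (x ∷ xs) ys f rewrite ∑-++ xs ys f = sym (+-assoc (f x) (∑ xs f) (∑ ys f))

∑-map : {A B : Set} (g : A → B) (xs : List A) (f : B → ℕ) → ∑ (map g xs) f ≡ ∑ xs (f ∘ g)
∑-map g []       f = refl
∑-map g (x ∷ xs) f = cong (f (g x) +_) (∑-map g xs f)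

∑-concatMap : {A B : Set} (g : A → List B) (xs : List A) (f : B → ℕ) →
              ∑ (concatMap g xs) f ≡ ∑ xs (λ x → ∑ (g x) f)
∑-concatMap g []       f = refl
∑-concatMap g (x ∷ xs) f = trans (∑-++ (g x) (concatMap g xs) f) (cong (∑ (g x) f +_) (∑-concatMap g xs f))

∑-term : {A : Set} {xs : List A} {x : A} → x ∈ xs → (f : A → ℕ) → f x ≤ ∑ xs f
∑-term {xs = x ∷ xs} (here refl) f = m≤m+n (f x) (∑ xs f)
∑-term {xs = y ∷ xs} (there p)   f = ≤-trans (∑-term p f) (m≤n+m (∑ xs f) (f y))

∑-pigeonhole : {A : Set} (xs : List A) (f g : A → ℕ) → ∑ xs f < ∑ xs g → ∃[ x ] f x < g x
∑-pigeonhole (x ∷ xs) f g lt with f x <? g x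
... | yes p = x , p
... | no ¬p = ∑-pigeonhole xs f g (+-cancelˡ-< (g x) _ _ (≤-<-trans (+-monoˡ-≤ _ (≮⇒≥ ¬p)) lt))

𝟙 : {P : Set} → Dec P → ℕ
𝟙 (yes _) = 1
𝟙 (no _)  = 0

𝟙-yes : {P : Set} (d : Dec P) → P → 𝟙 d ≡ 1
𝟙-yes (yes _) p = refl
𝟙-yes (no ¬p) p = ⊥-elim (¬p p)

𝟙-no : {P : Set} (d : Dec P) → ¬ P → 𝟙 d ≡ 0
𝟙-no (yes p) ¬p = ⊥-elim (¬p p)
𝟙-no (no _)  ¬p = refl

𝟙≤1 : {P : Set} (d : Dec P) → 𝟙 d ≤ 1
𝟙≤1 (yes _) = ≤-refl
𝟙≤1 (no _)  = z≤n

𝟙-≤ : {P : Set} (d : Dec P) {m : ℕ} → (P → 1 ≤ m) → 𝟙 d ≤ m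
𝟙-≤ (yes p) h = h p
𝟙-≤ (no _)  h = z≤n

𝟙-mono : {P Q : Set} (d : Dec P) (e : Dec Q) → (P → Q) → 𝟙 d ≤ 𝟙 e
𝟙-mono d e h = 𝟙-≤ d λ p → ≤-reflexive (sym (𝟙-yes e (h p)))

𝟙-cong : {P Q : Set} (d : Dec P) (e : Dec Q) → (P → Q) → (Q → P) → 𝟙 d ≡ 𝟙 e
𝟙-cong d e f g = ≤-antisym (𝟙-mono d e f) (𝟙-mono e d g)

𝟙-× : {P Q : Set} (d : Dec P) (e : Dec Q) → 𝟙 (d ×-dec e) ≡ 𝟙 d * 𝟙 e
𝟙-× (yes _) (yes _) = refl
𝟙-× (yes _) (no _)  = refl
𝟙-× (no _)  e       = refl

𝟙*-mono : {P : Set} (d : Dec P) {a b : ℕ} → (P → a ≤ b) → 𝟙 d * a ≤ 𝟙 d * b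
𝟙*-mono (yes p) h = *-monoʳ-≤ 1 (h p)
𝟙*-mono (no _)  h = z≤n

# : {n : ℕ} {P : Fin n → Set} → (∀ x → Dec (P x)) → ℕ
# {n} P? = ∑ (allFin n) (λ x → 𝟙 (P? x))

#-mono : {n : ℕ} {P Q : Fin n → Set} (P? : ∀ x → Dec (P x)) (Q? : ∀ x → Dec (Q x)) →
         (∀ x → P x → Q x) → # P? ≤ # Q?
#-mono P? Q? h = ∑-mono (allFin _) λ x → 𝟙-mono (P? x) (Q? x) (h x)

#-cong : {n : ℕ} {P Q : Fin n → Set} (P? : ∀ x → Dec (P x)) (Q? : ∀ x → Dec (Q x)) →
         (∀ x → P x → Q x) → (∀ x → Q x → P x) → # P? ≡ # Q?
#-cong P? Q? f g = ≤-antisym (#-mono P? Q? f) (#-mono Q? P? g)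

length-allFin : ∀ n → length (allFin n) ≡ n
length-allFin n = length-tabulate id

∑-allFin-const : ∀ n c → ∑ (allFin n) (λ _ → c) ≡ n * c
∑-allFin-const n c = trans (∑-const (allFin n) c) (cong (_* c) (length-allFin n))

#≤n : {n : ℕ} {P : Fin n → Set} (P? : ∀ x → Dec (P x)) → # P? ≤ n
#≤n {n} P? = ≤-trans (∑-mono (allFin n) (λ x → 𝟙≤1 (P? x)))
                     (≤-reflexive (trans (∑-allFin-const n 1) (*-identityʳ n)))

∑-allFin-suc : ∀ n (f : Fin (suc n) → ℕ) → ∑ (allFin (suc n)) f ≡ f fzero + ∑ (allFin n) (f ∘ fsuc)
∑-allFin-suc n f = cong (f fzero +_)
  (trans (cong (λ l → ∑ l f) (sym (map-tabulate id fsuc))) (∑-map fsuc (allFin n) f))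

#-singleton : {n : ℕ} (a : Fin n) → # (λ x → x ≟ᶠ a) ≡ 1
#-singleton {suc n} fzero = trans (∑-allFin-suc n (λ x → 𝟙 (x ≟ᶠ fzero)))
  (cong suc (trans (∑-cong (allFin n) (λ x → 𝟙-no (fsuc x ≟ᶠ fzero) λ ())) (∑-zero (allFin n))))
#-singleton {suc n} (fsuc a) = trans (∑-allFin-suc n (λ x → 𝟙 (x ≟ᶠ fsuc a)))
  (trans (cong (_+ ∑ (allFin n) (λ x → 𝟙 (fsuc x ≟ᶠ fsuc a))) (𝟙-no (fzero ≟ᶠ fsuc a) λ ()))
    (trans (∑-cong (allFin n) (λ x → 𝟙-cong (fsuc x ≟ᶠ fsuc a) (x ≟ᶠ a) fsuc-injective (cong fsuc)))
           (#-singleton a)))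

_∈?_ : {n : ℕ} (x : Fin n) (L : List (Fin n)) → Dec (x ∈ L)
x ∈? []      = no λ ()
x ∈? (y ∷ L) with x ≟ᶠ y
... | yes e = yes (here e)
... | no ¬e = map′ there (λ { (here e) → ⊥-elim (¬e e) ; (there p) → p }) (x ∈? L)

#-list : {n : ℕ} (L : List (Fin n)) → # (_∈? L) ≤ length L
#-list {n} []      = ≤-reflexive (∑-zero (allFin n))
#-list {n} (y ∷ L) = ≤-trans
  (∑-mono (allFin n) {g = λ x → 𝟙 (x ≟ᶠ y) + 𝟙 (x ∈? L)}
    λ x → 𝟙-≤ (x ∈? (y ∷ L)) λ
      { (here e)  → ≤-trans (≤-reflexive (sym (𝟙-yes (x ≟ᶠ y) e))) (m≤m+n _ _)
      ; (there p) → ≤-trans (≤-reflexive (sym (𝟙-yes (x ∈? L) p))) (m≤n+m _ _) })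
  (≤-trans (≤-reflexive (∑-+ (allFin n) _ _)) (+-mono-≤ (≤-reflexive (#-singleton y)) (#-list L)))

pick : {n : ℕ} {P : Fin n → Set} (P? : ∀ x → Dec (P x)) (L : List (Fin n)) →
       length L < # P? → ∃[ x ] P x × x ∉ L
pick {n} P? L lt with ∑-pigeonhole (allFin n) (λ x → 𝟙 (x ∈? L)) (λ x → 𝟙 (P? x)) (≤-<-trans (#-list L) lt)
... | x , p with P? x | x ∈? L
... | yes px | no x∉L = x , px , x∉L
... | yes px | yes _  = ⊥-elim (<-irrefl refl p)

#-split : {n : ℕ} {P Q : Fin n → Set} (P? : ∀ x → Dec (P x)) (Q? : ∀ x → Dec (Q x)) →
          # P? ≤ # (λ x → P? x ×-dec Q? x) + # (λ x → P? x ×-dec ¬? (Q? x))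
#-split {n} P? Q? = ≤-trans (∑-mono (allFin n) λ x → pt (P? x) (Q? x)) (≤-reflexive (∑-+ (allFin n) _ _))
  where
  pt : {A B : Set} (d : Dec A) (e : Dec B) → 𝟙 d ≤ 𝟙 (d ×-dec e) + 𝟙 (d ×-dec ¬? e)
  pt (yes _) (yes _) = s≤s z≤n
  pt (yes _) (no _)  = s≤s z≤n
  pt (no _)  e       = z≤n

∑-downFrom-shift : ∀ m (f : ℕ → ℕ) → f 0 + ∑ (downFrom m) (f ∘ suc) ≡ f m + ∑ (downFrom m) f
∑-downFrom-shift zero    f = refl
∑-downFrom-shift (suc m) f = begin
  f 0 + (f (suc m) + ∑ (downFrom m) (f ∘ suc)) ≡⟨ swap (f 0) (f (suc m)) _ ⟩
  f (suc m) + (f 0 + ∑ (downFrom m) (f ∘ suc)) ≡⟨ cong (f (suc m) +_) (∑-downFrom-shift m f) ⟩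
  f (suc m) + (f m + ∑ (downFrom m) f)         ∎
  where
  open ≡-Reasoning
  swap : ∀ a b c → a + (b + c) ≡ b + (a + c)
  swap = solve-∀

∑-periodic : ∀ m (f : ℕ → ℕ) → (∀ i → f (i + m) ≡ f i) → ∀ a →
             ∑ (downFrom m) (λ i → f (a + i)) ≡ ∑ (downFrom m) f
∑-periodic m f per zero    = refl
∑-periodic m f per (suc a) = trans
  (∑-cong (downFrom m) λ i → cong f (sym (+-suc a i)))
  (trans (+-cancelˡ-≡ (f (a + 0)) _ _
           (trans (∑-downFrom-shift m (λ i → f (a + i)))
                  (cong (_+ ∑ (downFrom m) (λ i → f (a + i)))
                        (trans (per a) (cong f (sym (+-identityʳ a)))))))
         (∑-periodic m f per a))

∑-downFrom-singleton : ∀ m c → ∑ (downFrom m) (λ i → 𝟙 (i ≟ c)) ≤ 1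
∑-downFrom-singleton m c = go m
  where
  below : ∀ m → m ≤ c → ∑ (downFrom m) (λ i → 𝟙 (i ≟ c)) ≤ 0
  below zero    _ = z≤n
  below (suc m) l rewrite 𝟙-no (m ≟ c) (λ e → <-irrefl e l) = below m (≤-trans (n≤1+n m) l)
  go : ∀ m → ∑ (downFrom m) (λ i → 𝟙 (i ≟ c)) ≤ 1
  go zero    = z≤n
  go (suc m) with m ≟ c
  ... | yes refl = s≤s (below m ≤-refl)
  ... | no _     = go m

-- Inequalities for powers

pos-right : ∀ a b → 0 < a * b → 0 < b
pos-right a zero    l = subst (0 <_) (*-zeroʳ a) l
pos-right a (suc b) l = s≤s z≤n

bernoulli : ∀ a d m → a ^ suc m + suc m * d * a ^ m ≤ (a + d) ^ suc m
bernoulli a d zero    = ≤-reflexive (eq a d)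
  where
  eq : ∀ a d → a * 1 + 1 * d * 1 ≡ (a + d) * 1
  eq = solve-∀
bernoulli a d (suc m) = begin
  a * (a * p) + (suc (suc m)) * d * (a * p)        ≤⟨ m≤m+n _ (d * (suc m * d * p)) ⟩
  a * (a * p) + (suc (suc m)) * d * (a * p) + d * (suc m * d * p) ≡⟨ eq a d p m ⟩
  (a + d) * (a * p + suc m * d * p)  ≤⟨ *-monoʳ-≤ (a + d) (bernoulli a d m) ⟩
  (a + d) * (a + d) ^ suc m                        ∎
  where
  open ≤-Reasoning
  p = a ^ m
  eq : ∀ a d p m → a * (a * p) + (2 + m) * d * (a * p) + d * ((1 + m) * d * p)
                   ≡ (a + d) * (a * p + (1 + m) * d * p)
  eq = solve-∀

-- Bernoulli's inequality for a negative increment: the tangent is taken at the upper end `b + e`,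
-- which avoids subtraction.
bernoulli⁻ : ∀ b e m → (b + e) ^ suc m ≤ b ^ suc m + suc m * e * (b + e) ^ m
bernoulli⁻ b e zero    = ≤-reflexive (eq b e)
  where
  eq : ∀ b e → (b + e) * 1 ≡ b * 1 + 1 * e * 1
  eq = solve-∀
bernoulli⁻ b e (suc m) = begin
  (b + e) * q  ≡⟨ *-distribʳ-+ q b e ⟩
  b * q + e * q  ≤⟨ +-monoˡ-≤ (e * q) (*-monoʳ-≤ b (bernoulli⁻ b e m)) ⟩
  b * (b ^ suc m + suc m * e * p) + e * q        ≡⟨ eq₁ b e p m (b ^ suc m) q ⟩
  b * b ^ suc m + suc m * e * (b * p) + e * q    ≤⟨ +-monoˡ-≤ (e * q) (+-monoʳ-≤ (b * b ^ suc m)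
            (*-monoʳ-≤ (suc m * e) (*-monoˡ-≤ p (m≤m+n b e)))) ⟩
  b * b ^ suc m + suc m * e * q + e * q  ≡⟨ eq₂ (b * b ^ suc m) m e q ⟩
  b * b ^ suc m + suc (suc m) * e * q            ∎
  where
  open ≤-Reasoning
  p = (b + e) ^ m
  q = (b + e) ^ suc m
  eq₁ : ∀ b e p m r q → b * (r + (1 + m) * e * p) + e * q ≡ b * r + (1 + m) * e * (b * p) + e * q
  eq₁ = solve-∀
  eq₂ : ∀ r m e q → r + (1 + m) * e * q + e * q ≡ r + (2 + m) * e * q
  eq₂ = solve-∀

*-^ : ∀ a b m → (a * b) ^ m ≡ a ^ m * b ^ m
*-^ a b zero    = refl
*-^ a b (suc m) rewrite *-^ a b m = eq a b (a ^ m) (b ^ m)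
  where
  eq : ∀ a b x y → a * b * (x * y) ≡ a * x * (b * y)
  eq = solve-∀

-- AM-GM for one number `x` and `m` copies of `y`. Both cases compare the power with its tangent at
-- `suc m * y`; they differ in the sign of x - y.
am-gm-one : ∀ m x y → suc m ^ suc m * (x * y ^ m) ≤ (x + m * y) ^ suc m
am-gm-one m x y with ≤-total y x
... | inj₁ y≤x with m≤n⇒∃[o]m+o≡n y≤x
...   | d , refl = begin
  suc m ^ suc m * ((y + d) * y ^ m)  ≡⟨ eq₁ m y d (suc m ^ m) (y ^ m) ⟩
  (suc m * y) * (suc m ^ m * y ^ m) + suc m * d * (suc m ^ m * y ^ m)
            ≡⟨ cong (λ t → suc m * y * t + suc m * d * t) (sym (*-^ (suc m) y m)) ⟩
  (suc m * y) ^ suc m + suc m * d * (suc m * y) ^ m       ≤⟨ bernoulli (suc m * y) d m ⟩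
  (suc m * y + d) ^ suc m  ≡⟨ cong (_^ suc m) (eq₂ m y d) ⟩
  (y + d + m * y) ^ suc m                                 ∎
  where
  open ≤-Reasoning
  eq₁ : ∀ m y d s t → (1 + m) * s * ((y + d) * t) ≡ (1 + m) * y * (s * t) + (1 + m) * d * (s * t)
  eq₁ = solve-∀
  eq₂ : ∀ m y d → (1 + m) * y + d ≡ y + d + m * y
  eq₂ = solve-∀
am-gm-one m x y | inj₂ x≤y with m≤n⇒∃[o]m+o≡n x≤y
... | e , refl = +-cancelʳ-≤ (suc m * e * a ^ m) _ _ (begin
  suc m ^ suc m * (x * (x + e) ^ m) + suc m * e * a ^ m  ≡⟨ cong (λ t → suc m ^ suc m * (x * (x + e) ^ m) + suc m * e * t) (*-^ (suc m) (x + e) m) ⟩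
  suc m ^ suc m * (x * (x + e) ^ m) + suc m * e * (suc m ^ m * (x + e) ^ m)
            ≡⟨ eq₁ m x e (suc m ^ m) ((x + e) ^ m) ⟩
  suc m * (x + e) * (suc m ^ m * (x + e) ^ m)  ≡⟨ cong (a *_) (sym (*-^ (suc m) (x + e) m)) ⟩
  a ^ suc m  ≡⟨ cong (_^ suc m) (eq₂ m x e) ⟩
  (b + e) ^ suc m  ≤⟨ bernoulli⁻ b e m ⟩
  b ^ suc m + suc m * e * (b + e) ^ m  ≡⟨ cong (λ t → b ^ suc m + suc m * e * t ^ m) (sym (eq₂ m x e)) ⟩
  b ^ suc m + suc m * e * a ^ m                          ∎)
  where
  open ≤-Reasoning
  a = suc m * (x + e)
  b = x + m * (x + e)
  eq₁ : ∀ m x e s t → (1 + m) * s * (x * t) + (1 + m) * e * (s * t) ≡ (1 + m) * (x + e) * (s * t)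
  eq₁ = solve-∀
  eq₂ : ∀ m x e → (1 + m) * (x + e) ≡ x + m * (x + e) + e
  eq₂ = solve-∀

-- This is `am-gm-one` at `m * a` and `b`, divided by `m`. It is the induction step of AM-GM, with
-- `b` as the sum of the `m` remaining numbers.
am-gm-step : ∀ m a b → suc m ^ suc m * (a * b ^ m) ≤ m ^ m * (a + b) ^ suc m
am-gm-step zero    a b = subst₂ _≤_ (eq₁ a) (eq₂ (a + b)) (m≤m+n a b)
  where
  eq₁ : ∀ a → a ≡ 1 * 1 * (a * 1)
  eq₁ = solve-∀
  eq₂ : ∀ c → c ≡ 1 * (c * 1)
  eq₂ = solve-∀
am-gm-step m@(suc _) a b = *-cancelˡ-≤ m (begin
  m * (suc m ^ suc m * (a * b ^ m))   ≡⟨ eq₁ m (suc m ^ suc m) a (b ^ m) ⟩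
  suc m ^ suc m * (m * a * b ^ m)     ≤⟨ am-gm-one m (m * a) b ⟩
  (m * a + m * b) ^ suc m  ≡⟨ cong (_^ suc m) (sym (*-distribˡ-+ m a b)) ⟩
  (m * (a + b)) ^ suc m  ≡⟨ *-^ m (a + b) (suc m) ⟩
  m * m ^ m * (a + b) ^ suc m  ≡⟨ *-assoc m (m ^ m) _ ⟩
  m * (m ^ m * (a + b) ^ suc m)       ∎)
  where
  open ≤-Reasoning
  eq₁ : ∀ m s a t → m * (s * (a * t)) ≡ s * (m * a * t)
  eq₁ = solve-∀

-- Walks, paths and cycles

-- Doubling by recursion: lengths such as `5 + dbl g` then reduce by computation, and parities can
-- be matched on.
dbl : ℕ → ℕ
dbl zero    = zero
dbl (suc m) = suc (suc (dbl m))

dbl-+ : ∀ a b → dbl (a + b) ≡ dbl a + dbl b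
dbl-+ zero    b = refl
dbl-+ (suc a) b = cong (suc ∘ suc) (dbl-+ a b)

dbl≡+ : ∀ a → dbl a ≡ a + a
dbl≡+ zero    = refl
dbl≡+ (suc a) = cong suc (trans (cong suc (dbl≡+ a)) (sym (+-suc a a)))

parity : ∀ m → (∃[ e ] m ≡ dbl e) ⊎ (∃[ e ] m ≡ suc (dbl e))
parity zero    = inj₁ (0 , refl)
parity (suc m) with parity m
... | inj₁ (e , refl) = inj₂ (e , refl)
... | inj₂ (e , refl) = inj₁ (suc e , refl)

dbl≢suc-dbl : ∀ a b → dbl a ≢ suc (dbl b)
dbl≢suc-dbl zero    b ()
dbl≢suc-dbl (suc a) zero ()
dbl≢suc-dbl (suc a) (suc b) e = dbl≢suc-dbl a b (suc-injective (suc-injective e))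

dbl-mono-≤ : ∀ {a b} → a ≤ b → dbl a ≤ dbl b
dbl-mono-≤ z≤n     = z≤n
dbl-mono-≤ (s≤s l) = s≤s (s≤s (dbl-mono-≤ l))

dbl-cancel-≤ : ∀ a b → dbl a ≤ dbl b → a ≤ b
dbl-cancel-≤ zero    b       l             = z≤n
dbl-cancel-≤ (suc a) (suc b) (s≤s (s≤s l)) = s≤s (dbl-cancel-≤ a b l)

dbl-cancel-≤ˢ : ∀ a b → dbl a ≤ suc (dbl b) → a ≤ b
dbl-cancel-≤ˢ zero    b       l             = z≤n
dbl-cancel-≤ˢ (suc a) zero    (s≤s ())
dbl-cancel-≤ˢ (suc a) (suc b) (s≤s (s≤s l)) = s≤s (dbl-cancel-≤ˢ a b l)

-- The cycle length: every odd k ≥ 7 is κ g for some g.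
κ : ℕ → ℕ
κ g = 7 + dbl g

module Walks {n : ℕ} (A : Fin n → Fin n → Set) where

  Walk : ℕ → Fin n → Fin n → Set
  Walk zero    u v = u ≡ v
  Walk (suc m) u v = ∃[ w ] (A u w × Walk m w v)

  walk? : (∀ u v → Dec (A u v)) → ∀ m u v → Dec (Walk m u v)
  walk? A? zero    u v = u ≟ᶠ v
  walk? A? (suc m) u v = any? λ w → A? u w ×-dec walk? A? m w v

  walk-++ : ∀ l {m u v w} → Walk l u v → Walk m v w → Walk (l + m) u w
  walk-++ zero    refl         q = q
  walk-++ (suc l) (x , a , p) q = x , a , walk-++ l p q

  walk-rev : (∀ {u v} → A u v → A v u) → ∀ m {u v} → Walk m u v → Walk m v u
  walk-rev A-sym zero    refl = refl
  walk-rev A-sym (suc m) {u} {v} (x , a , p) =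
    subst (λ l → Walk l v u) (+-comm m 1) (walk-++ m (walk-rev A-sym m p) (u , A-sym a , refl))

  walk-along : (x : ℕ → Fin n) → (∀ i → A (x i) (x (suc i))) → ∀ d a → Walk d (x a) (x (a + d))
  walk-along x step zero    a = cong x (sym (+-identityʳ a))
  walk-along x step (suc d) a = x (suc a) , step a ,
    subst (λ b → Walk d (x (suc a)) (x b)) (sym (+-suc a d)) (walk-along x step d (suc a))

  walk-seq : ∀ m {u v} → Walk m u v → ℕ → Fin n
  walk-seq zero    {u} p           i       = u
  walk-seq (suc m) {u} p           zero    = u
  walk-seq (suc m) {u} (_ , _ , p) (suc i) = walk-seq m p i

  walk-seq-0 : ∀ m {u v} (p : Walk m u v) → walk-seq m p 0 ≡ u
  walk-seq-0 zero    p = refl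
  walk-seq-0 (suc m) p = refl

  walk-seq-last : ∀ m {u v} (p : Walk m u v) → walk-seq m p m ≡ v
  walk-seq-last zero    p           = p
  walk-seq-last (suc m) (_ , _ , p) = walk-seq-last m p

  walk-seq-step : ∀ m {u v} (p : Walk m u v) i → i < m → A (walk-seq m p i) (walk-seq m p (suc i))
  walk-seq-step (suc m) {u} (x , a , p) zero    _       = subst (A u) (sym (walk-seq-0 m p)) a
  walk-seq-step (suc m)     (x , a , p) (suc i) (s≤s l) = walk-seq-step m p i l

  -- The list holds the vertices to avoid; it accumulates those already visited.
  Path : ℕ → List (Fin n) → Fin n → Fin n → Set
  Path zero    L u w = u ∉ L × u ≡ w
  Path (suc m) L u w = u ∉ L × ∃[ x ] (A u x × Path m (u ∷ L) x w)

  path? : (∀ u v → Dec (A u v)) → ∀ m L u w → Dec (Path m L u w)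
  path? A? zero    L u w = ¬? (u ∈? L) ×-dec (u ≟ᶠ w)
  path? A? (suc m) L u w = ¬? (u ∈? L) ×-dec any? λ x → A? u x ×-dec path? A? m (u ∷ L) x w

  visited : ∀ m {L u w} → Path m L u w → List (Fin n)
  visited zero    {L} {u} _               = u ∷ L
  visited (suc m)         (_ , _ , _ , p) = visited m p

  length-visited : ∀ m {L u w} (p : Path m L u w) → length (visited m p) ≡ suc m + length L
  length-visited zero        _               = refl
  length-visited (suc m) {L} (_ , _ , _ , p) = trans (length-visited m p) (cong suc (+-suc m (length L)))

  path-++ : ∀ m {r L u v y w} (p : Path m L u v) → A v y → Path r (visited m p) y w → Path (m + suc r) L u w
  path-++ zero    (u∉L , refl)        b q = u∉L , _ , b , q
  path-++ (suc m) (u∉L , x , a , p) b q = u∉L , x , a , path-++ m p b q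

  path-seq : ∀ m {L u w} → Path m L u w → ℕ → Fin n
  path-seq zero    {L} {u} p               i       = u
  path-seq (suc m) {L} {u} p               zero    = u
  path-seq (suc m)         (_ , _ , _ , p) (suc i) = path-seq m p i

  path-seq-0 : ∀ m {L u w} (p : Path m L u w) → path-seq m p 0 ≡ u
  path-seq-0 zero    p = refl
  path-seq-0 (suc m) p = refl

  path-seq-last : ∀ m {L u w} (p : Path m L u w) → path-seq m p m ≡ w
  path-seq-last zero    (_ , e)         = e
  path-seq-last (suc m) (_ , _ , _ , p) = path-seq-last m p

  path-seq-step : ∀ m {L u w} (p : Path m L u w) i → i < m → A (path-seq m p i) (path-seq m p (suc i))
  path-seq-step (suc m) {u = u} (_ , x , a , p) zero    _       = subst (A u) (sym (path-seq-0 m p)) a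
  path-seq-step (suc m)         (_ , x , a , p) (suc i) (s≤s l) = path-seq-step m p i l

  path-seq-∉ : ∀ m {L u w} (p : Path m L u w) i → path-seq m p i ∉ L
  path-seq-∉ zero    (u∉L , _)       i       = u∉L
  path-seq-∉ (suc m) (u∉L , _)       zero    = u∉L
  path-seq-∉ (suc m) (_ , _ , _ , p) (suc i) = path-seq-∉ m p i ∘ there

  path-seq-inj : ∀ m {L u w} (p : Path m L u w) i j → i ≤ m → j ≤ m → path-seq m p i ≡ path-seq m p j → i ≡ j
  path-seq-inj zero    p               zero    zero    _       _        e = refl
  path-seq-inj (suc m) p               zero    zero    _       _        e = refl
  path-seq-inj (suc m) (_ , _ , _ , p) zero    (suc j) _       _        e = ⊥-elim (path-seq-∉ m p j (here (sym e)))
  path-seq-inj (suc m) (_ , _ , _ , p) (suc i) zero    _       _        e = ⊥-elim (path-seq-∉ m p i (here e))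
  path-seq-inj (suc m) (_ , _ , _ , p) (suc i) (suc j) (s≤s l) (s≤s l′) e = cong suc (path-seq-inj m p i j l l′ e)

  seq-path : ∀ m (f : ℕ → Fin n) L → (∀ i → i < m → A (f i) (f (suc i))) →
             (∀ i → i ≤ m → f i ∉ L) → (∀ i j → i < j → j ≤ m → f i ≢ f j) → Path m L (f 0) (f m)
  seq-path zero    f L st av inj = av 0 z≤n , refl
  seq-path (suc m) f L st av inj = av 0 z≤n , f 1 , st 0 (s≤s z≤n) ,
    seq-path m (f ∘ suc) (f 0 ∷ L) (λ i l → st (suc i) (s≤s l))
      (λ { i l (here e) → inj 0 (suc i) (s≤s z≤n) (s≤s l) (sym e) ; i l (there p) → av (suc i) (s≤s l) p })
      (λ i j l l′ → inj (suc i) (suc j) (s≤s l) (s≤s l′))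

  OddCycle≤ : ℕ → Set
  OddCycle≤ m = ∃[ e ] (suc (dbl e) ≤ m × ∃[ u ] ∃[ w ] (Path (dbl e) [] u w × A w u))

  oddCycle-mono : ∀ {l m} → l ≤ m → OddCycle≤ l → OddCycle≤ m
  oddCycle-mono l≤m (e , b , r) = e , ≤-trans b l≤m , r

  -- A repeated vertex splits a closed odd walk into two closed walks, one of which is odd and shorter.
  closed-odd : ∀ fuel m (f : ℕ → Fin n) → m ≤ fuel → (∀ i → i < m → A (f i) (f (suc i))) →
               f m ≡ f 0 → ∃[ e ] m ≡ suc (dbl e) → OddCycle≤ m
  closed-odd fuel zero _ _ _ _ (e , ())
  closed-odd (suc fuel) (suc m) f (s≤s m≤fuel) st cl (e , refl)
    with any? {n = suc m} (λ j → any? {n = toℕ j} λ i → f (toℕ i) ≟ᶠ f (toℕ j))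
  ... | no none = e , ≤-refl , f 0 , f m , seq-path m f [] (λ i l → st i (m≤n⇒m≤1+n l)) (λ _ _ ())
          (λ i j i<j j≤m eq → none (fromℕ< (s≤s j≤m) , fromℕ< (≤-trans i<j (≤-reflexive (sym (toℕ-fromℕ< (s≤s j≤m))))) ,
             trans (cong f (toℕ-fromℕ< _)) (trans eq (cong f (sym (toℕ-fromℕ< (s≤s j≤m))))))) ,
          subst (A (f m)) cl (st m ≤-refl)
  ... | yes (j , i , eq) = split (toℕ i) (toℕ j) (toℕ<n i) (toℕ<n j) eq
    where
    split : ∀ i j → i < j → j < suc m → f i ≡ f j → OddCycle≤ (suc m)
    split i j i<j j<sm eq with m≤n⇒∃[o]m+o≡n (<⇒≤ i<j)
    split i j i<j j<sm eq | l , refl with m≤n⇒∃[o]m+o≡n (<⇒≤ j<sm)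
    split i j i<j j<sm eq | l , refl | r , i+l+r≡sm with parity l
    ... | inj₂ (e′ , refl) = oddCycle-mono (≤-trans (m≤n+m l i) (<⇒≤ j<sm))
            (closed-odd fuel l (λ t → f (i + t)) (≤-trans (m≤n+m l i) (≤-trans (≤-pred j<sm) m≤fuel))
              (λ t t<l → subst (λ z → A (f (i + t)) (f z)) (sym (+-suc i t))
                           (st (i + t) (≤-trans (+-monoʳ-< i t<l) (<⇒≤ j<sm))))
              (trans (sym eq) (cong f (sym (+-identityʳ i)))) (e′ , refl))
    ... | inj₁ (e′ , l≡) = oddCycle-mono i+r≤sm
            (closed-odd fuel (i + r) h (≤-trans (≤-pred i+r<sm) m≤fuel) h-step h-closed odd)
      where
      -- The walk with its even loop between the positions `i` and `i + l` cut out.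
      h : ℕ → Fin n
      h t with t <? i
      ... | yes _ = f t
      ... | no  _ = f (t + l)
      h-< : ∀ t → t < i → h t ≡ f t
      h-< t t<i with t <? i
      ... | yes _  = refl
      ... | no t≮i = ⊥-elim (t≮i t<i)
      h-≥ : ∀ t → i ≤ t → h t ≡ f (t + l)
      h-≥ t i≤t with t <? i
      ... | yes t<i = ⊥-elim (<⇒≱ t<i i≤t)
      ... | no _    = refl
      assoc : i + r + l ≡ suc m
      assoc = trans (trans (+-assoc i r l) (trans (cong (i +_) (+-comm r l)) (sym (+-assoc i l r)))) i+l+r≡sm
      0<l : 0 < l
      0<l = +-cancelˡ-< i 0 l (subst (_< i + l) (sym (+-identityʳ i)) i<j)
      i+r<sm : i + r < suc m
      i+r<sm = subst (i + r <_) assoc (subst (_< i + r + l) (+-identityʳ (i + r)) (+-monoʳ-< (i + r) 0<l))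
      i+r≤sm : i + r ≤ suc m
      i+r≤sm = <⇒≤ i+r<sm
      h-step : ∀ t → t < i + r → A (h t) (h (suc t))
      h-step t t<ir with <-cmp (suc t) i
      ... | tri< st<i _ _ = subst₂ A (sym (h-< t (<⇒≤ st<i))) (sym (h-< (suc t) st<i))
                              (st t (≤-trans (<⇒≤ st<i) (≤-trans (m≤m+n i l) (<⇒≤ j<sm))))
      ... | tri≈ _ st≡i _ = subst₂ A (sym (h-< t (≤-reflexive st≡i)))
                              (sym (trans (h-≥ (suc t) (≤-reflexive (sym st≡i)))
                                 (trans (cong (λ z → f (z + l)) st≡i) (trans (sym eq) (cong f (sym st≡i))))))
                              (st t (≤-trans (≤-reflexive st≡i) (≤-trans (m≤m+n i l) (<⇒≤ j<sm))))
      ... | tri> _ _ i<st = subst₂ A (sym (h-≥ t (≤-pred i<st))) (sym (h-≥ (suc t) (<⇒≤ i<st)))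
                              (st (t + l) (subst (t + l <_) assoc (+-monoˡ-< l t<ir)))
      h-closed : h (i + r) ≡ h 0
      h-closed = trans (h-≥ (i + r) (m≤m+n i r)) (trans (cong f assoc) (trans cl (sym (h0 i refl))))
        where
        h0 : ∀ i′ → i ≡ i′ → h 0 ≡ f 0
        h0 zero     i≡ = trans (h-≥ 0 (≤-reflexive i≡)) (trans (cong (λ z → f (z + l)) (sym i≡)) (trans (sym eq) (cong f i≡)))
        h0 (suc i′) i≡ = h-< 0 (subst (0 <_) (sym i≡) (s≤s z≤n))
      odd : ∃[ e″ ] i + r ≡ suc (dbl e″)
      odd with parity (i + r)
      ... | inj₂ q        = q
      ... | inj₁ (e″ , p) = ⊥-elim (dbl≢suc-dbl (e″ + e′) e
              (trans (dbl-+ e″ e′) (trans (cong₂ _+_ (sym p) (sym l≡)) assoc)))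

module _ {n : ℕ} {A B : Fin n → Fin n → Set} (A⊆B : ∀ {u v} → A u v → B u v) where

  path-map : ∀ m {L u w} → Walks.Path A m L u w → Walks.Path B m L u w
  path-map zero    p                 = p
  path-map (suc m) (u∉L , x , a , p) = u∉L , x , A⊆B a , path-map m p

Adj : {n : ℕ} → Graph n → Fin n → Fin n → Set
Adj G u v = adj G u v ≡ true

adj? : {n : ℕ} (G : Graph n) → ∀ u v → Dec (Adj G u v)
adj? G u v with adj G u v
... | true  = yes refl
... | false = no λ ()

Adj-sym : {n : ℕ} (G : Graph n) → ∀ {u v} → Adj G u v → Adj G v u
Adj-sym G {u} {v} a = trans (adj-sym G v u) a

Adj-irrefl : {n : ℕ} (G : Graph n) → ∀ {u} → ¬ Adj G u u
Adj-irrefl G {u} a with trans (sym a) (adj-irrefl G u)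
... | ()

toℕ-next : ∀ {m} (i : Fin (suc m)) → toℕ (next i) ≡ suc (toℕ i) % suc m
toℕ-next {m} i = toℕ-fromℕ< (m%n<n (suc (toℕ i)) (suc m))

close-path : {n : ℕ} (G : Graph n) → ∀ m {u w} → Walks.Path (Adj G) m [] u w → Adj G w u → HasCycle (suc m) G
close-path {n} G m {u} {w} p a = f ∘ toℕ , inj , step
  where
  open Walks (Adj G)
  f : ℕ → Fin n
  f = path-seq m p
  inj : ∀ {i j} → f (toℕ i) ≡ f (toℕ j) → i ≡ j
  inj {i} {j} e = toℕ-injective (path-seq-inj m p (toℕ i) (toℕ j) (≤-pred (toℕ<n i)) (≤-pred (toℕ<n j)) e)
  step : ∀ i → Adj G (f (toℕ i)) (f (toℕ (next i)))
  step i with m≤n⇒m<n∨m≡n (≤-pred (toℕ<n i))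
  ... | inj₁ i<m = subst (λ z → Adj G (f (toℕ i)) (f z))
                     (sym (trans (toℕ-next i) (m<n⇒m%n≡m (s≤s i<m)))) (path-seq-step m p (toℕ i) i<m)
  ... | inj₂ i≡m = subst₂ (λ y z → Adj G (f y) (f z)) (sym i≡m)
                     (sym (trans (toℕ-next i) (trans (cong (λ z → suc z % suc m) i≡m) (n%n≡0 (suc m)))))
                     (subst₂ (Adj G) (sym (path-seq-last m p)) (sym (path-seq-0 m p)) a)

-- Edges in short odd cycles

∑∑ : {n : ℕ} {B : Fin n → Fin n → Set} → (∀ u v → Dec (B u v)) → ℕ
∑∑ {n} B? = ∑ (allFin n) λ u → # (B? u)

#-∷ : {n : ℕ} (x : Fin n) (L : List (Fin n)) → x ∉ L → suc (# (_∈? L)) ≤ # (_∈? (x ∷ L))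
#-∷ {n} x L x∉L = begin
  suc (# (_∈? L))  ≡⟨ cong (_+ # (_∈? L)) (sym (#-singleton x)) ⟩
  # (_≟ᶠ x) + # (_∈? L)  ≡⟨ sym (∑-+ (allFin n) _ _) ⟩
  ∑ (allFin n) (λ y → 𝟙 (y ≟ᶠ x) + 𝟙 (y ∈? L))       ≤⟨ ∑-mono (allFin n) pt ⟩
  # (_∈? (x ∷ L))                                    ∎
  where
  open ≤-Reasoning
  pt : ∀ y → 𝟙 (y ≟ᶠ x) + 𝟙 (y ∈? L) ≤ 𝟙 (y ∈? (x ∷ L))
  pt y with y ≟ᶠ x
  ... | yes refl rewrite 𝟙-no (y ∈? L) x∉L = ≤-refl
  ... | no _     = 𝟙-mono (y ∈? L) _ there

module _ {n : ℕ} {B : Fin n → Fin n → Set} (B? : ∀ u v → Dec (B u v)) where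

  -- Averaging over y ∈ Y finds a vertex outside L joined to a 1/(4M) fraction of Y.
  rich-vertex : ∀ M {Y : Fin n → Set} (Y? : ∀ y → Dec (Y y)) (L : List (Fin n)) →
    (∀ y → Y y → n ≤ 2 * M * # (λ x → B? x y)) → 4 * M * length L ≤ n → 0 < n → 0 < # Y? →
    ∃[ x ] (x ∉ L × # Y? ≤ 4 * M * # (λ y → Y? y ×-dec B? x y))
  rich-vertex M {Y} Y? L rich small 0<n 0<Y = result
    where
    open ≤-Reasoning
    h : Fin n → ℕ
    h x = 𝟙 (¬? (x ∈? L)) * (4 * M * # (λ y → Y? y ×-dec B? x y))

    per-y : ∀ y → Y y → n ≤ 4 * M * ∑ (allFin n) (λ x → 𝟙 (¬? (x ∈? L)) * 𝟙 (B? x y))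
    per-y y Yy = +-cancelʳ-≤ n _ _ (begin
      n + n  ≤⟨ +-mono-≤ (rich y Yy) (rich y Yy) ⟩
      2 * M * # (λ x → B? x y) + 2 * M * # (λ x → B? x y) ≡⟨ eq₁ M _ ⟩
      4 * M * # (λ x → B? x y)  ≤⟨ *-monoʳ-≤ (4 * M) (∑-mono (allFin n) pt) ⟩
      4 * M * ∑ (allFin n) (λ x → 𝟙 (¬? (x ∈? L)) * 𝟙 (B? x y) + 𝟙 (x ∈? L)) ≡⟨ cong (4 * M *_) (∑-+ (allFin n) _ _) ⟩
      4 * M * (S + # (_∈? L))  ≤⟨ *-monoʳ-≤ (4 * M) (+-monoʳ-≤ S (#-list L)) ⟩
      4 * M * (S + length L)  ≡⟨ *-distribˡ-+ (4 * M) S (length L) ⟩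
      4 * M * S + 4 * M * length L  ≤⟨ +-monoʳ-≤ (4 * M * S) small ⟩
      4 * M * S + n                             ∎)
      where
      S = ∑ (allFin n) (λ x → 𝟙 (¬? (x ∈? L)) * 𝟙 (B? x y))
      eq₁ : ∀ M c → 2 * M * c + 2 * M * c ≡ 4 * M * c
      eq₁ = solve-∀
      pt : ∀ x → 𝟙 (B? x y) ≤ 𝟙 (¬? (x ∈? L)) * 𝟙 (B? x y) + 𝟙 (x ∈? L)
      pt x with x ∈? L
      ... | yes _ = 𝟙≤1 (B? x y)
      ... | no _  = ≤-reflexive (eq (𝟙 (B? x y)))
        where
        eq : ∀ a → a ≡ 1 * a + 0
        eq = solve-∀

    h-sum : ∑ (allFin n) (λ _ → # Y?) ≤ ∑ (allFin n) h
    h-sum = begin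
      ∑ (allFin n) (λ _ → # Y?)  ≡⟨ ∑-allFin-const n (# Y?) ⟩
      n * # Y?  ≡⟨ trans (*-comm n (# Y?)) (sym (∑-*ʳ (allFin n) n _)) ⟩
      ∑ (allFin n) (λ y → 𝟙 (Y? y) * n)  ≤⟨ ∑-mono (allFin n) (λ y → 𝟙*-mono (Y? y) (per-y y)) ⟩
      ∑ (allFin n) (λ y → 𝟙 (Y? y) * (4 * M * ∑ (allFin n) (λ x → 𝟙 (¬? (x ∈? L)) * 𝟙 (B? x y))))
        ≡⟨ ∑-cong (allFin n) (λ y → trans (eq₁ (𝟙 (Y? y)) (4 * M) _) (sym (∑-*ˡ (allFin n) (𝟙 (Y? y) * (4 * M)) _))) ⟩
      ∑ (allFin n) (λ y → ∑ (allFin n) (λ x → 𝟙 (Y? y) * (4 * M) * (𝟙 (¬? (x ∈? L)) * 𝟙 (B? x y))))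
        ≡⟨ ∑-comm (allFin n) (allFin n) _ ⟩
      ∑ (allFin n) (λ x → ∑ (allFin n) (λ y → 𝟙 (Y? y) * (4 * M) * (𝟙 (¬? (x ∈? L)) * 𝟙 (B? x y))))
        ≡⟨ ∑-cong (allFin n) (λ x → trans (∑-cong (allFin n) (λ y → trans (eq₂ (𝟙 (Y? y)) (4 * M) (𝟙 (¬? (x ∈? L))) (𝟙 (B? x y)))
                                        (cong (𝟙 (¬? (x ∈? L)) * (4 * M) *_) (sym (𝟙-× (Y? y) (B? x y))))))
                                  (trans (∑-*ˡ (allFin n) (𝟙 (¬? (x ∈? L)) * (4 * M)) _) (*-assoc (𝟙 (¬? (x ∈? L))) (4 * M) _))) ⟩
      ∑ (allFin n) h                                   ∎
      where
      eq₁ : ∀ a b c → a * (b * c) ≡ a * b * c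
      eq₁ = solve-∀
      eq₂ : ∀ a b c d → a * b * (c * d) ≡ c * b * (a * d)
      eq₂ = solve-∀

    result : ∃[ x ] (x ∉ L × # Y? ≤ 4 * M * # (λ y → Y? y ×-dec B? x y))
    result = conclude (∑-pigeonhole (allFin n) (λ _ → # Y?) (λ x → 1 + h x)
                  (≤-<-trans h-sum (subst (∑ (allFin n) h <_) (sym (trans (∑-+ (allFin n) (λ _ → 1) h)
                    (cong (_+ ∑ (allFin n) h) (trans (∑-allFin-const n 1) (*-identityʳ n)))))
                    (+-monoˡ-≤ (∑ (allFin n) h) 0<n))))
      where
      outside : ∀ x (d : Dec (x ∈ L)) → # Y? < 1 + 𝟙 (¬? d) * (4 * M * # (λ y → Y? y ×-dec B? x y)) →
                x ∉ L × # Y? ≤ 4 * M * # (λ y → Y? y ×-dec B? x y)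
      outside x (yes _)  lt = ⊥-elim (<⇒≱ 0<Y (≤-pred lt))
      outside x (no x∉L) lt = x∉L , ≤-trans (≤-pred lt) (≤-reflexive (*-identityˡ _))
      conclude : ∃[ x ] # Y? < 1 + h x → ∃[ x ] (x ∉ L × # Y? ≤ 4 * M * # (λ y → Y? y ×-dec B? x y))
      conclude (x , lt) = x , outside x (x ∈? L) lt

  CommonNeighbours : ℕ → ℕ → ℕ → Set₁
  CommonNeighbours M y t =
    ∃[ L ] (t ≤ # (_∈? L) × length L ≡ t ×
      Σ (Fin n → Set) λ Z → Σ (∀ y → Dec (Z y)) λ Z? →
        (∀ y → Z y → n ≤ 2 * M * # (λ x → B? x y)) × 0 < # Z? ×
        y ≤ (4 * M) ^ t * # Z? × (∀ {x y} → x ∈ L → Z y → B x y))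

  -- The Kővári-Sós-Turán argument carried out greedily: each new vertex comes from averaging over
  -- the surviving set `Z` and keeps at least a 1/(4M) fraction of it.
  common-neighbours : ∀ M → 0 < n → {Y : Fin n → Set} (Y? : ∀ y → Dec (Y y)) →
    (∀ y → Y y → n ≤ 2 * M * # (λ x → B? x y)) → 0 < # Y? → ∀ t → 4 * M * t ≤ n →
    CommonNeighbours M (# Y?) t
  common-neighbours M 0<n {Y} Y? rich 0<Y zero _ =
    [] , z≤n , refl , Y , Y? , rich , 0<Y , ≤-reflexive (sym (*-identityˡ _)) , (λ ())
  common-neighbours M 0<n Y? rich 0<Y (suc t) small =
    extend (common-neighbours M 0<n Y? rich 0<Y t (≤-trans (*-monoʳ-≤ (4 * M) (n≤1+n t)) small))
    where
    eq : ∀ a b c → a * (b * c) ≡ b * a * c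
    eq = solve-∀
    extend : CommonNeighbours M (# Y?) t → CommonNeighbours M (# Y?) (suc t)
    extend (L , t≤ , lenL , Z , Z? , Z-rich , 0<Z , Y≤Z , full) =
      add (rich-vertex M Z? L Z-rich (≤-trans (*-monoʳ-≤ (4 * M) (≤-trans (≤-reflexive lenL) (n≤1+n t))) small) 0<n 0<Z)
      where
      add : ∃[ x ] (x ∉ L × # Z? ≤ 4 * M * # (λ y → Z? y ×-dec B? x y)) → CommonNeighbours M (# Y?) (suc t)
      add (x , x∉L , Z≤) = x ∷ L , ≤-trans (s≤s t≤) (#-∷ x L x∉L) , cong suc lenL ,
          (λ y → Z y × B x y) , (λ y → Z? y ×-dec B? x y) , (λ y (Zy , _) → Z-rich y Zy) ,
          pos-right (4 * M) _ (≤-trans 0<Z Z≤) ,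
          ≤-trans Y≤Z (≤-trans (*-monoʳ-≤ ((4 * M) ^ t) Z≤) (≤-reflexive (eq ((4 * M) ^ t) (4 * M) _))) ,
          λ { (here refl) (_ , b) → b ; (there p) (Zy , _) → full p Zy }

  Biclique : ℕ → Set₁
  Biclique t = Σ (Fin n → Set) λ X → Σ (∀ x → Dec (X x)) λ X? → Σ (Fin n → Set) λ Y → Σ (∀ y → Dec (Y y)) λ Y? →
      t ≤ # X? × t ≤ # Y? × (∀ {x y} → X x → Y y → B x y)

  biclique : ∀ M t → 0 < n → 4 * M * t ≤ n → 2 * M * ((4 * M) ^ t * t) < n → n * n < M * ∑∑ B? → Biclique t
  biclique M t 0<n small large dense =
    finish (common-neighbours M 0<n Rich? (λ _ r → r) (pos-right (2 * M) _ (≤-<-trans z≤n many)) t small)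
    where
    open ≤-Reasoning
    deg : Fin n → ℕ
    deg y = # (λ x → B? x y)
    Rich? : ∀ y → Dec (n ≤ 2 * M * deg y)
    Rich? y = n ≤? 2 * M * deg y
    -- Twice the density hypothesis exceeds 2n², and the vertices that are not rich contribute at
    -- most n² to it.
    many : n < 2 * M * # Rich?
    many = *-cancelʳ-< n n (2 * M * # Rich?) (+-cancelʳ-< (n * n) _ _ (begin-strict
      n * n + n * n  <⟨ +-mono-< dense dense ⟩
      M * ∑∑ B? + M * ∑∑ B?  ≡⟨ cong (λ z → M * z + M * z) (∑-comm (allFin n) (allFin n) _) ⟩
      M * ∑ (allFin n) deg + M * ∑ (allFin n) deg ≡⟨ eq₁ M (∑ (allFin n) deg) ⟩
      2 * M * ∑ (allFin n) deg       ≡⟨ sym (∑-*ˡ (allFin n) (2 * M) deg) ⟩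
      ∑ (allFin n) (λ y → 2 * M * deg y) ≤⟨ ∑-mono (allFin n) pt ⟩
      ∑ (allFin n) (λ y → 2 * M * n * 𝟙 (Rich? y) + n) ≡⟨ ∑-+ (allFin n) _ _ ⟩
      ∑ (allFin n) (λ y → 2 * M * n * 𝟙 (Rich? y)) + ∑ (allFin n) (λ _ → n)
                                     ≡⟨ cong₂ _+_ (∑-*ˡ (allFin n) (2 * M * n) _) (∑-allFin-const n n) ⟩
      2 * M * n * # Rich? + n * n    ≡⟨ cong (_+ n * n) (eq₂ M n (# Rich?)) ⟩
      2 * M * # Rich? * n + n * n    ∎))
      where
      eq₁ : ∀ M z → M * z + M * z ≡ 2 * M * z
      eq₁ = solve-∀
      eq₂ : ∀ M n r → 2 * M * n * r ≡ 2 * M * r * n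
      eq₂ = solve-∀
      pt : ∀ y → 2 * M * deg y ≤ 2 * M * n * 𝟙 (Rich? y) + n
      pt y with Rich? y
      ... | yes _ = ≤-trans (≤-trans (*-monoʳ-≤ (2 * M) (#≤n (λ x → B? x y))) (≤-reflexive (sym (*-identityʳ _)))) (m≤m+n _ _)
      ... | no ¬p = ≤-trans (<⇒≤ (≰⇒> ¬p)) (m≤n+m _ _)
    finish : CommonNeighbours M (# Rich?) t → Biclique t
    finish (L , t≤ , _ , Z , Z? , _ , _ , R≤Z , full) = (_∈ L) , (_∈? L) , Z , Z? , t≤ ,
      <⇒≤ (*-cancelˡ-< (2 * M * (4 * M) ^ t) t (# Z?) (begin-strict
        2 * M * (4 * M) ^ t * t       ≡⟨ *-assoc (2 * M) ((4 * M) ^ t) t ⟩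
        2 * M * ((4 * M) ^ t * t)     <⟨ large ⟩
        n  <⟨ many ⟩
        2 * M * # Rich?  ≤⟨ *-monoʳ-≤ (2 * M) R≤Z ⟩
        2 * M * ((4 * M) ^ t * # Z?)  ≡⟨ sym (*-assoc (2 * M) ((4 * M) ^ t) (# Z?)) ⟩
        2 * M * (4 * M) ^ t * # Z?    ∎)) , λ {_} {_} → full

module ShortCycles (g : ℕ) {n : ℕ} (G : Graph n) where
  open Walks (Adj G)

  -- The lengths are 2, 4, ..., k - 5, so that on an edge `u v` this is an odd cycle of length 3, 5,
  -- ..., k - 4 through the edge.
  ShortBypass : Fin n → Fin n → Set
  ShortBypass u v = ∃[ s ] Path (dbl (suc (toℕ {suc g} s))) [] u v

  shortBypass? : ∀ u v → Dec (ShortBypass u v)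
  shortBypass? u v = any? λ s → path? (adj? G) (dbl (suc (toℕ s))) [] u v

  BadEdge : Fin n → Fin n → Set
  BadEdge u v = Adj G u v × ShortBypass u v

  badEdge? : ∀ u v → Dec (BadEdge u v)
  badEdge? u v = adj? G u v ×-dec shortBypass? u v

  alternating-path : {X Y : Fin n → Set} (X? : ∀ x → Dec (X x)) (Y? : ∀ y → Dec (Y y)) →
    (∀ {x y} → X x → Y y → Adj G x y) → ∀ f L x → X x → x ∉ L →
    length L + (2 + dbl f) ≤ # X? → length L + (2 + dbl f) ≤ # Y? → ∃[ y ] (Y y × Path (1 + dbl f) L x y)
  alternating-path X? Y? full zero L x Xx x∉L lX lY =
    case pick Y? (x ∷ L) (≤-trans (≤-reflexive (+-comm 2 (length L))) lY) of
      λ (y , Yy , y∉) → y , Yy , x∉L , y , full Xx Yy , y∉ , refl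
  alternating-path X? Y? full (suc f) L x Xx x∉L lX lY =
    case pick Y? (x ∷ L) (≤-trans (≤-trans (≤-reflexive (+-comm 2 (length L))) (+-monoʳ-≤ (length L) (m≤m+n 2 _))) lY) of
      λ (y , Yy , y∉) →
    case pick X? (y ∷ x ∷ L) (≤-trans (≤-trans (≤-reflexive (+-comm 3 (length L))) (+-monoʳ-≤ (length L) (m≤m+n 3 _))) lX) of
      λ (x′ , Xx′ , x′∉) →
    case alternating-path X? Y? full f (y ∷ x ∷ L) x′ Xx′ x′∉ (≤-trans (≤-reflexive (eq (length L) (dbl f))) lX)
            (≤-trans (≤-reflexive (eq (length L) (dbl f))) lY) of
      λ (y′ , Yy′ , p) → y′ , Yy′ , x∉L , y , full Xx Yy , y∉ , x′ , Adj-sym G (full Xx′ Yy) , p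
    where
    eq : ∀ l d → 2 + l + (2 + d) ≡ l + (2 + (2 + d))
    eq = solve-∀

  -- The bypass of one edge `x y` has 2s + 2 edges. Its end `y` is led back to `x` inside the
  -- biclique by 2f + 3 edges through fresh vertices; with s + f = g this makes a cycle of length k
  -- - 2.
  bad-biclique⇒cycle : {X Y : Fin n → Set} (X? : ∀ x → Dec (X x)) (Y? : ∀ y → Dec (Y y)) →
    7 + dbl g ≤ # X? → 7 + dbl g ≤ # Y? → (∀ {x y} → X x → Y y → BadEdge x y) → HasCycle (5 + dbl g) G
  bad-biclique⇒cycle {X} {Y} X? Y? lX lY full =
    case pick X? [] (≤-trans (s≤s z≤n) lX) of λ (x , Xx , _) →
    case pick Y? [] (≤-trans (s≤s z≤n) lY) of λ (y , Yy , _) →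
    case full Xx Yy of λ (_ , s , p) →
    case m≤n⇒∃[o]m+o≡n (≤-pred (toℕ<n s)) of λ (f , s+f≡g) →
    detour Xx Yy (toℕ s) f s+f≡g p
    where
    eq₁ : ∀ a b → 3 + (a + 0) + (2 + b) ≡ 5 + (a + b)
    eq₁ = solve-∀
    eq₂ : ∀ a b → 2 + a + (1 + (1 + b)) ≡ 4 + (a + b)
    eq₂ = solve-∀
    detour : ∀ {x y} → X x → Y y → ∀ s f → s + f ≡ g → Path (dbl (suc s)) [] x y → HasCycle (5 + dbl g) G
    detour {x} {y} Xx Yy s f s+f≡g p =
      case pick X? (visited (dbl (suc s)) p) (≤-trans (≤-trans (m≤m+n _ _) bound) lX) of λ (x′ , Xx′ , x′∉) →
      case alternating-path X? Y? (λ X Y → proj₁ (full X Y)) f (visited (dbl (suc s)) p) x′ Xx′ x′∉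
             (≤-trans (≤-trans (n≤1+n _) bound) lX) (≤-trans (≤-trans (n≤1+n _) bound) lY) of λ (y′ , Yy′ , q) →
      subst (λ l → HasCycle (suc l) G) len
        (close-path G (dbl (suc s) + suc (1 + dbl f)) (path-++ (dbl (suc s)) p (Adj-sym G (proj₁ (full Xx′ Yy))) q)
          (Adj-sym G (proj₁ (full Xx Yy′))))
      where
      dbl≡ : dbl s + dbl f ≡ dbl g
      dbl≡ = trans (sym (dbl-+ s f)) (cong dbl s+f≡g)
      bound : suc (length (visited (dbl (suc s)) p)) + (2 + dbl f) ≤ 7 + dbl g
      bound = ≤-trans (≤-reflexive (cong suc (trans (cong (_+ (2 + dbl f)) (length-visited (dbl (suc s)) p))
                (trans (eq₁ (dbl s) (dbl f)) (cong (5 +_) dbl≡))))) (n≤1+n _)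
      len : dbl (suc s) + suc (1 + dbl f) ≡ 4 + dbl g
      len = trans (eq₂ (dbl s) (dbl f)) (cong (4 +_) dbl≡)

  -- A bypass is a directed path; excluding it in both directions makes the relation symmetric by
  -- construction.
  Good : Fin n → Fin n → Set
  Good u v = Adj G u v × ¬ ShortBypass u v × ¬ ShortBypass v u

  good? : ∀ u v → Dec (Good u v)
  good? u v = adj? G u v ×-dec (¬? (shortBypass? u v) ×-dec ¬? (shortBypass? v u))

  Good-sym : ∀ {u v} → Good u v → Good v u
  Good-sym (a , b , c) = Adj-sym G a , c , b

  -- The walk contains an odd cycle of good edges. If its length is at most k - 4, the rest of the
  -- cycle is a bypass of its closing edge; the only other odd length below k is k - 2, which is
  -- forbidden.
  Good-no-odd : CycleFree (5 + dbl g) G → ∀ r u → r < 3 + g → ¬ Walks.Walk Good (suc (dbl r)) u u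
  Good-no-odd free r u r<3+g w =
    contradict (Walks.closed-odd Good (suc (dbl r)) (suc (dbl r)) (Walks.walk-seq Good _ w) ≤-refl
           (Walks.walk-seq-step Good _ w)
           (trans (Walks.walk-seq-last Good _ w) (sym (Walks.walk-seq-0 Good _ w))) (r , refl))
    where
    contradict : ¬ Walks.OddCycle≤ Good (suc (dbl r))
    contradict (zero  , _ , x , .x , (_ , refl) , (a , _)) = Adj-irrefl G a
    contradict (suc e , l , x , y , p , a , ¬b , ¬c) = case e <? suc g of λ
      { (yes e<) → ¬c (fromℕ< e< , subst (λ z → Path (dbl (suc z)) [] x y) (sym (toℕ-fromℕ< e<)) (path-map proj₁ (dbl (suc e)) p))
      ; (no e≮)  → free (subst (λ z → HasCycle (suc (dbl z)) G)
                     (≤-antisym (≤-trans (dbl-cancel-≤ (suc e) r (≤-pred l)) (≤-pred r<3+g)) (s≤s (≮⇒≥ e≮)))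
                     (close-path G (dbl (suc e)) (path-map proj₁ (dbl (suc e)) p) a)) }

  bad-pairs : CycleFree (5 + dbl g) G → ∀ M → 0 < n → 4 * M * (7 + dbl g) ≤ n →
    2 * M * ((4 * M) ^ (7 + dbl g) * (7 + dbl g)) < n →
    M * ∑∑ (λ u v → adj? G u v ×-dec ¬? (good? u v)) ≤ 2 * (n * n)
  bad-pairs free M 0<n small large = begin
    M * ∑∑ (λ u v → adj? G u v ×-dec ¬? (good? u v))
      ≤⟨ *-monoʳ-≤ M (∑-mono (allFin n) λ u → ∑-mono (allFin n) λ v → pt u v) ⟩
    M * ∑ (allFin n) (λ u → ∑ (allFin n) (λ v → 𝟙 (badEdge? u v) + 𝟙 (badEdge? v u)))
      ≡⟨ cong (M *_) (trans (∑-cong (allFin n) λ u → ∑-+ (allFin n) _ _) (∑-+ (allFin n) _ _)) ⟩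
    M * (∑∑ badEdge? + ∑ (allFin n) (λ u → ∑ (allFin n) (λ v → 𝟙 (badEdge? v u))))
      ≡⟨ cong (λ z → M * (∑∑ badEdge? + z)) (∑-comm (allFin n) (allFin n) _) ⟩
    M * (∑∑ badEdge? + ∑∑ badEdge?)
      ≡⟨ *-distribˡ-+ M (∑∑ badEdge?) (∑∑ badEdge?) ⟩
    M * ∑∑ badEdge? + M * ∑∑ badEdge?
      ≤⟨ +-mono-≤ sparse sparse ⟩
    n * n + n * n
      ≡⟨ cong (n * n +_) (sym (+-identityʳ (n * n))) ⟩
    2 * (n * n) ∎
    where
    open ≤-Reasoning
    sparse : M * ∑∑ badEdge? ≤ n * n
    sparse = case M * ∑∑ badEdge? ≤? n * n of λ
      { (yes l) → l
      ; (no ¬l) → case biclique badEdge? M (7 + dbl g) 0<n small large (≰⇒> ¬l) of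
          λ (X , X? , Y , Y? , lX , lY , full) → ⊥-elim (free (bad-biclique⇒cycle X? Y? lX lY full)) }
    pt : ∀ u v → 𝟙 (adj? G u v ×-dec ¬? (good? u v)) ≤ 𝟙 (badEdge? u v) + 𝟙 (badEdge? v u)
    pt u v = 𝟙-≤ (adj? G u v ×-dec ¬? (good? u v)) λ (a , ¬good) →
      case shortBypass? u v of λ
        { (yes b) → ≤-trans (≤-reflexive (sym (𝟙-yes (badEdge? u v) (a , b)))) (m≤m+n _ _)
        ; (no ¬b) → case shortBypass? v u of λ
            { (yes c) → ≤-trans (≤-reflexive (sym (𝟙-yes (badEdge? v u) (Adj-sym G a , c)))) (m≤n+m _ _)
            ; (no ¬c) → ⊥-elim (¬good (a , ¬b , ¬c)) } }

-- Closed sequences as vectors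

vecs : ∀ n k → List (Vec (Fin n) k)
vecs n zero    = [] ∷ []
vecs n (suc k) = concatMap (λ x → map (x ∷_) (vecs n k)) (allFin n)

∑-vecs-suc : ∀ {n k} (F : Vec (Fin n) (suc k) → ℕ) →
  ∑ (vecs n (suc k)) F ≡ ∑ (allFin n) (λ x → ∑ (vecs n k) (λ xs → F (x ∷ xs)))
∑-vecs-suc {n} {k} F = trans (∑-concatMap (λ x → map (x ∷_) (vecs n k)) (allFin n) F)
  (∑-cong (allFin n) λ x → ∑-map (x ∷_) (vecs n k) F)

-- Summing over the last entry first is what makes rotation and reversal preserve sums over `vecs`.
∑-vecs-snoc : ∀ {n} k (F : Vec (Fin n) (suc k) → ℕ) →
  ∑ (vecs n (suc k)) F ≡ ∑ (allFin n) (λ x → ∑ (vecs n k) (λ xs → F (xs ∷ʳ x)))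
∑-vecs-snoc zero    F = ∑-vecs-suc F
∑-vecs-snoc {n} (suc k) F = begin
  ∑ (vecs n (suc (suc k))) F  ≡⟨ ∑-vecs-suc F ⟩
  ∑ (allFin n) (λ y → ∑ (vecs n (suc k)) (λ xs → F (y ∷ xs)))  ≡⟨ ∑-cong (allFin n) (λ y → ∑-vecs-snoc k (λ xs → F (y ∷ xs))) ⟩
  ∑ (allFin n) (λ y → ∑ (allFin n) (λ x → ∑ (vecs n k) (λ zs → F (y ∷ (zs ∷ʳ x))))) ≡⟨ ∑-comm (allFin n) (allFin n) _ ⟩
  ∑ (allFin n) (λ x → ∑ (allFin n) (λ y → ∑ (vecs n k) (λ zs → F (y ∷ (zs ∷ʳ x))))) ≡⟨ ∑-cong (allFin n) (λ x → sym (∑-vecs-suc (λ xs → F (xs ∷ʳ x)))) ⟩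
  ∑ (allFin n) (λ x → ∑ (vecs n (suc k)) (λ xs → F (xs ∷ʳ x)))                      ∎
  where open ≡-Reasoning

rot : ∀ {A : Set} {k} → Vec A (suc k) → Vec A (suc k)
rot (x ∷ xs) = xs ∷ʳ x

∑-rot : ∀ {n} k (F : Vec (Fin n) (suc k) → ℕ) → ∑ (vecs n (suc k)) (F ∘ rot) ≡ ∑ (vecs n (suc k)) F
∑-rot k F = trans (∑-vecs-suc (F ∘ rot)) (sym (∑-vecs-snoc k F))

∑-reverse : ∀ {n} k (F : Vec (Fin n) k → ℕ) → ∑ (vecs n k) (F ∘ reverse) ≡ ∑ (vecs n k) F
∑-reverse     zero    F = refl
∑-reverse {n} (suc k) F = begin
  ∑ (vecs n (suc k)) (F ∘ reverse)  ≡⟨ ∑-vecs-suc (F ∘ reverse) ⟩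
  ∑ (allFin n) (λ x → ∑ (vecs n k) (λ xs → F (reverse (x ∷ xs))))    ≡⟨ ∑-cong (allFin n) (λ x → ∑-cong (vecs n k) (λ xs → cong F (reverse-∷ x xs))) ⟩
  ∑ (allFin n) (λ x → ∑ (vecs n k) (λ xs → F (reverse xs ∷ʳ x)))     ≡⟨ ∑-cong (allFin n) (λ x → ∑-reverse k (λ xs → F (xs ∷ʳ x))) ⟩
  ∑ (allFin n) (λ x → ∑ (vecs n k) (λ xs → F (xs ∷ʳ x)))  ≡⟨ sym (∑-vecs-snoc k F) ⟩
  ∑ (vecs n (suc k)) F                                               ∎
  where open ≡-Reasoning

∑-vecs-const : ∀ n k c → ∑ (vecs n k) (λ _ → c) ≡ n ^ k * c
∑-vecs-const n zero    c = refl
∑-vecs-const n (suc k) c = begin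
  ∑ (vecs n (suc k)) (λ _ → c)  ≡⟨ ∑-vecs-suc {n} {k} (λ _ → c) ⟩
  ∑ (allFin n) (λ _ → ∑ (vecs n k) (λ _ → c))  ≡⟨ ∑-allFin-const n _ ⟩
  n * ∑ (vecs n k) (λ _ → c)  ≡⟨ cong (n *_) (∑-vecs-const n k c) ⟩
  n * (n ^ k * c)  ≡⟨ sym (*-assoc n (n ^ k) c) ⟩
  n * n ^ k * c                                       ∎
  where open ≡-Reasoning

%-suc : ∀ m k → suc (m % suc k) % suc k ≡ suc m % suc k
%-suc m k = sym (trans (cong (λ z → suc z % suc k) (m≡m%n+[m/n]*n m (suc k)))
                       ([m+kn]%n≡m%n (suc (m % suc k)) (m / suc k) (suc k)))

toℕ-mod : ∀ m k → toℕ (m mod suc k) ≡ m % suc k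
toℕ-mod m k = toℕ-fromℕ< (m%n<n m (suc k))

mod-cong : ∀ {k a b} → a % suc k ≡ b % suc k → a mod suc k ≡ b mod suc k
mod-cong {k} {a} {b} e = toℕ-injective (trans (toℕ-mod a k) (trans e (sym (toℕ-mod b k))))

mod-toℕ : ∀ {k} (i : Fin (suc k)) → toℕ i mod suc k ≡ i
mod-toℕ {k} i = toℕ-injective (trans (toℕ-mod (toℕ i) k) (m<n⇒m%n≡m (toℕ<n i)))

mod-+ : ∀ k m → (m + suc k) mod suc k ≡ m mod suc k
mod-+ k m = mod-cong {k} {m + suc k} {m} ([m+n]%n≡m%n m (suc k))

next-mod : ∀ k m → next (m mod suc k) ≡ suc m mod suc k
next-mod k m = toℕ-injective (trans (toℕ-next (m mod suc k))
  (trans (cong (λ z → suc z % suc k) (toℕ-mod m k)) (trans (%-suc m k) (sym (toℕ-mod (suc m) k)))))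

-- Indexing modulo the length turns a closed sequence into a periodic function on ℕ, so that shifts
-- need no case distinction at the wrap-around.
at : ∀ {A : Set} {k} → Vec A (suc k) → ℕ → A
at {k = k} v m = lookup v (m mod suc k)

at-toℕ : ∀ {A : Set} {k} (v : Vec A (suc k)) i → at v (toℕ i) ≡ lookup v i
at-toℕ v i = cong (lookup v) (mod-toℕ i)

at-+ : ∀ {A : Set} {k} (v : Vec A (suc k)) m → at v (m + suc k) ≡ at v m
at-+ {k = k} v m = cong (lookup v) (mod-+ k m)

lookup-∷ʳ-init : ∀ {A : Set} {k} (xs : Vec A k) x i j → toℕ j ≡ toℕ i → lookup (xs ∷ʳ x) j ≡ lookup xs i
lookup-∷ʳ-init (y ∷ xs) x fzero    fzero    e = refl
lookup-∷ʳ-init (y ∷ xs) x (fsuc i) (fsuc j) e = lookup-∷ʳ-init xs x i j (suc-injective e)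

lookup-∷ʳ-last : ∀ {A : Set} {k} (xs : Vec A k) x j → toℕ j ≡ k → lookup (xs ∷ʳ x) j ≡ x
lookup-∷ʳ-last []       x fzero    e = refl
lookup-∷ʳ-last (y ∷ xs) x (fsuc j) e = lookup-∷ʳ-last xs x j (suc-injective e)

at-rot : ∀ {A : Set} {k} (v : Vec A (suc k)) m → at (rot v) m ≡ at v (suc m)
at-rot {k = k} (x ∷ xs) m = [ inner , last ]′ (m≤n⇒m<n∨m≡n (≤-pred (m%n<n m (suc k))))
  where
  inner : m % suc k < k → at (xs ∷ʳ x) m ≡ at (x ∷ xs) (suc m)
  inner l = trans (lookup-∷ʳ-init xs x (fromℕ< l) (m mod suc k) (trans (toℕ-mod m k) (sym (toℕ-fromℕ< l))))
    (cong (lookup (x ∷ xs)) (toℕ-injective (trans (cong suc (toℕ-fromℕ< l))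
      (sym (trans (toℕ-mod (suc m) k) (trans (sym (%-suc m k)) (m<n⇒m%n≡m (s≤s l))))))))
  last : m % suc k ≡ k → at (xs ∷ʳ x) m ≡ at (x ∷ xs) (suc m)
  last e = trans (lookup-∷ʳ-last xs x (m mod suc k) (trans (toℕ-mod m k) e))
    (cong (lookup (x ∷ xs)) (toℕ-injective {i = fzero} (sym (trans (toℕ-mod (suc m) k)
      (trans (sym (%-suc m k)) (trans (cong (λ z → suc z % suc k) e) (n%n≡0 (suc k))))))))

lookup-reverse : ∀ {A : Set} {k} (v : Vec A (suc k)) i j → toℕ i + toℕ j ≡ k → lookup (reverse v) i ≡ lookup v j
lookup-reverse {k = k} (x ∷ xs) i fzero e = trans (cong (λ w → lookup w i) (reverse-∷ x xs))
  (lookup-∷ʳ-last (reverse xs) x i (trans (sym (+-identityʳ (toℕ i))) e))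
lookup-reverse {k = suc k} (x ∷ xs) i (fsuc j) e = trans (cong (λ w → lookup w i) (reverse-∷ x xs))
  (trans (lookup-∷ʳ-init (reverse xs) x (fromℕ< i<) i (sym (toℕ-fromℕ< i<)))
         (lookup-reverse xs (fromℕ< i<) j (trans (cong (_+ toℕ j) (toℕ-fromℕ< i<)) i+j)))
  where
  i+j : toℕ i + toℕ j ≡ k
  i+j = suc-injective (trans (sym (+-suc (toℕ i) (toℕ j))) e)
  i< : toℕ i < suc k
  i< = s≤s (≤-trans (m≤m+n _ _) (≤-reflexive i+j))

-- The residue of k·(a+1) modulo k+1 is k − a.
at-reverse : ∀ {A : Set} {k} (v : Vec A (suc k)) a → at (reverse v) a ≡ at v (k * suc a)
at-reverse {k = k} v a = lookup-reverse v (a mod suc k) (k * suc a mod suc k)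
  (trans (cong₂ _+_ (toℕ-mod a k) (toℕ-mod (k * suc a) k)) (residue (a % suc k) (k * suc a % suc k) (m%n<n a (suc k)) (m%n<n (k * suc a) (suc k)) zero-sum))
  where
  zero-sum : suc (a % suc k + k * suc a % suc k) % suc k ≡ 0
  zero-sum = begin
    suc (a % suc k + k * suc a % suc k) % suc k  ≡⟨ sym (%-suc (a % suc k + k * suc a % suc k) k) ⟩
    suc ((a % suc k + k * suc a % suc k) % suc k) % suc k  ≡⟨ cong (λ z → suc z % suc k) (sym (%-distribˡ-+ a (k * suc a) (suc k))) ⟩
    suc ((a + k * suc a) % suc k) % suc k  ≡⟨ %-suc (a + k * suc a) k ⟩
    suc (a + k * suc a) % suc k  ≡⟨ cong (_% suc k) (eq a k) ⟩
    suc a * suc k % suc k  ≡⟨ m*n%n≡0 (suc a) (suc k) ⟩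
    0                                                      ∎
    where
    open ≡-Reasoning
    eq : ∀ a k → 1 + (a + k * (1 + a)) ≡ (1 + a) * (1 + k)
    eq = solve-∀
  residue : ∀ i j → i < suc k → j < suc k → suc (i + j) % suc k ≡ 0 → i + j ≡ k
  residue i j i< j< e with <-cmp (i + j) k
  ... | tri≈ _ q _ = q
  ... | tri< l _ _ = case trans (sym (m<n⇒m%n≡m (s≤s l))) e of λ ()
  ... | tri> _ _ l with m≤n⇒∃[o]m+o≡n l
  ...   | o , q = ⊥-elim (absurd (trans (sym (m<n⇒m%n≡m o+1<)) (trans (sym ([m+n]%n≡m%n (suc o) (suc k)))
              (trans (cong (λ z → suc z % suc k) (trans (+-comm o (suc k)) q)) e))))
    where
    absurd : suc o ≡ 0 → ⊥
    absurd ()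
    o+1< : suc o < suc k
    o+1< = +-cancelˡ-< (suc k) (suc o) (suc k) (subst (_< suc k + suc k) (sym (trans (+-suc (suc k) o) (cong suc q)))
             (≤-trans (s≤s (≤-reflexive (sym (+-suc i j)))) (+-mono-≤ i< j<)))

Closed : ∀ {A : Set} (R : A → A → Set) {k} → Vec A k → Set
Closed R v = ∀ i → R (lookup v i) (lookup v (next i))

closed? : ∀ {A : Set} {R : A → A → Set} → (∀ u v → Dec (R u v)) → ∀ {k} (v : Vec A k) → Dec (Closed R v)
closed? R? v = all? λ i → R? (lookup v i) (lookup v (next i))

closed⇒at : ∀ {A : Set} {R : A → A → Set} {k} (v : Vec A (suc k)) → Closed R v → ∀ m → R (at v m) (at v (suc m))
closed⇒at {R = R} {k} v c m = subst (λ z → R (at v m) (lookup v z)) (next-mod k m) (c (m mod suc k))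

at⇒closed : ∀ {A : Set} {R : A → A → Set} {k} (v : Vec A (suc k)) → (∀ m → R (at v m) (at v (suc m))) → Closed R v
at⇒closed {R = R} {k} v c i = subst₂ R (at-toℕ v i)
  (cong (lookup v) (trans (sym (next-mod k (toℕ i))) (cong next (mod-toℕ i)))) (c (toℕ i))

closed-rot : ∀ {A : Set} {R : A → A → Set} {k} (v : Vec A (suc k)) → Closed R v → Closed R (rot v)
closed-rot {R = R} v c = at⇒closed {R = R} (rot v) λ m →
  subst₂ R (sym (at-rot v m)) (sym (at-rot v (suc m))) (closed⇒at {R = R} v c (suc m))

closed-unrot : ∀ {A : Set} {R : A → A → Set} {k} (v : Vec A (suc k)) → Closed R (rot v) → Closed R v
closed-unrot {R = R} {k} v c = at⇒closed {R = R} v λ m →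
  subst₂ R (trans (at-rot v (m + k)) (shift m)) (trans (at-rot v (suc (m + k))) (shift (suc m)))
    (closed⇒at {R = R} (rot v) c (m + k))
  where
  shift : ∀ m → at v (suc (m + k)) ≡ at v m
  shift m = trans (cong (at v) (sym (+-suc m k))) (at-+ v m)

closed-reverse : ∀ {A : Set} {R : A → A → Set} {k} (v : Vec A (suc k)) →
                 Closed R v → Closed (λ x y → R y x) (reverse v)
closed-reverse {R = R} {k} v c = at⇒closed {R = λ x y → R y x} (reverse v) λ m →
  subst₂ R (sym (at-reverse v (suc m))) (sym (trans (at-reverse v m) (wrap m)))
    (closed⇒at {R = R} v c (k * suc (suc m)))
  where
  eq : ∀ k m → k * (1 + m) + (1 + k) ≡ 1 + k * (2 + m)
  eq = solve-∀
  wrap : ∀ m → at v (k * suc m) ≡ at v (suc (k * suc (suc m)))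
  wrap m = trans (sym (at-+ v (k * suc m))) (cong (at v) (eq k m))

∑-closed-rot : ∀ {n k} {R : Fin n → Fin n → Set} (R? : ∀ u v → Dec (R u v)) (F : Vec (Fin n) (suc k) → ℕ) →
  ∑ (vecs n (suc k)) (λ v → 𝟙 (closed? R? v) * F (rot v)) ≡ ∑ (vecs n (suc k)) (λ v → 𝟙 (closed? R? v) * F v)
∑-closed-rot {n} {k} {R} R? F = trans
  (∑-cong (vecs n (suc k)) λ v → cong (_* F (rot v))
    (𝟙-cong (closed? R? v) (closed? R? (rot v)) (closed-rot {R = R} v) (closed-unrot {R = R} v)))
  (∑-rot k (λ v → 𝟙 (closed? R? v) * F v))

-- Counting embeddings

Inj : ∀ {k n} → (Fin k → Fin n) → Set
Inj f = ∀ i j → f i ≡ f j → i ≡ j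

Emb : ∀ {k n} → Graph n → (Fin k → Fin n) → Set
Emb G f = (∀ i → Adj G (f i) (f (next i))) × Inj f

emb? : ∀ {k n} (G : Graph n) (f : Fin k → Fin n) → Dec (Emb G f)
emb? G f = all? (λ i → adj? G (f i) (f (next i))) ×-dec all? (λ i → all? λ j → dec-impl (f i ≟ᶠ f j) (i ≟ᶠ j))
  where
  dec-impl : {P Q : Set} → Dec P → Dec Q → Dec (P → Q)
  dec-impl (no ¬p) _       = yes λ p → ⊥-elim (¬p p)
  dec-impl (yes p) (yes q) = yes λ _ → q
  dec-impl (yes p) (no ¬q) = no λ h → ¬q (h p)

private
  ∧-split : ∀ {a b} → a ∧ b ≡ true → a ≡ true × b ≡ true
  ∧-split {true} {true} _ = refl , refl

  allB⇒ : {A : Set} (p : A → Bool) (xs : List A) → allB p xs ≡ true → ∀ {x} → x ∈ xs → p x ≡ true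
  allB⇒ p (x ∷ xs) e (here refl) = proj₁ (∧-split e)
  allB⇒ p (x ∷ xs) e (there q)   = allB⇒ p xs (proj₂ (∧-split {p x} e)) q

  ⇒allB : {A : Set} (p : A → Bool) (xs : List A) → (∀ x → p x ≡ true) → allB p xs ≡ true
  ⇒allB p []       h = refl
  ⇒allB p (x ∷ xs) h = cong₂ _∧_ (h x) (⇒allB p xs h)

==-sound : ∀ {n} (i j : Fin n) → (i == j) ≡ true → i ≡ j
==-sound i j e = toℕ-injective (≡ᵇ⇒≡ (toℕ i) (toℕ j) (subst T (sym e) _))

==-refl : ∀ {n} (i : Fin n) → (i == i) ≡ true
==-refl i = T⇒ (≡⇒≡ᵇ (toℕ i) (toℕ i) refl)
  where
  T⇒ : ∀ {b} → T b → b ≡ true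
  T⇒ {true} _ = refl

𝟙ᵇ : Bool → ℕ
𝟙ᵇ true  = 1
𝟙ᵇ false = 0

length-filterᵇ : {A : Set} (p : A → Bool) (xs : List A) → length (filterᵇ p xs) ≡ ∑ xs (𝟙ᵇ ∘ p)
length-filterᵇ p []       = refl
length-filterᵇ p (x ∷ xs) with p x
... | true  = cong suc (length-filterᵇ p xs)
... | false = length-filterᵇ p xs

𝟙ᵇ-dec : {P : Set} (b : Bool) (d : Dec P) → (b ≡ true → P) → (P → b ≡ true) → 𝟙ᵇ b ≡ 𝟙 d
𝟙ᵇ-dec true  d f g = sym (𝟙-yes d (f refl))
𝟙ᵇ-dec false d f g = sym (𝟙-no d λ p → case g p of λ ())

isCycleEmbedding⇔Emb : ∀ {k n} (G : Graph n) (f : Fin k → Fin n) →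
  (isCycleEmbedding G f ≡ true → Emb G f) × (Emb G f → isCycleEmbedding G f ≡ true)
isCycleEmbedding⇔Emb {k} G f = to , from
  where
  clash : ∀ i j → ((i == j) ∨ not (f i == f j)) ≡ true → f i ≡ f j → i ≡ j
  clash i j e q with i == j in eq
  ... | true  = ==-sound i j eq
  ... | false rewrite q | ==-refl (f j) = case e of λ ()
  to : isCycleEmbedding G f ≡ true → Emb G f
  to e = (λ i → allB⇒ _ (allFin k) (proj₁ (∧-split e)) (∈-allFin i)) ,
         λ i j → clash i j (allB⇒ _ (allFin k) (allB⇒ _ (allFin k)
                   (proj₂ (∧-split {allB (λ i → adj G (f i) (f (next i))) (allFin k)} e)) (∈-allFin i)) (∈-allFin j))
  apart : Inj f → ∀ i j → ((i == j) ∨ not (f i == f j)) ≡ true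
  apart inj i j with f i == f j in eq
  ... | true rewrite inj i j (==-sound (f i) (f j) eq) | ==-refl j = refl
  ... | false with i == j
  ...   | true  = refl
  ...   | false = refl
  from : Emb G f → isCycleEmbedding G f ≡ true
  from (a , inj) = cong₂ _∧_ (⇒allB _ (allFin k) a) (⇒allB _ (allFin k) λ i → ⇒allB _ (allFin k) (apart inj i))

-- The functions listed by `allFuns` agree with `lookup` of the vectors only pointwise, hence the
-- condition on `F`.
∑-allFuns : ∀ k n (F : (Fin k → Fin n) → ℕ) → (∀ f h → (∀ i → f i ≡ h i) → F f ≡ F h) →
            ∑ (allFuns k n) F ≡ ∑ (vecs n k) (F ∘ lookup)
∑-allFuns zero    n F ext = cong (_+ 0) (ext _ _ λ ())
∑-allFuns (suc k) n F ext = begin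
  ∑ (allFuns (suc k) n) F  ≡⟨ ∑-concatMap (λ f → map (λ x → cons x f) (allFin n)) (allFuns k n) F ⟩
  ∑ (allFuns k n) (λ f → ∑ (map (λ x → cons x f) (allFin n)) F)      ≡⟨ ∑-cong (allFuns k n) (λ f → ∑-map (λ x → cons x f) (allFin n) F) ⟩
  ∑ (allFuns k n) (λ f → ∑ (allFin n) (λ x → F (cons x f)))  ≡⟨ ∑-allFuns k n _ (λ f h e → ∑-cong (allFin n) λ x →
            ext _ _ λ { fzero → refl ; (fsuc i) → e i }) ⟩
  ∑ (vecs n k) (λ v → ∑ (allFin n) (λ x → F (cons x (lookup v))))    ≡⟨ ∑-comm (vecs n k) (allFin n) _ ⟩
  ∑ (allFin n) (λ x → ∑ (vecs n k) (λ v → F (cons x (lookup v))))    ≡⟨ ∑-cong (allFin n) (λ x → ∑-cong (vecs n k) λ v →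
            ext _ _ λ { fzero → refl ; (fsuc i) → refl }) ⟩
  ∑ (allFin n) (λ x → ∑ (vecs n k) (λ v → F (lookup (x ∷ v))))       ≡⟨ sym (∑-vecs-suc (F ∘ lookup)) ⟩
  ∑ (vecs n (suc k)) (F ∘ lookup)                                    ∎
  where open ≡-Reasoning

embeddings-∑ : ∀ k {n} (G : Graph n) → embeddings k G ≡ ∑ (vecs n k) (λ v → 𝟙 (emb? G (lookup v)))
embeddings-∑ k {n} G = begin
  embeddings k G  ≡⟨ length-filterᵇ (isCycleEmbedding G) (allFuns k n) ⟩
  ∑ (allFuns k n) (λ f → 𝟙ᵇ (isCycleEmbedding G f))     ≡⟨ ∑-cong (allFuns k n) (λ f → 𝟙ᵇ-dec _ (emb? G f)
            (proj₁ (isCycleEmbedding⇔Emb G f)) (proj₂ (isCycleEmbedding⇔Emb G f))) ⟩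
  ∑ (allFuns k n) (λ f → 𝟙 (emb? G f))  ≡⟨ ∑-allFuns k n _ (λ f h e → 𝟙-cong (emb? G f) (emb? G h) (transport f h e) (transport h f (λ i → sym (e i)))) ⟩
  ∑ (vecs n k) (λ v → 𝟙 (emb? G (lookup v)))            ∎
  where
  open ≡-Reasoning
  transport : ∀ f h → (∀ i → f i ≡ h i) → Emb G f → Emb G h
  transport f h e (a , inj) = (λ i → subst₂ (Adj G) (e i) (e (next i)) (a i)) ,
                              λ i j q → inj i j (trans (e i) (trans q (sym (e j))))

-- Counting the roles of a vertex with respect to a cycle

∑-downFrom-mono : ∀ m {f h : ℕ → ℕ} → (∀ i → i < m → f i ≤ h i) → ∑ (downFrom m) f ≤ ∑ (downFrom m) h
∑-downFrom-mono zero    le = z≤n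
∑-downFrom-mono (suc m) le = +-mono-≤ (le m ≤-refl) (∑-downFrom-mono m λ i l → le i (m≤n⇒m≤1+n l))

count-covered : ∀ m {P : ℕ → Set} (P? : ∀ i → Dec (P i)) (L : List ℕ) →
  (∀ i → i < m → P i → i ∈ L) → ∑ (downFrom m) (λ i → 𝟙 (P? i)) ≤ length L
count-covered m P? L cov = begin
  ∑ (downFrom m) (λ i → 𝟙 (P? i))  ≤⟨ ∑-downFrom-mono m (λ i l → 𝟙-≤ (P? i) λ p →
            ≤-trans (≤-reflexive (sym (𝟙-yes (i ≟ i) refl))) (∑-term (cov i l p) λ c → 𝟙 (i ≟ c))) ⟩
  ∑ (downFrom m) (λ i → ∑ L (λ c → 𝟙 (i ≟ c)))       ≡⟨ ∑-comm (downFrom m) L _ ⟩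
  ∑ L (λ c → ∑ (downFrom m) (λ i → 𝟙 (i ≟ c)))       ≤⟨ ∑-mono L (λ c → ∑-downFrom-singleton m c) ⟩
  ∑ L (λ _ → 1)  ≡⟨ trans (∑-const L 1) (*-identityʳ (length L)) ⟩
  length L                                           ∎
  where open ≤-Reasoning

downFrom-∈ : ∀ {m} (i : Fin m) → toℕ i ∈ downFrom m
downFrom-∈ {suc m} i = case m≤n⇒m<n∨m≡n (≤-pred (toℕ<n i)) of λ
  { (inj₁ l) → there (subst (_∈ downFrom m) (toℕ-fromℕ< l) (downFrom-∈ (fromℕ< l)))
  ; (inj₂ e) → here e }

-- A periodic property may be counted over any full period, in particular over the one that starts
-- at a position `a` where something is known.
count-window : ∀ m {P : ℕ → Set} (P? : ∀ i → Dec (P i)) → (∀ i → P (i + m) → P i) → (∀ i → P i → P (i + m)) →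
  ∀ a (L : List ℕ) → (∀ d → d < m → P (a + d) → d ∈ L) → ∑ (downFrom m) (λ i → 𝟙 (P? i)) ≤ length L
count-window m P? per per⁻ a L cov = ≤-trans
  (≤-reflexive (sym (∑-periodic m (λ i → 𝟙 (P? i)) (λ i → 𝟙-cong (P? (i + m)) (P? i) (per i) (per⁻ i)) a)))
  (count-covered m (λ d → P? (a + d)) L cov)

dbl≢odd : ∀ g {m} → ∃[ e ] m ≡ suc (dbl e) → dbl g ≢ m
dbl≢odd g (e , refl) = dbl≢suc-dbl g e

-- s i says that a fixed vertex w is adjacent to the vertex i of a cycle, R i that w is a candidate for position
-- i + 3 when the positions i and i + 1 are taken.
module RoleCount (g : ℕ) {s R : ℕ → Set} (s? : ∀ i → Dec (s i)) (R? : ∀ i → Dec (R i))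
  (s-per : ∀ i → s (i + κ g) → s i) (s-per⁻ : ∀ i → s i → s (i + κ g))
  (R-per : ∀ i → R (i + κ g) → R i) (R-per⁻ : ∀ i → R i → R (i + κ g))
  (ss : ∀ a d → d < κ g → s a → s (a + d) → d ∈ 0 ∷ 2 ∷ 5 + dbl g ∷ [])
  (RR : ∀ a d → d < κ g → R a → R (a + d) → d ∈ 0 ∷ 2 ∷ 4 ∷ 3 + dbl g ∷ 5 + dbl g ∷ [])
  (sR : ∀ a d → d < κ g → s a → R (a + d) → d ∈ 2 ∷ 3 + dbl g ∷ 5 + dbl g ∷ []) where

  -- `S⁺?` dominates each of the k - 4 positions from `z₄` on, `S²?` accounts for `z₂`, and `R?` for
  -- `z₃`.
  S⁺? : ∀ i → Dec ((¬ s i) × s (i + 2))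
  S⁺? i = ¬? (s? i) ×-dec s? (i + 2)
  S²? : ∀ i → Dec (s i × s (i + 2))
  S²? i = s? i ×-dec s? (i + 2)

  private
    swap2 : ∀ i → i + 2 + κ g ≡ i + κ g + 2
    swap2 i = eq i (κ g)
      where
      eq : ∀ i k → i + 2 + k ≡ i + k + 2
      eq = solve-∀

    count : {P : ℕ → Set} → (∀ i → Dec (P i)) → ℕ
    count P? = ∑ (downFrom (κ g)) (λ i → 𝟙 (P? i))

    windowR : ∀ a (L : List ℕ) → (∀ d → d < κ g → R (a + d) → d ∈ L) → count R? ≤ length L
    windowR = count-window (κ g) R? R-per R-per⁻

    windowS⁺ : ∀ a (L : List ℕ) → (∀ d → d < κ g → (¬ s (a + d)) × s (a + d + 2) → d ∈ L) → count S⁺? ≤ length L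
    windowS⁺ = count-window (κ g) S⁺? (λ i (p , q) → (λ z → p (s-per⁻ i z)) , s-per (i + 2) (subst s (sym (swap2 i)) q))
                          (λ i (p , q) → (λ z → p (s-per i z)) , subst s (swap2 i) (s-per⁻ (i + 2) q))

    windowS² : ∀ a (L : List ℕ) → (∀ d → d < κ g → s (a + d) × s (a + d + 2) → d ∈ L) → count S²? ≤ length L
    windowS² = count-window (κ g) S²? (λ i (p , q) → s-per i p , s-per (i + 2) (subst s (sym (swap2 i)) q))
                          (λ i (p , q) → s-per⁻ i p , subst s (swap2 i) (s-per⁻ (i + 2) q))

    reduce : {P : ℕ → Set} → (∀ i → P (i + κ g) → P i) → ∀ i → P i → P (i % κ g)
    reduce {P} per i p = go (i / κ g) (subst P (m≡m%n+[m/n]*n i (κ g)) p)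
      where
      eq : ∀ r m k → r + (k + m) ≡ r + m + k
      eq = solve-∀
      go : ∀ q → P (i % κ g + q * κ g) → P (i % κ g)
      go zero    z = subst P (+-identityʳ (i % κ g)) z
      go (suc q) z = go q (per (i % κ g + q * κ g) (subst P (eq (i % κ g) (q * κ g) (κ g)) z))

    nowhere : {P : ℕ → Set} → (∀ i → P (i + κ g) → P i) → ¬ (∃[ i ] P (toℕ {(κ g)} i)) → ∀ i → ¬ P i
    nowhere {P} per none i p = none (i mod κ g , subst P (sym (toℕ-mod i (6 + dbl g))) (reduce per i p))

    k-4<k : 3 + dbl g < κ g
    k-4<k = m≤n+m (4 + dbl g) 3

    s0 : ∀ {a} → s a → s (a + 0)
    s0 {a} = subst s (sym (+-identityʳ a))

    -- For a vertex without neighbours on the cycle `z₃` is the only possible position; five offsets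
    -- are allowed by `RR`, and 5 ≤ k - 2.
    R≤5 : count R? ≤ 5
    R≤5 = case any? (λ i → R? (toℕ {(κ g)} i)) of λ
      { (yes (i , r)) → windowR (toℕ i) (0 ∷ 2 ∷ 4 ∷ 3 + dbl g ∷ 5 + dbl g ∷ []) (λ d l q → RR (toℕ i) d l r q)
      ; (no none)     → ≤-trans (windowR 0 [] (λ d _ q → ⊥-elim (nowhere R-per none (0 + d) q))) z≤n }

    -- a is the first of the neighbours of w on the cycle in the cyclic order with step two.
    module Based (a : ℕ) (sa : s a) (¬before : ¬ s (a + (5 + dbl g))) where

      -- The neighbours of `w` are `a` and possibly `a + 2`, so only a - 2, written
      -- `a + (5 + dbl g)`, is a non-neighbour whose second successor is a neighbour.
      p≤1 : count S⁺? ≤ 1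
      p≤1 = windowS⁺ a (5 + dbl g ∷ []) λ d l (¬sd , sd2) → cover d l ¬sd (subst s (+-assoc a d 2) sd2) (d + 2 <? (κ g))
        where
        cover : ∀ d → d < κ g → ¬ s (a + d) → s (a + (d + 2)) → Dec (d + 2 < κ g) → d ∈ 5 + dbl g ∷ []
        cover d l ¬sd sd2 (yes d2<k) = inside (ss a (d + 2) d2<k sa sd2)
          where
          inside : d + 2 ∈ 0 ∷ 2 ∷ 5 + dbl g ∷ [] → d ∈ 5 + dbl g ∷ []
          inside (here e)                 = ⊥-elim (m+1+n≢0 d e)
          inside (there (here e))         = ⊥-elim (¬sd (subst (λ z → s (a + z)) (sym (+-cancelʳ-≡ 2 d 0 e)) (s0 sa)))
          inside (there (there (here e))) = ⊥-elim (¬before (subst (λ z → s (a + z)) e sd2))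
        -- Past the wrap-around only d = k - 2 and d = k - 1 remain; the latter would make `a + 1` a
        -- neighbour.
        cover d l ¬sd sd2 (no ¬d2<k) = case m≤n⇒m<n∨m≡n (≤-pred l) of λ
          { (inj₁ l′) → here (≤-antisym (≤-pred l′) (+-cancelʳ-≤ 2 _ _ (≤-trans (≤-reflexive (+-comm (5 + dbl g) 2)) (≮⇒≥ ¬d2<k))))
          ; (inj₂ refl) → ⊥-elim (case ss a 1 (s≤s (s≤s z≤n)) sa
                             (s-per (a + 1) (subst s (trans (cong (a +_) (eq (dbl g))) (sym (+-assoc a 1 (κ g)))) sd2)) of λ
                                { (here ()) ; (there (here ())) ; (there (there (here ()))) }) }
          where
          eq : ∀ e → 6 + e + 2 ≡ 1 + (7 + e)
          eq = solve-∀

      -- If `a + 2` is a neighbour too, both neighbours restrict the positions where `R` holds and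
      -- leave only a - 2. Otherwise `S²` never occurs, and of the three offsets 2, k - 4, k - 2 the
      -- first two exclude each other, as they differ by 6 modulo k.
      Q+t≤2 : count S²? + count R? ≤ 2
      Q+t≤2 = case s? (a + 2) of λ { (yes s2) → +-mono-≤ (Q≤1 s2) (t≤1 s2) ; (no ¬s2) → +-mono-≤ (Q≤0 ¬s2) t≤2 }
        where
        at-a+2 : ∀ {P : ℕ → Set} → P (a + (3 + dbl g)) → P (a + 2 + (1 + dbl g))
        at-a+2 {P} = subst P (sym (+-assoc a 2 (1 + dbl g)))
        k-6<k : 1 + dbl g < κ g
        k-6<k = m≤n+m (2 + dbl g) 5
        Q≤1 : s (a + 2) → count S²? ≤ 1
        Q≤1 s2 = windowS² a (0 ∷ []) λ d l (sd , sd2) → case ss a d l sa sd of λ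
          { (here refl) → here refl
          ; (there (here refl)) → ⊥-elim (case ss a 4 (s≤s (s≤s (s≤s (s≤s (s≤s z≤n))))) sa (subst s (+-assoc a 2 2) sd2) of λ
               { (here ()) ; (there (here ())) ; (there (there (here ()))) })
          ; (there (there (here refl))) → ⊥-elim (¬before sd) }
        t≤1 : s (a + 2) → count R? ≤ 1
        t≤1 s2 = windowR a (5 + dbl g ∷ []) λ d l r → case sR a d l sa r of λ
          { (here refl) → ⊥-elim (case sR (a + 2) 0 (s≤s z≤n) s2 (subst R (sym (+-identityʳ (a + 2))) r) of λ
               { (here ()) ; (there (here ())) ; (there (there (here ()))) })
          ; (there (here refl)) → ⊥-elim (case sR (a + 2) (1 + dbl g) k-6<k s2 (at-a+2 {R} r) of λ
               { (here e) → dbl≢odd g (0 , refl) (suc-injective e)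
               ; (there (here e)) → m≢1+n+m (1 + dbl g) {1} e
               ; (there (there (here e))) → m≢1+n+m (1 + dbl g) {3} e })
          ; (there (there (here refl))) → here refl }
        Q≤0 : ¬ s (a + 2) → count S²? ≤ 0
        Q≤0 ¬s2 = windowS² a [] λ d l (sd , sd2) → case ss a d l sa sd of λ
          { (here refl) → ⊥-elim (¬s2 (subst (λ z → s (z + 2)) (+-identityʳ a) sd2))
          ; (there (here refl)) → ⊥-elim (¬s2 sd)
          ; (there (there (here refl))) → ⊥-elim (¬before sd) }
        t≤2 : count R? ≤ 2
        t≤2 = case R? (a + 2) of λ
          { (yes r2) → windowR a (2 ∷ 5 + dbl g ∷ []) λ d l r → case sR a d l sa r of λ
              { (here refl) → here refl
              ; (there (here refl)) → ⊥-elim (case RR (a + 2) (1 + dbl g) k-6<k r2 (at-a+2 {R} r) of λ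
                  { (here ())
                  ; (there (here e)) → dbl≢odd g (0 , refl) (suc-injective e)
                  ; (there (there (here e))) → dbl≢odd g (1 , refl) (suc-injective e)
                  ; (there (there (there (here e)))) → m≢1+n+m (1 + dbl g) {1} e
                  ; (there (there (there (there (here e))))) → m≢1+n+m (1 + dbl g) {3} e })
              ; (there (there (here refl))) → there (here refl) }
          ; (no ¬r2) → windowR a (3 + dbl g ∷ 5 + dbl g ∷ []) λ d l r → case sR a d l sa r of λ
              { (here refl) → ⊥-elim (¬r2 r)
              ; (there q) → q } }

      bound : (3 + dbl g) * count S⁺? + (count S²? + count R?) ≤ 5 + dbl g
      bound = ≤-trans (+-mono-≤ (*-monoʳ-≤ (3 + dbl g) p≤1) Q+t≤2) (≤-reflexive (eq (dbl g)))
        where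
        eq : ∀ e → (3 + e) * 1 + 2 ≡ 5 + e
        eq = solve-∀

  role-count : (3 + dbl g) * count S⁺? + (count S²? + count R?) ≤ 5 + dbl g
  role-count = case any? (λ i → s? (toℕ {(κ g)} i)) of λ
    { (no none) → ≤-trans (+-mono-≤ (*-monoʳ-≤ (3 + dbl g)
                              (windowS⁺ 0 [] λ d _ (_ , q) → ⊥-elim (nowhere s-per none (0 + d + 2) q)))
                            (+-mono-≤ (windowS² 0 [] λ d _ (q , _) → ⊥-elim (nowhere s-per none (0 + d) q)) R≤5))
                          (≤-trans (≤-reflexive (cong (_+ 5) (*-zeroʳ (3 + dbl g)))) (m≤m+n 5 (dbl g)))
    ; (yes (i , sa)) → case s? (toℕ i + (5 + dbl g)) of λ
        { (no ¬q) → Based.bound (toℕ i) sa ¬q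
        -- If a - 2 is also a neighbour, it becomes the base point: a - 4 cannot be a third one,
        -- being at offset k - 4 from a.
        ; (yes q) → Based.bound (toℕ i + (5 + dbl g)) q λ q′ →
            case ss (toℕ i) (3 + dbl g) k-4<k sa (s-per (toℕ i + (3 + dbl g)) (subst s (eq (toℕ i) (dbl g)) q′)) of λ
              { (here ()) ; (there (here ())) ; (there (there (here e))) → m≢1+n+m (3 + dbl g) {1} e } } }
    where
    eq : ∀ i e → i + (5 + e) + (5 + e) ≡ i + (3 + e) + (7 + e)
    eq = solve-∀

-- Short walks between the vertices of a shortest odd cycle

module OddGirth (g : ℕ) {n : ℕ} {A : Fin n → Fin n → Set} (A-sym : ∀ {u v} → A u v → A v u)
  (no-odd : ∀ r u → r < 3 + g → ¬ Walks.Walk A (suc (dbl r)) u u) where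
  open Walks A

  odd-long : ∀ m u → Walk m u u → ∃[ e ] m ≡ suc (dbl e) → κ g ≤ m
  odd-long m u w (e , refl) = case e <? 3 + g of λ
    { (yes l) → ⊥-elim (no-odd e u l w)
    ; (no ¬l) → s≤s (dbl-mono-≤ (≮⇒≥ ¬l)) }

  module Cycle (x : ℕ → Fin n) (step : ∀ i → A (x i) (x (suc i))) (per : ∀ i → x (i + κ g) ≡ x i) where

    -- The alternatives are the two arcs of the cycle, exactly one of which has the parity of the walk.
    arc : ∀ ℓ a d → d < κ g → Walk ℓ (x a) (x (a + d)) →
          (∃[ e ] d + dbl e ≡ ℓ) ⊎ (∃[ r ] ∃[ e ] (d + r ≡ κ g × r + dbl e ≡ ℓ))
    arc ℓ a d d<k w = go (m≤n⇒∃[o]m+o≡n (<⇒≤ d<k)) (parity (ℓ + d))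
      where
      go : ∃[ r ] d + r ≡ κ g → (∃[ e ] ℓ + d ≡ dbl e) ⊎ (∃[ e ] ℓ + d ≡ suc (dbl e)) →
           (∃[ e ] d + dbl e ≡ ℓ) ⊎ (∃[ r ] ∃[ e ] (d + r ≡ κ g × r + dbl e ≡ ℓ))
      -- Closed up by the arc whose parity differs from that of the walk, the walk becomes an odd
      -- closed walk. Its length is therefore at least k, so ℓ is at least the length of the other
      -- arc.
      go (r , d+r) (inj₂ odd) = inj₂ (r , finish (m≤n⇒∃[o]m+o≡n (+-cancelʳ-≤ d r ℓ
          (≤-trans (≤-reflexive (trans (+-comm r d) d+r)) (odd-long (ℓ + d) (x a) closed odd)))))
        where
        closed : Walk (ℓ + d) (x a) (x a)
        closed = walk-++ ℓ w (walk-rev A-sym d (walk-along x step d a))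
        finish : ∃[ o ] r + o ≡ ℓ → ∃[ e ] (d + r ≡ κ g × r + dbl e ≡ ℓ)
        finish (o , refl) = case parity o of λ
          { (inj₁ (e , refl)) → e , d+r , refl
          ; (inj₂ (e , refl)) → ⊥-elim (dbl≢suc-dbl (e + (4 + g)) (proj₁ odd)
              (trans (trans (dbl-+ e (4 + g)) (trans (+-suc (dbl e) (κ g)) (trans (cong (λ z → suc (dbl e + z)) (sym d+r)) (eq d r (dbl e))))) (proj₂ odd))) }
          where
          eq : ∀ d r e → 1 + (e + (d + r)) ≡ r + (1 + e) + d
          eq = solve-∀
      go (r , d+r) (inj₁ (e , even)) = inj₁ (finish (m≤n⇒∃[o]m+o≡n (+-cancelʳ-≤ r d ℓ
          (≤-trans (≤-reflexive d+r) (odd-long (ℓ + r) (x a) closed odd)))))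
        where
        closed : Walk (ℓ + r) (x a) (x a)
        closed = walk-++ ℓ w (subst (Walk r (x (a + d))) (trans (cong x (trans (+-assoc a d r) (cong (a +_) d+r))) (per a))
                   (walk-along x step r (a + d)))
        odd : ∃[ e′ ] ℓ + r ≡ suc (dbl e′)
        odd = case parity (ℓ + r) of λ
          { (inj₂ q) → q
          ; (inj₁ (e′ , q)) → ⊥-elim (dbl≢suc-dbl (e + e′) (ℓ + (3 + g))
              (trans (dbl-+ e e′) (trans (cong₂ _+_ (sym even) (sym q))
                (trans (eq ℓ d r) (trans (cong₂ _+_ (sym (dbl≡+ ℓ)) d+r) (trans (+-suc (dbl ℓ) (6 + dbl g)) (cong suc (sym (dbl-+ ℓ (3 + g)))))))))) }
          where
          eq : ∀ ℓ d r → ℓ + d + (ℓ + r) ≡ ℓ + ℓ + (d + r)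
          eq = solve-∀
        finish : ∃[ o ] d + o ≡ ℓ → ∃[ e ] d + dbl e ≡ ℓ
        finish (o , refl) = case parity o of λ
          { (inj₁ (e′ , refl)) → e′ , refl
          ; (inj₂ (e′ , refl)) → ⊥-elim (dbl≢suc-dbl e (d + e′)
              (trans (sym even) (trans (eq d (dbl e′)) (cong suc (trans (cong (_+ dbl e′) (sym (dbl≡+ d))) (sym (dbl-+ d e′))))))) }
          where
          eq : ∀ d e → d + (1 + e) + d ≡ 1 + (d + d + e)
          eq = solve-∀

    no-triangle : ∀ u → ¬ Walk 3 u u
    no-triangle u w = no-odd 1 u (s≤s (s≤s z≤n)) w

    arc2 : ∀ a d → d < κ g → Walk 2 (x a) (x (a + d)) → d ∈ 0 ∷ 2 ∷ 5 + dbl g ∷ []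
    arc2 a d l w = case arc 2 a d l w of λ
      { (inj₁ (0 , e)) → there (here (trans (sym (+-identityʳ d)) e))
      ; (inj₁ (1 , e)) → here (+-cancelʳ-≡ 2 d 0 e)
      ; (inj₁ (suc (suc e′) , e)) → ⊥-elim (m+1+n≰m 2 (≤-trans (m≤n+m (4 + dbl e′) d) (≤-reflexive e)))
      ; (inj₂ (2 , _ , e , _)) → there (there (here (+-cancelʳ-≡ 2 d (5 + dbl g) (trans e (+-comm 2 (5 + dbl g))))))
      ; (inj₂ (0 , _ , e , _)) → ⊥-elim (<-irrefl (trans (sym (+-identityʳ d)) e) l)
      ; (inj₂ (1 , e′ , _ , e)) → ⊥-elim (dbl≢suc-dbl e′ 0 (suc-injective e))
      ; (inj₂ (suc (suc (suc r)) , e′ , _ , ())) }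

    arc3 : ∀ a d → d < κ g → Walk 3 (x a) (x (a + d)) → d ∈ 1 ∷ 3 ∷ 4 + dbl g ∷ 6 + dbl g ∷ []
    arc3 a d l w = case arc 3 a d l w of λ
      { (inj₁ (0 , e)) → there (here (trans (sym (+-identityʳ d)) e))
      ; (inj₁ (1 , e)) → here (+-cancelʳ-≡ 2 d 1 e)
      ; (inj₁ (suc (suc e′) , e)) → ⊥-elim (m+1+n≰m 3 (≤-trans (m≤n+m (4 + dbl e′) d) (≤-reflexive e)))
      ; (inj₂ (3 , _ , e , _)) → there (there (here (+-cancelʳ-≡ 3 d (4 + dbl g) (trans e (+-comm 3 (4 + dbl g))))))
      ; (inj₂ (1 , _ , e , _)) → there (there (there (here (+-cancelʳ-≡ 1 d (6 + dbl g) (trans e (+-comm 1 (6 + dbl g)))))))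
      ; (inj₂ (0 , e′ , _ , e)) → ⊥-elim (dbl≢suc-dbl e′ 1 e)
      ; (inj₂ (2 , e′ , _ , e)) → ⊥-elim (dbl≢suc-dbl e′ 0 (suc-injective (suc-injective e)))
      ; (inj₂ (suc (suc (suc (suc r))) , e′ , _ , ())) }

    arc4 : ∀ a d → d < κ g → Walk 4 (x a) (x (a + d)) → d ∈ 0 ∷ 2 ∷ 4 ∷ 3 + dbl g ∷ 5 + dbl g ∷ []
    arc4 a d l w = case arc 4 a d l w of λ
      { (inj₁ (0 , e)) → there (there (here (trans (sym (+-identityʳ d)) e)))
      ; (inj₁ (1 , e)) → there (here (+-cancelʳ-≡ 2 d 2 e))
      ; (inj₁ (2 , e)) → here (+-cancelʳ-≡ 4 d 0 e)
      ; (inj₁ (suc (suc (suc e′)) , e)) → ⊥-elim (m+1+n≰m 4 (≤-trans (≤-trans (n≤1+n _) (m≤n+m (6 + dbl e′) d)) (≤-reflexive e)))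
      ; (inj₂ (4 , _ , e , _)) → there (there (there (here (+-cancelʳ-≡ 4 d (3 + dbl g) (trans e (+-comm 4 (3 + dbl g)))))))
      ; (inj₂ (2 , _ , e , _)) → there (there (there (there (here (+-cancelʳ-≡ 2 d (5 + dbl g) (trans e (+-comm 2 (5 + dbl g))))))))
      ; (inj₂ (0 , _ , e , _)) → ⊥-elim (<-irrefl (trans (sym (+-identityʳ d)) e) l)
      ; (inj₂ (1 , e′ , _ , e)) → ⊥-elim (dbl≢suc-dbl e′ 1 (suc-injective e))
      ; (inj₂ (3 , e′ , _ , e)) → ⊥-elim (dbl≢suc-dbl e′ 0 (suc-injective (suc-injective (suc-injective e))))
      ; (inj₂ (suc (suc (suc (suc (suc r)))) , e′ , _ , ())) }

    module Roles (A? : ∀ u v → Dec (A u v)) (w : Fin n) where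

      s : ℕ → Set
      s i = A (x i) w
      s? : ∀ i → Dec (s i)
      s? i = A? (x i) w
      R : ℕ → Set
      R i = Walk 2 (x (suc i)) w × Walk (4 + dbl g) w (x i)
      R? : ∀ i → Dec (R i)
      R? i = walk? A? 2 (x (suc i)) w ×-dec walk? A? (4 + dbl g) w (x i)

      s-per : ∀ i → s (i + κ g) → s i
      s-per i = subst (λ z → A z w) (per i)
      s-per⁻ : ∀ i → s i → s (i + κ g)
      s-per⁻ i = subst (λ z → A z w) (sym (per i))
      R-per : ∀ i → R (i + κ g) → R i
      R-per i = subst₂ (λ y z → Walk 2 y w × Walk (4 + dbl g) w z) (per (suc i)) (per i)
      R-per⁻ : ∀ i → R i → R (i + κ g)
      R-per⁻ i = subst₂ (λ y z → Walk 2 y w × Walk (4 + dbl g) w z) (sym (per (suc i))) (sym (per i))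

      ss : ∀ a d → d < κ g → s a → s (a + d) → d ∈ 0 ∷ 2 ∷ 5 + dbl g ∷ []
      ss a d l p q = arc2 a d l (w , p , x (a + d) , A-sym q , refl)

      RR : ∀ a d → d < κ g → R a → R (a + d) → d ∈ 0 ∷ 2 ∷ 4 ∷ 3 + dbl g ∷ 5 + dbl g ∷ []
      RR a d l (p , _) (q , _) = arc4 (suc a) d l (walk-++ 2 p (walk-rev A-sym 2 q))

      -- The edge at `x a` extends the walk of length two to one of length three ending in
      -- `x (suc (a + d))`, so `arc3` applies to d + 1. The value d + 1 = 1 would let the long walk
      -- in `R` close up with the edge to length k - 2.
      sR : ∀ a d → d < κ g → s a → R (a + d) → d ∈ 2 ∷ 3 + dbl g ∷ 5 + dbl g ∷ []
      sR a d l p (q , q′) = case m≤n⇒m<n∨m≡n l of λ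
        { (inj₂ refl) → ⊥-elim (no-triangle (x a)
            (w , p , subst (Walk 2 w) (trans (cong x (sym (+-suc a d))) (per a)) (walk-rev A-sym 2 q)))
        ; (inj₁ sd<k) → case arc3 a (suc d) sd<k (w , p , subst (λ z → Walk 2 w (x z)) (sym (+-suc a d)) (walk-rev A-sym 2 q)) of λ
            { (here refl) → ⊥-elim (no-odd (2 + g) (x a) ≤-refl (w , p , subst (λ z → Walk (4 + dbl g) w (x z)) (+-identityʳ a) q′))
            ; (there (here refl)) → here refl
            ; (there (there (here refl))) → there (here refl)
            ; (there (there (there (here refl)))) → there (there (here refl)) } }

      open RoleCount g s? R? s-per s-per⁻ R-per R-per⁻ ss RR sR public

-- Weighted counting of shortest odd cycles

-- A choice among a candidates lowers the budget c by w·a; weighted AM-GM bounds the sum over the choices.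
choice-step : ∀ {n} m c w D {P : Fin n → Set} (P? : ∀ x → Dec (P x)) (S : Fin n → ℕ) →
  (∀ x → suc m ^ suc m * D * S x ≤ (c ∸ w * # P?) ^ suc m) →
  suc (suc m) ^ suc (suc m) * (w * D) * ∑ (allFin n) (λ x → 𝟙 (P? x) * S x) ≤ c ^ suc (suc m)
choice-step {n} m c w D P? S hyp = *-cancelˡ-≤ E {{m^n≢0 (suc m) (suc m)}} (begin
  E * (F * (w * D) * Tot)  ≡⟨ eq₁ E F w D Tot ⟩
  F * (w * (E * D * Tot))  ≤⟨ *-monoʳ-≤ F (*-monoʳ-≤ w sum-bound) ⟩
  F * (w * (a * b ^ suc m))  ≡⟨ cong (F *_) (sym (*-assoc w a (b ^ suc m))) ⟩
  F * (w * a * b ^ suc m)  ≤⟨ last (w * a ≤? c) ⟩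
  E * c ^ suc (suc m)                ∎)
  where
  open ≤-Reasoning
  E = suc m ^ suc m
  F = suc (suc m) ^ suc (suc m)
  a = # P?
  b = c ∸ w * a
  Tot = ∑ (allFin n) (λ x → 𝟙 (P? x) * S x)
  eq₁ : ∀ E F w D Tot → E * (F * (w * D) * Tot) ≡ F * (w * (E * D * Tot))
  eq₁ = solve-∀
  eq₂ : ∀ C i s → C * (i * s) ≡ i * (C * s)
  eq₂ = solve-∀
  sum-bound : E * D * Tot ≤ a * b ^ suc m
  sum-bound = begin
    E * D * Tot  ≡⟨ sym (∑-*ˡ (allFin n) (E * D) _) ⟩
    ∑ (allFin n) (λ x → E * D * (𝟙 (P? x) * S x))    ≤⟨ ∑-mono (allFin n) (λ x → ≤-trans (≤-reflexive (eq₂ (E * D) (𝟙 (P? x)) (S x)))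
            (*-monoʳ-≤ (𝟙 (P? x)) (hyp x))) ⟩
    ∑ (allFin n) (λ x → 𝟙 (P? x) * b ^ suc m)        ≡⟨ ∑-*ʳ (allFin n) (b ^ suc m) _ ⟩
    a * b ^ suc m                                    ∎
  last : Dec (w * a ≤ c) → F * (w * a * b ^ suc m) ≤ E * c ^ suc (suc m)
  last (yes l) = ≤-trans (am-gm-step (suc m) (w * a) b) (≤-reflexive (cong (λ z → E * z ^ suc (suc m)) (m+[n∸m]≡n l)))
  -- An overdrawn budget is truncated to `b = 0`, and the left-hand side vanishes.
  last (no ¬l) = ≤-trans (≤-reflexive (trans (cong (λ z → F * (w * a * z ^ suc m)) (m≤n⇒m∸n≡0 (<⇒≤ (≰⇒> ¬l))))
                   (trans (cong (F *_) (*-zeroʳ (w * a))) (*-zeroʳ F)))) z≤n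

∑-∸ : {A : Set} (xs : List A) (c : ℕ) (f : A → ℕ) → length xs * c ∸ ∑ xs f ≤ ∑ xs (λ x → c ∸ f x)
∑-∸ xs c f = m≤n+o⇒m∸n≤o _ (∑ xs f) (begin
  length xs * c  ≡⟨ sym (∑-const xs c) ⟩
  ∑ xs (λ _ → c)  ≤⟨ ∑-mono xs (λ x → m≤n+m∸n c (f x)) ⟩
  ∑ xs (λ x → f x + (c ∸ f x))       ≡⟨ ∑-+ xs f _ ⟩
  ∑ xs f + ∑ xs (λ x → c ∸ f x)      ∎)
  where open ≤-Reasoning

module Weights (g : ℕ) {n : ℕ} {A : Fin n → Fin n → Set} (A? : ∀ u v → Dec (A u v)) (A-sym : ∀ {u v} → A u v → A v u)
  (no-odd : ∀ r u → r < 3 + g → ¬ Walks.Walk A (suc (dbl r)) u u) where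
  open Walks A
  open OddGirth g A-sym no-odd

  -- Candidates for the vertices of a cycle z₀z₁z₂…, chosen in the order z₀, z₁, z₃, z₂, z₄, z₅, …:
  -- third? for z₃, second? for z₂, and later? for z_{k-m}.
  third? : ∀ z₀ z₁ w → Dec (Walk 2 z₁ w × Walk (4 + dbl g) w z₀)
  third? z₀ z₁ w = walk? A? 2 z₁ w ×-dec walk? A? (4 + dbl g) w z₀

  second? : ∀ z₁ z₃ w → Dec (A z₁ w × A z₃ w)
  second? z₁ z₃ w = A? z₁ w ×-dec A? z₃ w

  later? : ∀ z₀ y m w → Dec (A y w × Walk m w z₀)
  later? z₀ y m w = A? y w ×-dec walk? A? m w z₀

  tail-weight : ∀ {m} → ℕ → Fin n → Fin n → Vec (Fin n) m → ℕ
  tail-weight          c z₀ y []       = c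
  tail-weight {suc m} c z₀ y (x ∷ xs) = 𝟙 (later? z₀ y (suc m) x) * tail-weight (c ∸ 2 * # (later? z₀ y (suc m))) z₀ x xs

  weight : ℕ → Vec (Fin n) (κ g) → ℕ
  weight c (z₀ ∷ z₁ ∷ z₂ ∷ z₃ ∷ zs) =
    let c₁ = c ∸ 1 * # (A? z₀)
        c₂ = c₁ ∸ 2 * # (third? z₀ z₁)
        c₃ = c₂ ∸ 2 * # (second? z₁ z₃)
    in 𝟙 (A? z₀ z₁) * (𝟙 (third? z₀ z₁ z₃) * (𝟙 (second? z₁ z₃ z₂) * tail-weight c₃ z₀ z₃ zs))

  -- The budget left over at the end acts as one more factor: AM-GM is applied to the `m` charges
  -- and this remainder, whence the exponent `suc m`, while each of the `m` charges has factor 2.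
  tail-bound : ∀ m c z₀ y → suc m ^ suc m * 2 ^ m * ∑ (vecs n m) (tail-weight c z₀ y) ≤ c ^ suc m
  tail-bound zero    c z₀ y = ≤-reflexive (eq c)
    where
    eq : ∀ c → 1 * 1 * (c + 0) ≡ c * 1
    eq = solve-∀
  tail-bound (suc m) c z₀ y = ≤-trans
    (≤-reflexive (cong (suc (suc m) ^ suc (suc m) * 2 ^ suc m *_)
      (trans (∑-vecs-suc (tail-weight c z₀ y)) (∑-cong (allFin n) λ x → ∑-*ˡ (vecs n m) (𝟙 (later? z₀ y (suc m) x)) (tail-weight c′ z₀ x)))))
    (choice-step m c 2 (2 ^ m) (later? z₀ y (suc m)) (λ x → ∑ (vecs n m) (tail-weight c′ z₀ x)) (λ x → tail-bound m c′ z₀ x))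
    where
    c′ = c ∸ 2 * # (later? z₀ y (suc m))

  pull : ∀ {B : Set} (xs : List B) (a b : ℕ) (f : B → ℕ) → ∑ xs (λ x → a * (b * f x)) ≡ a * (b * ∑ xs f)
  pull xs a b f = trans (∑-*ˡ xs a _) (cong (a *_) (∑-*ˡ xs b f))

  rooted-bound : ∀ c z₀ → κ g ^ κ g * (1 * 2 ^ (5 + dbl g)) * ∑ (vecs n (6 + dbl g)) (λ v → weight c (z₀ ∷ v)) ≤ c ^ κ g
  rooted-bound c z₀ = ≤-trans (≤-reflexive (cong (κ g ^ κ g * (1 * 2 ^ (5 + dbl g)) *_) rearrange))
    (choice-step (5 + dbl g) c 1 (2 ^ (5 + dbl g)) (A? z₀) _ λ z₁ →
      choice-step (4 + dbl g) _ 2 (2 ^ (4 + dbl g)) (third? z₀ z₁) _ λ z₃ →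
        choice-step (3 + dbl g) _ 2 (2 ^ (3 + dbl g)) (second? z₁ z₃) _ λ z₂ →
          tail-bound (3 + dbl g) _ z₀ z₃)
    where
    open ≡-Reasoning
    V = allFin n
    c₁ = c ∸ 1 * # (A? z₀)
    c₂ : Fin n → ℕ
    c₂ z₁ = c₁ ∸ 2 * # (third? z₀ z₁)
    c₃ : Fin n → Fin n → ℕ
    c₃ z₁ z₃ = c₂ z₁ ∸ 2 * # (second? z₁ z₃)
    S : Fin n → Fin n → Fin n → ℕ
    S z₁ z₃ z₂ = ∑ (vecs n (3 + dbl g)) (tail-weight (c₃ z₁ z₃) z₀ z₃)
    rearrange : ∑ (vecs n (6 + dbl g)) (λ v → weight c (z₀ ∷ v)) ≡
      ∑ V (λ z₁ → 𝟙 (A? z₀ z₁) * ∑ V (λ z₃ → 𝟙 (third? z₀ z₁ z₃) * ∑ V (λ z₂ → 𝟙 (second? z₁ z₃ z₂) * S z₁ z₃ z₂)))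
    rearrange = trans (∑-vecs-suc {n} {5 + dbl g} (λ v → weight c (z₀ ∷ v))) (∑-cong V λ z₁ → begin
      ∑ (vecs n (5 + dbl g)) (λ v → weight c (z₀ ∷ z₁ ∷ v))
        ≡⟨ ∑-vecs-suc {n} {4 + dbl g} (λ v → weight c (z₀ ∷ z₁ ∷ v)) ⟩
      ∑ V (λ z₂ → ∑ (vecs n (4 + dbl g)) (λ v → weight c (z₀ ∷ z₁ ∷ z₂ ∷ v)))
        ≡⟨ ∑-cong V (λ z₂ → ∑-vecs-suc {n} {3 + dbl g} (λ v → weight c (z₀ ∷ z₁ ∷ z₂ ∷ v))) ⟩
      ∑ V (λ z₂ → ∑ V (λ z₃ → ∑ (vecs n (3 + dbl g)) (λ v → weight c (z₀ ∷ z₁ ∷ z₂ ∷ z₃ ∷ v))))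
        -- `z₃` is chosen before `z₂`.
        ≡⟨ ∑-comm V V _ ⟩
      ∑ V (λ z₃ → ∑ V (λ z₂ → ∑ (vecs n (3 + dbl g)) (λ v → weight c (z₀ ∷ z₁ ∷ z₂ ∷ z₃ ∷ v))))
        ≡⟨ ∑-cong V (λ z₃ → ∑-cong V λ z₂ → trans (pull (vecs n (3 + dbl g)) (𝟙 (A? z₀ z₁)) (𝟙 (third? z₀ z₁ z₃)) _)
             (cong (λ t → 𝟙 (A? z₀ z₁) * (𝟙 (third? z₀ z₁ z₃) * t)) (∑-*ˡ (vecs n (3 + dbl g)) (𝟙 (second? z₁ z₃ z₂)) _))) ⟩
      ∑ V (λ z₃ → ∑ V (λ z₂ → 𝟙 (A? z₀ z₁) * (𝟙 (third? z₀ z₁ z₃) * (𝟙 (second? z₁ z₃ z₂) * S z₁ z₃ z₂))))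
        ≡⟨ ∑-cong V (λ z₃ → pull V (𝟙 (A? z₀ z₁)) (𝟙 (third? z₀ z₁ z₃)) _) ⟩
      ∑ V (λ z₃ → 𝟙 (A? z₀ z₁) * (𝟙 (third? z₀ z₁ z₃) * ∑ V (λ z₂ → 𝟙 (second? z₁ z₃ z₂) * S z₁ z₃ z₂)))
        ≡⟨ ∑-*ˡ V (𝟙 (A? z₀ z₁)) _ ⟩
      𝟙 (A? z₀ z₁) * ∑ V (λ z₃ → 𝟙 (third? z₀ z₁ z₃) * ∑ V (λ z₂ → 𝟙 (second? z₁ z₃ z₂) * S z₁ z₃ z₂)) ∎)

  weight-bound : ∀ c → κ g ^ κ g * 2 ^ (5 + dbl g) * ∑ (vecs n (κ g)) (weight c) ≤ n * c ^ κ g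
  weight-bound c = begin
    κ g ^ κ g * 2 ^ (5 + dbl g) * ∑ (vecs n (κ g)) (weight c)
      ≡⟨ cong₂ (λ s t → κ g ^ κ g * s * t) (sym (*-identityˡ (2 ^ (5 + dbl g)))) (∑-vecs-suc {n} {6 + dbl g} (weight c)) ⟩
    κ g ^ κ g * (1 * 2 ^ (5 + dbl g)) * ∑ (allFin n) (λ z₀ → ∑ (vecs n (6 + dbl g)) (λ v → weight c (z₀ ∷ v)))
      ≡⟨ sym (∑-*ˡ (allFin n) (κ g ^ κ g * (1 * 2 ^ (5 + dbl g))) _) ⟩
    ∑ (allFin n) (λ z₀ → κ g ^ κ g * (1 * 2 ^ (5 + dbl g)) * ∑ (vecs n (6 + dbl g)) (λ v → weight c (z₀ ∷ v)))
      ≤⟨ ∑-mono (allFin n) (rooted-bound c) ⟩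
    ∑ (allFin n) (λ _ → c ^ κ g)
      ≡⟨ ∑-allFin-const n (c ^ κ g) ⟩
    n * c ^ κ g ∎
    where open ≤-Reasoning

  module _ (x : ℕ → Fin n) (step : ∀ i → A (x i) (x (suc i))) (per : ∀ i → x (i + κ g) ≡ x i) where

    later-cost : Fin n → ℕ → ℕ → ℕ
    later-cost z₀ zero    b = 0
    later-cost z₀ (suc m) b = # (later? z₀ (x b) (suc m)) + later-cost z₀ m (suc b)

    cost : ℕ → ℕ
    cost b = # (third? (x b) (x (suc b))) + # (second? (x (suc b)) (x (3 + b))) + later-cost (x b) (3 + dbl g) (3 + b)

    tail-weight-≥ : ∀ {m} (xs : Vec (Fin n) m) c b z₀ → (∀ i → lookup xs i ≡ x (suc b + toℕ i)) → x (b + suc m) ≡ z₀ →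
      c ∸ 2 * later-cost z₀ m b ≤ tail-weight c z₀ (x b) xs
    tail-weight-≥ []       c b z₀ _  _   = ≤-refl
    tail-weight-≥ {suc m} (y ∷ ys) c b z₀ eq end =
      subst (λ y → c ∸ 2 * later-cost z₀ (suc m) b ≤ 𝟙 (later? z₀ (x b) (suc m) y) * tail-weight (c ∸ 2 * a) z₀ y ys)
        (sym (trans (eq fzero) (cong x (+-identityʳ (suc b))))) (begin
      c ∸ 2 * (a + later-cost z₀ m (suc b))  ≡⟨ cong (c ∸_) (*-distribˡ-+ 2 a _) ⟩
      c ∸ (2 * a + 2 * later-cost z₀ m (suc b))      ≡⟨ sym (∸-+-assoc c (2 * a) _) ⟩
      c ∸ 2 * a ∸ 2 * later-cost z₀ m (suc b)        ≤⟨ tail-weight-≥ ys (c ∸ 2 * a) (suc b) z₀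
            (λ i → trans (eq (fsuc i)) (cong x (+-suc (suc b) (toℕ i))))
            (trans (cong x (sym (+-suc b (suc m)))) end) ⟩
      tail-weight (c ∸ 2 * a) z₀ (x (suc b)) ys      ≡⟨ sym (*-identityˡ _) ⟩
      1 * tail-weight (c ∸ 2 * a) z₀ (x (suc b)) ys  ≡⟨ cong (_* tail-weight (c ∸ 2 * a) z₀ (x (suc b)) ys)
            (sym (𝟙-yes (later? z₀ (x b) (suc m) (x (suc b)))
            (step b , subst (Walk (suc m) (x (suc b))) (trans (cong x (sym (+-suc b (suc m)))) end)
            (walk-along x step (suc m) (suc b))))) ⟩
      𝟙 (later? z₀ (x b) (suc m) (x (suc b))) * tail-weight (c ∸ 2 * a) z₀ (x (suc b)) ys ∎)
      where
      open ≤-Reasoning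
      a = # (later? z₀ (x b) (suc m))

    weight-≥ : ∀ v c b → (∀ m → at v m ≡ x (b + m)) → c ∸ (# (A? (x b)) + 2 * cost b) ≤ weight c v
    weight-≥ (v₀ ∷ v₁ ∷ v₂ ∷ v₃ ∷ vs) c b eq =
      go v₀ v₁ v₂ v₃ (trans (eq 0) (cong x (+-identityʳ b))) (trans (eq 1) (cong x (+-comm b 1)))
        (trans (eq 2) (cong x (+-comm b 2))) (trans (eq 3) (cong x (+-comm b 3)))
        (λ i → trans (sym (at-toℕ (v₀ ∷ v₁ ∷ v₂ ∷ v₃ ∷ vs) (fsuc (fsuc (fsuc (fsuc i))))))
                 (trans (eq (4 + toℕ i)) (cong x (eq₁ b (toℕ i)))))
      where
      open ≤-Reasoning
      eq₁ : ∀ b i → b + (4 + i) ≡ 4 + b + i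
      eq₁ = solve-∀
      eq₂ : ∀ b e → 3 + b + (4 + e) ≡ b + (7 + e)
      eq₂ = solve-∀
      eq₄ : ∀ d a s l → d + 2 * (a + s + l) ≡ 1 * d + 2 * a + 2 * s + 2 * l
      eq₄ = solve-∀
      go : ∀ y₀ y₁ y₂ y₃ → y₀ ≡ x b → y₁ ≡ x (suc b) → y₂ ≡ x (2 + b) → y₃ ≡ x (3 + b) →
           (∀ i → lookup vs i ≡ x (4 + b + toℕ i)) →
           c ∸ (# (A? (x b)) + 2 * cost b) ≤ weight c (y₀ ∷ y₁ ∷ y₂ ∷ y₃ ∷ vs)
      go .(x b) .(x (suc b)) .(x (2 + b)) .(x (3 + b)) refl refl refl refl rest = begin
        c ∸ (d + 2 * (a₃ + a₂ + l))  ≡⟨ cong (c ∸_) (eq₄ d a₃ a₂ l) ⟩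
        c ∸ (1 * d + 2 * a₃ + 2 * a₂ + 2 * l)  ≡⟨ sym (∸-+-assoc c (1 * d + 2 * a₃ + 2 * a₂) (2 * l)) ⟩
        c ∸ (1 * d + 2 * a₃ + 2 * a₂) ∸ 2 * l  ≡⟨ cong (_∸ 2 * l) (sym (∸-+-assoc c (1 * d + 2 * a₃) (2 * a₂))) ⟩
        c ∸ (1 * d + 2 * a₃) ∸ 2 * a₂ ∸ 2 * l  ≡⟨ cong (λ t → t ∸ 2 * a₂ ∸ 2 * l) (sym (∸-+-assoc c (1 * d) (2 * a₃))) ⟩
        c₃ ∸ 2 * l  ≤⟨ tail-weight-≥ vs c₃ (3 + b) (x b) rest (trans (cong x (eq₂ b (dbl g))) (per b)) ⟩
        W  ≡⟨ sym (ones (A? (x b) (x (suc b))) (third? (x b) (x (suc b)) (x (3 + b)))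
            (second? (x (suc b)) (x (3 + b)) (x (2 + b))) W (step b)
            ((x (2 + b) , step (suc b) , x (3 + b) , step (2 + b) , refl) ,
            subst (Walk (4 + dbl g) (x (3 + b))) (trans (cong x (eq₂ b (dbl g))) (per b))
            (walk-along x step (4 + dbl g) (3 + b)))
            (step (suc b) , A-sym (step (2 + b)))) ⟩
        weight c (x b ∷ x (suc b) ∷ x (2 + b) ∷ x (3 + b) ∷ vs) ∎
        where
        d = # (A? (x b))
        a₃ = # (third? (x b) (x (suc b)))
        a₂ = # (second? (x (suc b)) (x (3 + b)))
        l = later-cost (x b) (3 + dbl g) (3 + b)
        c₃ = c ∸ 1 * d ∸ 2 * a₃ ∸ 2 * a₂
        W = tail-weight c₃ (x b) (x (3 + b)) vs
        ones : {P Q R : Set} (p? : Dec P) (q? : Dec Q) (r? : Dec R) (W : ℕ) → P → Q → R →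
               𝟙 p? * (𝟙 q? * (𝟙 r? * W)) ≡ W
        ones p? q? r? W p q r rewrite 𝟙-yes p? p | 𝟙-yes q? q | 𝟙-yes r? r = eq₅ W
          where
          eq₅ : ∀ W → 1 * (1 * (1 * W)) ≡ W
          eq₅ = solve-∀

    -- Each vertex is a candidate for at most k − 2 of the positions, over all rotations.
    total-cost : ∑ (downFrom (κ g)) cost ≤ n * (5 + dbl g)
    total-cost = begin
      ∑ (downFrom (κ g)) cost
        ≡⟨ trans (∑-cong (downFrom (κ g)) λ b → trans (cong (# (third? (x b) (x (suc b))) + # (second? (x (suc b)) (x (3 + b))) +_) (later-cost-∑ (x b) (3 + dbl g) (3 + b)))
             (trans (cong (_+ ∑ V (role (x b) (3 + dbl g) (3 + b))) (sym (∑-+ V _ _))) (sym (∑-+ V _ _)))) (∑-comm (downFrom (κ g)) V _) ⟩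
      ∑ V (λ w → ∑ (downFrom (κ g)) (λ b → 𝟙 (third? (x b) (x (suc b)) w) + 𝟙 (second? (x (suc b)) (x (3 + b)) w) + role (x b) (3 + dbl g) (3 + b) w))
        ≤⟨ ∑-mono V per-vertex ⟩
      ∑ V (λ _ → 5 + dbl g)
        ≡⟨ ∑-allFin-const n (5 + dbl g) ⟩
      n * (5 + dbl g) ∎
      where
      open ≤-Reasoning
      V = allFin n
      role : Fin n → ℕ → ℕ → Fin n → ℕ
      role z₀ zero    b w = 0
      role z₀ (suc m) b w = 𝟙 (later? z₀ (x b) (suc m) w) + role z₀ m (suc b) w
      later-cost-∑ : ∀ z₀ m b → later-cost z₀ m b ≡ ∑ V (role z₀ m b)
      later-cost-∑ z₀ zero    b = sym (∑-zero V)
      later-cost-∑ z₀ (suc m) b = trans (cong (# (later? z₀ (x b) (suc m)) +_) (later-cost-∑ z₀ m (suc b))) (sym (∑-+ V _ _))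
      per-vertex : ∀ w → ∑ (downFrom (κ g)) (λ b → 𝟙 (third? (x b) (x (suc b)) w) + 𝟙 (second? (x (suc b)) (x (3 + b)) w) + role (x b) (3 + dbl g) (3 + b) w) ≤ 5 + dbl g
      per-vertex w = begin
        ∑ (downFrom (κ g)) (λ b → 𝟙 (R? b) + 𝟙 (second? (x (suc b)) (x (3 + b)) w) + role (x b) (3 + dbl g) (3 + b) w)
          ≡⟨ trans (∑-+ (downFrom (κ g)) (λ b → 𝟙 (R? b) + f₂ b) f₃) (cong (_+ ∑ (downFrom (κ g)) f₃) (∑-+ (downFrom (κ g)) (λ b → 𝟙 (R? b)) f₂)) ⟩
        t + ∑ (downFrom (κ g)) (λ b → 𝟙 (second? (x (suc b)) (x (3 + b)) w)) + ∑ (downFrom (κ g)) (λ b → role (x b) (3 + dbl g) (3 + b) w)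
          ≤⟨ +-mono-≤ (+-monoʳ-≤ t (≤-reflexive seconds)) (roles (3 + dbl g) 0 refl) ⟩
        t + Q + (3 + dbl g) * p
          ≡⟨ eq₁ t Q ((3 + dbl g) * p) ⟩
        (3 + dbl g) * p + (Q + t)
          ≤⟨ role-count ⟩
        5 + dbl g ∎
        where
        open Cycle x step per using (module Roles)
        open Roles A? w
        f₂ f₃ : ℕ → ℕ
        f₂ b = 𝟙 (second? (x (suc b)) (x (3 + b)) w)
        f₃ b = role (x b) (3 + dbl g) (3 + b) w
        t = ∑ (downFrom (κ g)) (λ i → 𝟙 (R? i))
        Q = ∑ (downFrom (κ g)) (λ i → 𝟙 (S²? i))
        p = ∑ (downFrom (κ g)) (λ i → 𝟙 (S⁺? i))
        eq₁ : ∀ a b c → a + b + c ≡ c + (b + a)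
        eq₁ = solve-∀
        shift2 : ∀ i → i + κ g + 2 ≡ i + 2 + κ g
        shift2 i = trans (+-assoc i (κ g) 2) (trans (cong (i +_) (+-comm (κ g) 2)) (sym (+-assoc i 2 (κ g))))
        S²-per : ∀ i → 𝟙 (S²? (i + κ g)) ≡ 𝟙 (S²? i)
        S²-per i = 𝟙-cong (S²? (i + κ g)) (S²? i) (λ (a , b) → s-per i a , s-per (i + 2) (subst s (shift2 i) b))
                     (λ (a , b) → s-per⁻ i a , subst s (sym (shift2 i)) (s-per⁻ (i + 2) b))
        S⁺-per : ∀ i → 𝟙 (S⁺? (i + κ g)) ≡ 𝟙 (S⁺? i)
        S⁺-per i = 𝟙-cong (S⁺? (i + κ g)) (S⁺? i) (λ (a , b) → (λ z → a (s-per⁻ i z)) , s-per (i + 2) (subst s (shift2 i) b))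
                     (λ (a , b) → (λ z → a (s-per i z)) , subst s (sym (shift2 i)) (s-per⁻ (i + 2) b))
        seconds : ∑ (downFrom (κ g)) (λ b → 𝟙 (second? (x (suc b)) (x (3 + b)) w)) ≡ Q
        seconds = trans (∑-cong (downFrom (κ g)) λ b → 𝟙-cong (second? (x (suc b)) (x (3 + b)) w) (S²? (1 + b))
                          (λ (a , c) → a , subst s (+-comm 2 (suc b)) c) (λ (a , c) → a , subst s (+-comm (suc b) 2) c))
                        (∑-periodic (κ g) (λ i → 𝟙 (S²? i)) S²-per 1)
        roles : ∀ m j → j + m ≡ 3 + dbl g → ∑ (downFrom (κ g)) (λ b → role (x b) m (3 + j + b) w) ≤ m * p
        roles zero    j e = ≤-reflexive (∑-zero (downFrom (κ g)))
        roles (suc m) j e = ≤-trans (≤-reflexive (∑-+ (downFrom (κ g)) (λ b → 𝟙 (later? (x b) (x (3 + j + b)) (suc m) w)) (λ b → role (x b) m (4 + j + b) w)))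
          (+-mono-≤ first (roles m (suc j) (trans (sym (+-suc j m)) e)))
          where
          eq₂ : ∀ j b → 3 + j + b ≡ 1 + j + b + 2
          eq₂ = solve-∀
          eq₃ : ∀ j m → 1 + j + (1 + (1 + m)) ≡ 2 + (j + (1 + m))
          eq₃ = solve-∀
          eq₄ : ∀ j b → 1 + j + b ≡ b + (1 + j)
          eq₄ = solve-∀
          -- An edge from `w` to position `1 + j + b` would close a walk of length (1 + j) + 1 + (1
          -- + m) = k - 2 through `x b`.
          forced : ∀ b → A (x (3 + j + b)) w × Walk (suc m) w (x b) → (¬ s (1 + j + b)) × s (1 + j + b + 2)
          forced b (a , q) = (λ a′ → no-odd (2 + g) (x b) ≤-refl (subst (λ l → Walk l (x b) (x b))
                                (trans (eq₃ j m) (cong (2 +_) e))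
                                (walk-++ (1 + j) (subst (λ z → Walk (1 + j) (x b) (x z)) (sym (eq₄ j b)) (walk-along x step (1 + j) b)) (w , a′ , q)))) ,
                             subst s (eq₂ j b) a
          first : ∑ (downFrom (κ g)) (λ b → 𝟙 (later? (x b) (x (3 + j + b)) (suc m) w)) ≤ p
          first = ≤-trans (∑-mono (downFrom (κ g)) λ b → 𝟙-mono (later? (x b) (x (3 + j + b)) (suc m) w) (S⁺? (1 + j + b)) (forced b))
                    (≤-reflexive (∑-periodic (κ g) (λ i → 𝟙 (S⁺? i)) S⁺-per (1 + j)))

  rotⁿ : ℕ → Vec (Fin n) (κ g) → Vec (Fin n) (κ g)
  rotⁿ zero    v = v
  rotⁿ (suc i) v = rotⁿ i (rot v)

  at-rotⁿ : ∀ i v m → at (rotⁿ i v) m ≡ at v (i + m)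
  at-rotⁿ zero    v m = refl
  at-rotⁿ (suc i) v m = trans (at-rotⁿ i (rot v) m) (at-rot v (i + m))

  ∑-rotⁿ : ∀ i (F : Vec (Fin n) (κ g) → ℕ) →
    ∑ (vecs n (κ g)) (λ v → 𝟙 (closed? A? v) * F (rotⁿ i v)) ≡ ∑ (vecs n (κ g)) (λ v → 𝟙 (closed? A? v) * F v)
  ∑-rotⁿ zero    F = refl
  ∑-rotⁿ (suc i) F = trans (∑-closed-rot A? (λ v → F (rotⁿ i v))) (∑-rotⁿ i F)

  degree-sum : Vec (Fin n) (κ g) → ℕ
  degree-sum v = ∑ (downFrom (κ g)) (λ i → # (A? (at v i)))

  -- The k rotations have the total budget 2kn. Their first charges add up to the degree sum, the
  -- others by `total-cost` to at most 2n(k - 2), which leaves 4n minus the degree sum.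
  rotations-weight : ∀ v → Closed A v → 4 * n ∸ degree-sum v ≤ ∑ (downFrom (κ g)) (λ i → weight (2 * n) (rotⁿ i v))
  rotations-weight v cl = begin
    4 * n ∸ degree-sum v
      ≡⟨ trans (sym ([m+n]∸[m+o]≡n∸o (2 * (n * (5 + dbl g))) (4 * n) (degree-sum v)))
           (cong₂ _∸_ (eq n (dbl g)) (+-comm (2 * (n * (5 + dbl g))) (degree-sum v))) ⟩
    κ g * (2 * n) ∸ (degree-sum v + 2 * (n * (5 + dbl g)))
      ≤⟨ ∸-monoʳ-≤ (κ g * (2 * n)) (+-monoʳ-≤ (degree-sum v) (*-monoʳ-≤ 2 (total-cost x step per))) ⟩
    κ g * (2 * n) ∸ (degree-sum v + 2 * ∑ (downFrom (κ g)) (cost x step per))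
      ≡⟨ cong₂ (λ l t → l * (2 * n) ∸ t) (sym (length-downFrom (κ g)))
           (trans (cong (degree-sum v +_) (sym (∑-*ˡ (downFrom (κ g)) 2 (cost x step per)))) (sym (∑-+ (downFrom (κ g)) (λ i → # (A? (x i))) (λ i → 2 * cost x step per i)))) ⟩
    length (downFrom (κ g)) * (2 * n) ∸ ∑ (downFrom (κ g)) (λ i → # (A? (x i)) + 2 * cost x step per i)
      ≤⟨ ∑-∸ (downFrom (κ g)) (2 * n) (λ i → # (A? (x i)) + 2 * cost x step per i) ⟩
    ∑ (downFrom (κ g)) (λ i → 2 * n ∸ (# (A? (x i)) + 2 * cost x step per i))
      ≤⟨ ∑-mono (downFrom (κ g)) (λ i → weight-≥ x step per (rotⁿ i v) (2 * n) i (at-rotⁿ i v)) ⟩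
    ∑ (downFrom (κ g)) (λ i → weight (2 * n) (rotⁿ i v)) ∎
    where
    open ≤-Reasoning
    x : ℕ → Fin n
    x = at v
    step : ∀ i → A (x i) (x (suc i))
    step = closed⇒at {R = A} v cl
    per : ∀ i → x (i + κ g) ≡ x i
    per = at-+ v
    eq : ∀ n e → 2 * (n * (5 + e)) + 4 * n ≡ (7 + e) * (2 * n)
    eq = solve-∀

  -- Rotation permutes the closed sequences, so the rotations together weigh k times the total
  -- weight. For degree sums equal to 2n this bounds the number of closed sequences by 2k(n/k)^k,
  -- the value for a balanced blow-up; a smaller degree sum is a gain over it.
  cycle-degree-bound : (κ g) ^ κ g * ∑ (vecs n (κ g)) (λ v → 𝟙 (closed? A? v) * (4 * n ∸ degree-sum v)) ≤ 4 * κ g * (n * n ^ κ g)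
  cycle-degree-bound = *-cancelʳ-≤ _ _ (2 ^ (5 + dbl g)) {{m^n≢0 2 (5 + dbl g)}} (begin
    κ g ^ κ g * ∑ (vecs n (κ g)) (λ v → 𝟙 (closed? A? v) * (4 * n ∸ degree-sum v)) * 2 ^ (5 + dbl g)
      ≡⟨ eq₁ (κ g ^ κ g) _ (2 ^ (5 + dbl g)) ⟩
    κ g ^ κ g * 2 ^ (5 + dbl g) * ∑ (vecs n (κ g)) (λ v → 𝟙 (closed? A? v) * (4 * n ∸ degree-sum v))
      ≤⟨ *-monoʳ-≤ (κ g ^ κ g * 2 ^ (5 + dbl g)) (∑-mono (vecs n (κ g)) λ v → 𝟙*-mono (closed? A? v) (rotations-weight v)) ⟩
    κ g ^ κ g * 2 ^ (5 + dbl g) * ∑ (vecs n (κ g)) (λ v → 𝟙 (closed? A? v) * ∑ (downFrom (κ g)) (λ i → weight (2 * n) (rotⁿ i v)))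
      ≡⟨ cong (κ g ^ κ g * 2 ^ (5 + dbl g) *_) (trans (∑-cong (vecs n (κ g)) λ v → sym (∑-*ˡ (downFrom (κ g)) (𝟙 (closed? A? v)) _))
            (trans (∑-comm (vecs n (κ g)) (downFrom (κ g)) _) (trans (∑-cong (downFrom (κ g)) λ i → ∑-rotⁿ i (weight (2 * n)))
              (trans (∑-const (downFrom (κ g)) W) (cong (_* W) (length-downFrom (κ g))))))) ⟩
    κ g ^ κ g * 2 ^ (5 + dbl g) * (κ g * W)
      ≤⟨ *-monoʳ-≤ (κ g ^ κ g * 2 ^ (5 + dbl g)) (*-monoʳ-≤ (κ g) (∑-mono (vecs n (κ g)) λ v →
            ≤-trans (*-monoˡ-≤ (weight (2 * n) v) (𝟙≤1 (closed? A? v))) (≤-reflexive (*-identityˡ _)))) ⟩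
    κ g ^ κ g * 2 ^ (5 + dbl g) * (κ g * ∑ (vecs n (κ g)) (weight (2 * n)))
      ≡⟨ eq₂ (κ g ^ κ g) (2 ^ (5 + dbl g)) (κ g) _ ⟩
    κ g * (κ g ^ κ g * 2 ^ (5 + dbl g) * ∑ (vecs n (κ g)) (weight (2 * n)))
      ≤⟨ *-monoʳ-≤ (κ g) (weight-bound (2 * n)) ⟩
    κ g * (n * (2 * n) ^ κ g)
      ≡⟨ cong (λ z → κ g * (n * z)) (*-^ 2 n (κ g)) ⟩
    κ g * (n * (2 * (2 * 2 ^ (5 + dbl g)) * n ^ κ g))
      ≡⟨ eq₃ (κ g) n (2 ^ (5 + dbl g)) (n ^ κ g) ⟩
    4 * κ g * (n * n ^ κ g) * 2 ^ (5 + dbl g) ∎)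
    where
    open ≤-Reasoning
    W = ∑ (vecs n (κ g)) (λ v → 𝟙 (closed? A? v) * weight (2 * n) v)
    eq₁ : ∀ a b c → a * b * c ≡ a * c * b
    eq₁ = solve-∀
    eq₂ : ∀ a b c d → a * b * (c * d) ≡ c * (a * b * d)
    eq₂ = solve-∀
    eq₃ : ∀ k n t m → k * (n * (2 * (2 * t) * m)) ≡ 4 * k * (n * m) * t
    eq₃ = solve-∀

-- Closed walks in a cycle and in its blow-ups

module _ (k′ : ℕ) where
  private
    K : ℕ
    K = suc k′

  %-+ʳ : ∀ a b c → a % K ≡ b % K → (a + c) % K ≡ (b + c) % K
  %-+ʳ a b c e = trans (%-distribˡ-+ a c K) (trans (cong (λ z → (z + c % K) % K) e) (sym (%-distribˡ-+ b c K)))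

  %-cancel-suc : ∀ a b → suc a % K ≡ suc b % K → a % K ≡ b % K
  %-cancel-suc a b e = trans (sym ([m+n]%n≡m%n a K)) (trans (cong (_% K) (+-suc a k′))
    (trans (%-+ʳ (suc a) (suc b) k′ e) (trans (cong (_% K) (sym (+-suc b k′))) ([m+n]%n≡m%n b K))))

  %-cancelˡ : ∀ c a b → (c + a) % K ≡ (c + b) % K → a % K ≡ b % K
  %-cancelˡ zero    a b e = e
  %-cancelˡ (suc c) a b e = %-cancelˡ c a b (%-cancel-suc (c + a) (c + b) e)

  toℕ% : ∀ (i : Fin K) → toℕ i % K ≡ toℕ i
  toℕ% i = m<n⇒m%n≡m (toℕ<n i)

  toℕ-next% : ∀ (i : Fin K) → toℕ (next i) % K ≡ suc (toℕ i) % K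
  toℕ-next% i = trans (toℕ% (next i)) (toℕ-next i)

  locate : ∀ a (c : Fin K) → ∃[ d ] (d < K × c ≡ (a + d) mod K)
  -- Modulo `K` the factor `k′` is -1, so the offset is c - a.
  locate a c = (toℕ c + k′ * a) % K , m%n<n (toℕ c + k′ * a) K ,
    sym (trans (mod-cong {k′} {a + (toℕ c + k′ * a) % K} {toℕ c} (begin
      (a + (toℕ c + k′ * a) % K) % K  ≡⟨ %-distribˡ-+ a ((toℕ c + k′ * a) % K) K ⟩
      (a % K + (toℕ c + k′ * a) % K % K) % K     ≡⟨ cong (λ z → (a % K + z) % K) (m%n%n≡m%n (toℕ c + k′ * a) K) ⟩
      (a % K + (toℕ c + k′ * a) % K) % K  ≡⟨ sym (%-distribˡ-+ a (toℕ c + k′ * a) K) ⟩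
      (a + (toℕ c + k′ * a)) % K  ≡⟨ cong (_% K) (eq a (toℕ c) k′) ⟩
      (toℕ c + a * K) % K  ≡⟨ [m+kn]%n≡m%n (toℕ c) a K ⟩
      toℕ c % K                                  ∎)) (mod-toℕ c))
    where
    open ≡-Reasoning
    eq : ∀ a c k′ → a + (c + k′ * a) ≡ c + a * (1 + k′)
    eq = solve-∀

  -- U counts the forward and D the backward steps.
  winding : (c : ℕ → Fin K) → (∀ i → c (suc i) ≡ next (c i) ⊎ c i ≡ next (c (suc i))) → ∀ m →
    ∃[ U ] ∃[ D ] (U + D ≡ m × (toℕ (c m) + D) % K ≡ (toℕ (c 0) + U) % K ×
      (D ≡ 0 → ∀ i → i < m → c (suc i) ≡ next (c i)) × (U ≡ 0 → ∀ i → i < m → c i ≡ next (c (suc i))))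
  winding c st zero    = 0 , 0 , refl , refl , (λ _ _ ()) , (λ _ _ ())
  winding c st (suc m) = go (winding c st m) (st m)
    where
    go : _ → _ → _
    go (U , D , U+D , e , up , down) (inj₁ q) = suc U , D , cong suc U+D ,
      (begin
        (toℕ (c (suc m)) + D) % K    ≡⟨ cong (λ z → (toℕ z + D) % K) q ⟩
        (toℕ (next (c m)) + D) % K   ≡⟨ %-+ʳ (toℕ (next (c m))) (suc (toℕ (c m))) D (toℕ-next% (c m)) ⟩
        suc (toℕ (c m) + D) % K      ≡⟨ sym (%-suc (toℕ (c m) + D) k′) ⟩
        suc ((toℕ (c m) + D) % K) % K ≡⟨ cong (λ z → suc z % K) e ⟩
        suc ((toℕ (c 0) + U) % K) % K ≡⟨ %-suc (toℕ (c 0) + U) k′ ⟩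
        suc (toℕ (c 0) + U) % K      ≡⟨ cong (_% K) (sym (+-suc (toℕ (c 0)) U)) ⟩
        (toℕ (c 0) + suc U) % K      ∎) ,
      (λ D≡0 i l → case m≤n⇒m<n∨m≡n (≤-pred l) of λ { (inj₁ i<m) → up D≡0 i i<m ; (inj₂ refl) → q }) ,
      (λ ())
      where open ≡-Reasoning
    go (U , D , U+D , e , up , down) (inj₂ q) = U , suc D , trans (+-suc U D) (cong suc U+D) ,
      (begin
        (toℕ (c (suc m)) + suc D) % K   ≡⟨ cong (_% K) (+-suc (toℕ (c (suc m))) D) ⟩
        (suc (toℕ (c (suc m))) + D) % K ≡⟨ %-+ʳ (suc (toℕ (c (suc m)))) (toℕ (next (c (suc m)))) D (sym (toℕ-next% (c (suc m)))) ⟩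
        (toℕ (next (c (suc m))) + D) % K ≡⟨ cong (λ z → (toℕ z + D) % K) (sym q) ⟩
        (toℕ (c m) + D) % K  ≡⟨ e ⟩
        (toℕ (c 0) + U) % K             ∎) ,
      (λ ()) ,
      (λ U≡0 i l → case m≤n⇒m<n∨m≡n (≤-pred l) of λ { (inj₁ i<m) → down U≡0 i i<m ; (inj₂ refl) → q })
      where open ≡-Reasoning

module Winding (g : ℕ) (c : ℕ → Fin (κ g))
  (st : ∀ i → c (suc i) ≡ next (c i) ⊎ c i ≡ next (c (suc i))) where

  private
    k′ : ℕ
    k′ = 6 + dbl g

    balance : ∀ {m} → c m ≡ c 0 → ∀ U D → (toℕ (c m) + D) % κ g ≡ (toℕ (c 0) + U) % κ g → D % κ g ≡ U % κ g
    balance {m} e U D q = %-cancelˡ k′ (toℕ (c 0)) D U (trans (cong (λ z → (toℕ z + D) % κ g) (sym e)) q)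

    unequal : ∀ U D e → D ≡ U → U + D ≢ suc (dbl e)
    unequal U D e refl q = dbl≢suc-dbl U e (trans (dbl≡+ U) q)

  -- A closed walk has as many forward as backward steps modulo k. For length k - 2 both numbers are
  -- below k, hence equal, and their sum would be even.
  no-short : c (5 + dbl g) ≢ c 0
  no-short e = case winding k′ c st (5 + dbl g) of λ (U , D , U+D , q , _) →
    unequal U D (2 + g) (trans (sym (m<n⇒m%n≡m (small (m≤n+m D U) U+D)))
      (trans (balance e U D q) (m<n⇒m%n≡m (small (m≤m+n U D) U+D)))) U+D
    where
    small : ∀ {x s} → x ≤ s → s ≡ 5 + dbl g → x < κ g
    small l refl = ≤-trans (s≤s l) (n≤1+n _)

  -- With k steps the parity argument of `no-short` still works unless all steps go in one
  -- direction.
  monotone : c (κ g) ≡ c 0 → (∀ i → i < κ g → c (suc i) ≡ next (c i)) ⊎ (∀ i → i < κ g → c i ≡ next (c (suc i)))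
  monotone e = case winding k′ c st (κ g) of λ (U , D , U+D , q , up , down) →
    case (U <? (κ g)) of λ
      { (no ¬l) → inj₁ (up (+-cancelˡ-≡ U D 0 (trans U+D (trans (≤-antisym (≮⇒≥ ¬l) (≤-trans (m≤m+n U D) (≤-reflexive U+D))) (sym (+-identityʳ U))))))
      ; (yes l) → case (D <? (κ g)) of λ
          { (no ¬l′) → inj₂ (down (+-cancelʳ-≡ D U 0 (trans U+D (≤-antisym (≮⇒≥ ¬l′) (≤-trans (m≤n+m D U) (≤-reflexive U+D))))))
          ; (yes l′) → ⊥-elim (unequal U D (3 + g) (trans (sym (m<n⇒m%n≡m l′)) (trans (balance e U D q) (m<n⇒m%n≡m l))) U+D) } }

-- Runs through consecutive classes

module Runs {n : ℕ} {C : ℕ → Fin n → Set} (C? : ∀ i w → Dec (C i w)) where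

  Run : ∀ {m} → ℕ → Vec (Fin n) m → Set
  Run a []       = 0 ≡ 0
  Run a (x ∷ xs) = C a x × Run (suc a) xs

  run? : ∀ {m} a (v : Vec (Fin n) m) → Dec (Run a v)
  run? a []       = yes refl
  run? a (x ∷ xs) = C? a x ×-dec run? (suc a) xs

  run⇒lookup : ∀ {m} a (v : Vec (Fin n) m) → Run a v → ∀ i → C (a + toℕ i) (lookup v i)
  run⇒lookup a (x ∷ xs) (p , r) fzero    = subst (λ z → C z x) (sym (+-identityʳ a)) p
  run⇒lookup a (x ∷ xs) (p , r) (fsuc i) = subst (λ z → C z (lookup xs i)) (sym (+-suc a (toℕ i))) (run⇒lookup (suc a) xs r i)

  lookup⇒run : ∀ {m} a (v : Vec (Fin n) m) → (∀ i → C (a + toℕ i) (lookup v i)) → Run a v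
  lookup⇒run a []       h = refl
  lookup⇒run a (x ∷ xs) h = subst (λ z → C z x) (+-identityʳ a) (h fzero) ,
    lookup⇒run (suc a) xs λ i → subst (λ z → C z (lookup xs i)) (+-suc a (toℕ i)) (h (fsuc i))

  size : ℕ → ℕ
  size a = # (C? a)

  prod : ℕ → ℕ → ℕ
  prod zero    a = 1
  prod (suc m) a = size a * prod m (suc a)

  total : ℕ → ℕ → ℕ
  total zero    a = 0
  total (suc m) a = size a + total m (suc a)

  ∑-run : ∀ m a → ∑ (vecs n m) (λ v → 𝟙 (run? a v)) ≡ prod m a
  ∑-run zero    a = refl
  ∑-run (suc m) a = begin
    ∑ (vecs n (suc m)) (λ v → 𝟙 (run? a v))  ≡⟨ ∑-vecs-suc {n} {m} (λ v → 𝟙 (run? a v)) ⟩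
    ∑ (allFin n) (λ x → ∑ (vecs n m) (λ xs → 𝟙 (C? a x ×-dec run? (suc a) xs)))
      ≡⟨ ∑-cong (allFin n) (λ x → trans (∑-cong (vecs n m) λ xs → 𝟙-× (C? a x) (run? (suc a) xs))
                                    (trans (∑-*ˡ (vecs n m) (𝟙 (C? a x)) _) (cong (𝟙 (C? a x) *_) (∑-run m (suc a))))) ⟩
    ∑ (allFin n) (λ x → 𝟙 (C? a x) * prod m (suc a))  ≡⟨ ∑-*ʳ (allFin n) (prod m (suc a)) _ ⟩
    size a * prod m (suc a)                                              ∎
    where open ≡-Reasoning

  am-gm : ∀ m a → m ^ m * prod m a ≤ total m a ^ m
  am-gm zero    a = ≤-refl
  am-gm (suc m) a = *-cancelˡ-≤ (m ^ m) {{nz m}} (begin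
    m ^ m * (suc m ^ suc m * (size a * prod m (suc a)))    ≡⟨ eq (m ^ m) (suc m ^ suc m) (size a) (prod m (suc a)) ⟩
    suc m ^ suc m * (size a * (m ^ m * prod m (suc a)))    ≤⟨ *-monoʳ-≤ (suc m ^ suc m) (*-monoʳ-≤ (size a) (am-gm m (suc a))) ⟩
    suc m ^ suc m * (size a * total m (suc a) ^ m)  ≤⟨ am-gm-step m (size a) (total m (suc a)) ⟩
    m ^ m * total (suc m) a ^ suc m                        ∎)
    where
    open ≤-Reasoning
    nz : ∀ m → NonZero (m ^ m)
    nz zero    = _
    nz (suc m) = m^n≢0 (suc m) (suc m)
    eq : ∀ a b c d → a * (b * (c * d)) ≡ b * (c * (a * d))
    eq = solve-∀

  total-∑ : ∀ m a → total m a ≡ ∑ (downFrom m) (λ i → size (a + i))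
  total-∑ zero    a = refl
  total-∑ (suc m) a = trans (cong (size a +_) (total-∑ m (suc a)))
    (trans (cong₂ _+_ (cong size (sym (+-identityʳ a))) (∑-cong (downFrom m) λ i → cong size (sym (+-suc a i))))
           (∑-downFrom-shift m (λ i → size (a + i))))

  prod-lower : ∀ K {c} → (∀ a → c ≤ K * size a) → ∀ m a → c ^ m ≤ K ^ m * prod m a
  prod-lower K h zero    a = ≤-refl
  prod-lower K {c} h (suc m) a = ≤-trans (*-mono-≤ (h a) (prod-lower K h m (suc a)))
    (≤-reflexive (eq K (size a) (K ^ m) (prod m (suc a))))
    where
    eq : ∀ a b c d → a * b * (c * d) ≡ a * c * (b * d)
    eq = solve-∀

-- Three instances occur: `Cl` holds for all vertices in the blow-up, for the vertices sorted by a
-- long cycle in the stability part, and for the typical vertices.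
module Classes (g : ℕ) {n : ℕ} (ψ : Fin n → Fin (κ g)) {Cl : Fin n → Set} (Cl? : ∀ w → Dec (Cl w)) where

  private
    k′ : ℕ
    k′ = 6 + dbl g

  C : ℕ → Fin n → Set
  C i w = Cl w × ψ w ≡ i mod κ g

  C? : ∀ i w → Dec (C i w)
  C? i w = Cl? w ×-dec (ψ w ≟ᶠ i mod κ g)

  open Runs C? public

  C-per : ∀ i {w} → C (i + κ g) w → C i w
  C-per i (c , e) = c , trans e (mod-+ k′ i)
  C-per⁻ : ∀ i {w} → C i w → C (i + κ g) w
  C-per⁻ i (c , e) = c , trans e (sym (mod-+ k′ i))

  C-% : ∀ a m {w} → C (a + m % κ g) w → C (a + m) w
  C-% a m (c , e) = c , trans e (mod-cong {k′} {a + m % κ g} {a + m}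
    (trans (%-distribˡ-+ a (m % κ g) (κ g)) (trans (cong (λ z → (a % κ g + z) % κ g) (m%n%n≡m%n m (κ g))) (sym (%-distribˡ-+ a m (κ g))))))

  run⇒at : ∀ a (v : Vec (Fin n) (κ g)) → Run a v → ∀ m → C (a + m) (at v m)
  run⇒at a v r m = C-% a m (subst (λ z → C (a + z) (at v m)) (toℕ-mod m k′) (run⇒lookup a v r (m mod κ g)))

  at⇒run : ∀ a (v : Vec (Fin n) (κ g)) → (∀ m → C (a + m) (at v m)) → Run a v
  at⇒run a v h = lookup⇒run a v λ i → subst (C (a + toℕ i)) (at-toℕ v i) (h (toℕ i))

  run-rot : ∀ a (v : Vec (Fin n) (κ g)) → Run a v → Run (suc a) (rot v)
  run-rot a v r = at⇒run (suc a) (rot v) λ m →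
    subst₂ C (+-suc a m) (sym (at-rot v m)) (run⇒at a v r (suc m))

  run-unrot : ∀ a (v : Vec (Fin n) (κ g)) → Run (suc a) (rot v) → Run a v
  run-unrot a v r = at⇒run a v λ m → C-per (a + m)
    (subst₂ C (eq a m k′) (trans (at-rot v (m + k′)) (trans (cong (at v) (sym (+-suc m k′))) (at-+ v m))) (run⇒at (suc a) (rot v) r (m + k′)))
    where
    eq : ∀ a m k′ → 1 + a + (m + k′) ≡ a + m + (1 + k′)
    eq = solve-∀

  ∑-run-shift : {R : Fin n → Fin n → Set} (R? : ∀ u v → Dec (R u v)) → ∀ a →
    ∑ (vecs n (κ g)) (λ v → 𝟙 (closed? R? v) * 𝟙 (run? a v)) ≡ ∑ (vecs n (κ g)) (λ v → 𝟙 (closed? R? v) * 𝟙 (run? 0 v))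
  ∑-run-shift R? zero    = refl
  ∑-run-shift R? (suc a) = trans (sym (∑-closed-rot R? (λ v → 𝟙 (run? (suc a) v))))
    (trans (∑-cong (vecs n (κ g)) λ v → cong (𝟙 (closed? R? v) *_)
             (𝟙-cong (run? (suc a) (rot v)) (run? a v) (run-unrot a v) (run-rot a v)))
           (∑-run-shift R? a))

  prod-shift : ∀ a → prod (κ g) a ≡ prod (κ g) 0
  prod-shift zero    = refl
  prod-shift (suc a) = trans (sym (∑-run (κ g) (suc a))) (trans (sym (∑-rot k′ (λ v → 𝟙 (run? (suc a) v))))
    (trans (∑-cong (vecs n (κ g)) λ v → 𝟙-cong (run? (suc a) (rot v)) (run? a v) (run-unrot a v) (run-rot a v))
      (trans (∑-run (κ g) a) (prod-shift a))))

  total≤ : ∀ a → total (κ g) a ≤ n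
  total≤ a = begin
    total (κ g) a  ≡⟨ total-∑ (κ g) a ⟩
    ∑ (downFrom (κ g)) (λ i → size (a + i))  ≡⟨ ∑-periodic (κ g) size (λ i → #-cong (C? (i + κ g)) (C? i) (λ _ → C-per i) (λ _ → C-per⁻ i)) a ⟩
    ∑ (downFrom (κ g)) size  ≡⟨ ∑-comm (downFrom (κ g)) (allFin n) _ ⟩
    ∑ (allFin n) (λ w → ∑ (downFrom (κ g)) (λ i → 𝟙 (C? i w)))      ≤⟨ ∑-mono (allFin n) (λ w → count-covered (κ g) (λ i → C? i w) (toℕ (ψ w) ∷ [])
            λ i l (_ , e) → here (trans (sym (trans (toℕ-mod i k′) (m<n⇒m%n≡m l))) (cong toℕ (sym e)))) ⟩
    ∑ (allFin n) (λ _ → 1)  ≡⟨ trans (∑-allFin-const n 1) (*-identityʳ n) ⟩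
    n                                                           ∎
    where open ≤-Reasoning

  prod≤ : ∀ a → κ g ^ κ g * prod (κ g) a ≤ n ^ κ g
  prod≤ a = ≤-trans (am-gm (κ g) a) (^-monoˡ-≤ (κ g) (total≤ a))

  Up : Fin n → Fin n → Set
  Up u w = ψ w ≡ next (ψ u)

  up⇒ψ : (v : Vec (Fin n) (κ g)) → Closed Up v → ∀ m → ψ (at v m) ≡ (toℕ (ψ (at v 0)) + m) mod κ g
  up⇒ψ v cl zero    = sym (trans (cong (_mod κ g) (+-identityʳ (toℕ (ψ (at v 0))))) (mod-toℕ (ψ (at v 0))))
  up⇒ψ v cl (suc m) = trans (closed⇒at {R = Up} v cl m) (trans (cong next (up⇒ψ v cl m))
    (trans (next-mod k′ (toℕ (ψ (at v 0)) + m)) (cong (_mod κ g) (sym (+-suc (toℕ (ψ (at v 0))) m)))))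

  up⇒run : (v : Vec (Fin n) (κ g)) → (∀ m → Cl (at v m)) → Closed Up v → Run (toℕ (ψ (at v 0))) v
  up⇒run v all cl = at⇒run _ v λ m → all m , up⇒ψ v cl m

  run⇒up : ∀ a (v : Vec (Fin n) (κ g)) → Run a v → Closed Up v
  run⇒up a v r = at⇒closed {R = Up} v λ m → trans (proj₂ (run⇒at a v r (suc m)))
    (trans (cong (_mod κ g) (+-suc a m)) (trans (sym (next-mod k′ (a + m))) (cong next (sym (proj₂ (run⇒at a v r m))))))

  Down : Fin n → Fin n → Set
  Down u w = Up w u

  steps⇒up-or-down : (v : Vec (Fin n) (κ g)) → (∀ m → Up (at v m) (at v (suc m)) ⊎ Down (at v m) (at v (suc m))) →
    Closed Up v ⊎ Closed Up (reverse v)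
  steps⇒up-or-down v st = case Winding.monotone g (λ m → ψ (at v m)) st (cong ψ (at-+ v 0)) of λ
    { (inj₁ up)   → inj₁ λ i → convert Up i (up (toℕ i) (toℕ<n i))
    ; (inj₂ down) → inj₂ (closed-reverse {R = Down} v λ i → convert Down i (down (toℕ i) (toℕ<n i))) }
    where
    convert : ∀ (R : Fin n → Fin n → Set) i → R (at v (toℕ i)) (at v (suc (toℕ i))) → R (lookup v i) (lookup v (next i))
    convert R i = subst₂ R (at-toℕ v i) (cong (lookup v) (trans (sym (next-mod k′ (toℕ i))) (cong next (mod-toℕ i))))

  -- Orderings of a closed sequence by consecutive classes: k starting classes, two directions.
  turns : Vec (Fin n) (κ g) → ℕ
  turns v = ∑ (downFrom (κ g)) (λ a → 𝟙 (run? a v)) + ∑ (downFrom (κ g)) (λ a → 𝟙 (run? a (reverse v)))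

  ∑-turns : ∑ (vecs n (κ g)) turns ≡ 2 * κ g * prod (κ g) 0
  ∑-turns = begin
    ∑ (vecs n (κ g)) turns
      ≡⟨ ∑-+ (vecs n (κ g)) (λ v → S v) (λ v → S (reverse v)) ⟩
    ∑ (vecs n (κ g)) S + ∑ (vecs n (κ g)) (λ v → S (reverse v))
      ≡⟨ cong (∑ (vecs n (κ g)) S +_) (∑-reverse (κ g) S) ⟩
    ∑ (vecs n (κ g)) S + ∑ (vecs n (κ g)) S
      ≡⟨ cong (λ z → z + z) one ⟩
    κ g * prod (κ g) 0 + κ g * prod (κ g) 0
      ≡⟨ eq (κ g) (prod (κ g) 0) ⟩
    2 * κ g * prod (κ g) 0 ∎
    where
    open ≡-Reasoning
    S : Vec (Fin n) (κ g) → ℕ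
    S v = ∑ (downFrom (κ g)) (λ a → 𝟙 (run? a v))
    one : ∑ (vecs n (κ g)) S ≡ κ g * prod (κ g) 0
    one = trans (∑-comm (vecs n (κ g)) (downFrom (κ g)) _) (trans (∑-cong (downFrom (κ g)) λ a → trans (∑-run (κ g) a) (prod-shift a))
            (trans (∑-const (downFrom (κ g)) (prod (κ g) 0)) (cong (_* prod (κ g) 0) (length-downFrom (κ g)))))
    eq : ∀ k p → k * p + k * p ≡ 2 * k * p
    eq = solve-∀

  turns-pos : (v : Vec (Fin n) (κ g)) → (∀ m → Cl (at v m)) →
    (∀ m → Up (at v m) (at v (suc m)) ⊎ Down (at v m) (at v (suc m))) → 1 ≤ turns v
  turns-pos v all st = case steps⇒up-or-down v st of λ
    { (inj₁ up)   → ≤-trans (one v (up⇒run v all up)) (m≤m+n _ _)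
    ; (inj₂ down) → ≤-trans (one (reverse v) (up⇒run (reverse v) (λ m → subst Cl (sym (at-reverse v m)) (all (k′ * suc m))) down)) (m≤n+m _ (∑ (downFrom (κ g)) (λ a → 𝟙 (run? a v)))) }
    where
    one : ∀ u → Run (toℕ (ψ (at u 0))) u → 1 ≤ ∑ (downFrom (κ g)) (λ a → 𝟙 (run? a u))
    one u r = ≤-trans (≤-reflexive (sym (𝟙-yes (run? (toℕ (ψ (at u 0))) u) r)))
                (∑-term (downFrom-∈ (ψ (at u 0))) (λ a → 𝟙 (run? a u)))

  run≤turns : ∀ a (v : Vec (Fin n) (κ g)) → a < κ g → 𝟙 (run? a v) ≤ turns v
  run≤turns a v l = ≤-trans (∑-term (subst (_∈ downFrom (κ g)) (toℕ-fromℕ< l) (downFrom-∈ (fromℕ< l))) (λ a → 𝟙 (run? a v))) (m≤m+n _ _)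

  -- The class of the first entry determines where the run starts, so at most one summand is
  -- nonzero.
  ∑-run≤up : (v : Vec (Fin n) (κ g)) → ∑ (downFrom (κ g)) (λ a → 𝟙 (run? a v)) ≤ 𝟙 (closed? (λ u w → ψ w ≟ᶠ next (ψ u)) v)
  ∑-run≤up v = case closed? (λ u w → ψ w ≟ᶠ next (ψ u)) v of λ
    { (yes up) → ≤-trans (count-covered (κ g) (λ a → run? a v) (toℕ (ψ (at v 0)) ∷ []) (λ a l r →
                    here (trans (sym (trans (toℕ-mod a k′) (m<n⇒m%n≡m l)))
                                (cong toℕ (sym (trans (proj₂ (run⇒at a v r 0)) (cong (_mod κ g) (+-identityʳ a))))))))
                    (≤-reflexive (sym (𝟙-yes (closed? (λ u w → ψ w ≟ᶠ next (ψ u)) v) up)))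
    ; (no ¬up) → ≤-trans (count-covered (κ g) (λ a → run? a v) [] (λ a _ r → ⊥-elim (¬up (run⇒up a v r)))) z≤n }

-- Blow-ups

module BlowUp (g : ℕ) {n : ℕ} (ψ : Fin n → Fin (κ g)) where

  private
    k′ : ℕ
    k′ = 6 + dbl g

  Linked : Fin n → Fin n → Set
  Linked u v = ψ v ≡ next (ψ u) ⊎ ψ u ≡ next (ψ v)

  linked? : ∀ u v → Dec (Linked u v)
  linked? u v = (ψ v ≟ᶠ next (ψ u)) ⊎-dec (ψ u ≟ᶠ next (ψ v))

  Linked-sym : ∀ {u v} → Linked u v → Linked v u
  Linked-sym (inj₁ e) = inj₂ e
  Linked-sym (inj₂ e) = inj₁ e

  next≢ : ∀ (i : Fin (κ g)) → i ≢ next i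
  next≢ i e = case %-cancelˡ k′ (toℕ i) 1 0 (trans (cong (_% κ g) (+-comm (toℕ i) 1))
      (trans (sym (toℕ-next i)) (trans (cong toℕ (sym e)) (trans (sym (toℕ% k′ i)) (cong (_% κ g) (sym (+-identityʳ (toℕ i)))))))) of λ ()

  next²≢ : ∀ (i : Fin (κ g)) → i ≢ next (next i)
  next²≢ i e = case %-cancelˡ k′ (toℕ i) 2 0 (trans (cong (_% κ g) (+-comm (toℕ i) 2))
      (trans (sym (%-suc (suc (toℕ i)) k′)) (trans (cong (λ z → suc z % κ g) (sym (toℕ-next i)))
        (trans (sym (toℕ-next (next i))) (trans (cong toℕ (sym e)) (trans (sym (toℕ% k′ i)) (cong (_% κ g) (sym (+-identityʳ (toℕ i)))))))))) of λ ()

  Linked-irrefl : ∀ {u} → ¬ Linked u u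
  Linked-irrefl {u} (inj₁ e) = next≢ (ψ u) e
  Linked-irrefl {u} (inj₂ e) = next≢ (ψ u) e

  ⌊⌋⇒ : {P : Set} (d : Dec P) → ⌊ d ⌋ ≡ true → P
  ⌊⌋⇒ (yes p) _ = p

  ⇒⌊⌋ : {P : Set} (d : Dec P) → P → ⌊ d ⌋ ≡ true
  ⇒⌊⌋ (yes _) _ = refl
  ⇒⌊⌋ (no ¬p) p = ⊥-elim (¬p p)

  ⌊⌋-cong : {P Q : Set} (d : Dec P) (e : Dec Q) → (P → Q) → (Q → P) → ⌊ d ⌋ ≡ ⌊ e ⌋
  ⌊⌋-cong (yes p) e f h = sym (⇒⌊⌋ e (f p))
  ⌊⌋-cong (no ¬p) (yes q) f h = ⊥-elim (¬p (h q))
  ⌊⌋-cong (no ¬p) (no _)  f h = refl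

  ⌊⌋-no : {P : Set} (d : Dec P) → ¬ P → ⌊ d ⌋ ≡ false
  ⌊⌋-no (yes p) ¬p = ⊥-elim (¬p p)
  ⌊⌋-no (no _)  ¬p = refl

  blowUp : Graph n
  blowUp = record
    { adj    = λ u v → ⌊ linked? u v ⌋
    ; sym    = λ u v → ⌊⌋-cong (linked? u v) (linked? v u) Linked-sym Linked-sym
    ; irrefl = λ u → ⌊⌋-no (linked? u u) Linked-irrefl
    }

  blowUp-free : CycleFree (5 + dbl g) blowUp
  blowUp-free (f , _ , st) = Winding.no-short g (λ m → ψ (f (m mod (5 + dbl g))))
    (λ m → subst (λ z → Linked (f (m mod (5 + dbl g))) (f z)) (next-mod (4 + dbl g) m)
             (⌊⌋⇒ (linked? _ _) (st (m mod (5 + dbl g)))))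
    (cong (ψ ∘ f) (mod-+ (4 + dbl g) 0))

  open Classes g ψ {λ _ → 0 ≡ 0} (λ _ → yes refl) public

  private
    up? : (v : Vec (Fin n) (κ g)) → Dec (Closed Up v)
    up? = closed? (λ u w → ψ w ≟ᶠ next (ψ u))

    up-inj : (v : Vec (Fin n) (κ g)) → Closed Up v → Inj (lookup v)
    up-inj v cl i j e = toℕ-injective (trans (sym (toℕ% k′ i)) (trans (%-cancelˡ k′ (toℕ (ψ (at v 0))) (toℕ i) (toℕ j)
      (trans (sym (value i)) (trans (cong (toℕ ∘ ψ) e) (value j)))) (toℕ% k′ j)))
      where
      value : ∀ i → toℕ (ψ (lookup v i)) ≡ (toℕ (ψ (at v 0)) + toℕ i) % κ g
      value i = trans (cong (toℕ ∘ ψ) (sym (at-toℕ v i))) (trans (cong toℕ (up⇒ψ v cl (toℕ i))) (toℕ-mod (toℕ (ψ (at v 0)) + toℕ i) k′))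

    opp : Fin (κ g) → Fin (κ g)
    opp i = fromℕ< {m = k′ ∸ toℕ i} (s≤s (m∸n≤m k′ (toℕ i)))

    toℕ-opp : ∀ i → toℕ (opp i) + toℕ i ≡ k′
    toℕ-opp i = trans (cong (_+ toℕ i) (toℕ-fromℕ< (s≤s (m∸n≤m k′ (toℕ i))))) (m∸n+n≡m (≤-pred (toℕ<n i)))

    reverse-inj : (v : Vec (Fin n) (κ g)) → Inj (lookup (reverse v)) → Inj (lookup v)
    reverse-inj v inj i j e = toℕ-injective (+-cancelˡ-≡ (toℕ (opp i)) _ _
      (trans (toℕ-opp i) (trans (sym (toℕ-opp j)) (cong (λ z → toℕ z + toℕ j) (sym
        (inj (opp i) (opp j) (trans (lookup-reverse v (opp i) i (toℕ-opp i)) (trans e (sym (lookup-reverse v (opp j) j (toℕ-opp j)))))))))))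

    down : (v : Vec (Fin n) (κ g)) → Closed Up (reverse v) → Closed Down v
    down v cl = subst (Closed Down) (reverse-involutive v) (closed-reverse {R = Up} (reverse v) cl)

    emb-up : (v : Vec (Fin n) (κ g)) → Closed Up v → Emb blowUp (lookup v)
    emb-up v cl = (λ i → ⇒⌊⌋ (linked? _ _) (inj₁ (cl i))) , up-inj v cl

    emb-down : (v : Vec (Fin n) (κ g)) → Closed Up (reverse v) → Emb blowUp (lookup v)
    emb-down v cl = (λ i → ⇒⌊⌋ (linked? _ _) (inj₂ (down v cl i))) , reverse-inj v (up-inj (reverse v) cl)

    exclusive : (v : Vec (Fin n) (κ g)) → Closed Up v → ¬ Closed Up (reverse v)
    exclusive v up dn = next²≢ (ψ (lookup v fzero)) (trans (down v dn fzero) (cong next (up fzero)))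

  -- A monotone sequence meets every class once and is therefore injective. It cannot be monotone in
  -- both directions, as no class is its own second successor.
  turns≤emb : (v : Vec (Fin n) (κ g)) → turns v ≤ 𝟙 (emb? blowUp (lookup v))
  turns≤emb v = ≤-trans (+-mono-≤ (∑-run≤up v) (∑-run≤up (reverse v))) (go (up? v) (up? (reverse v)))
    where
    go : (d : Dec (Closed Up v)) (e : Dec (Closed Up (reverse v))) → 𝟙 d + 𝟙 e ≤ 𝟙 (emb? blowUp (lookup v))
    go (yes up) (yes dn) = ⊥-elim (exclusive v up dn)
    go (yes up) (no _)   = ≤-reflexive (sym (𝟙-yes (emb? blowUp (lookup v)) (emb-up v up)))
    go (no _)   (yes dn) = ≤-reflexive (sym (𝟙-yes (emb? blowUp (lookup v)) (emb-down v dn)))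
    go (no _)   (no _)   = z≤n

  embeddings-≥ : 2 * κ g * prod (κ g) 0 ≤ embeddings (κ g) blowUp
  embeddings-≥ = begin
    2 * κ g * prod (κ g) 0  ≡⟨ sym ∑-turns ⟩
    ∑ (vecs n (κ g)) turns  ≤⟨ ∑-mono (vecs n (κ g)) turns≤emb ⟩
    ∑ (vecs n (κ g)) (λ v → 𝟙 (emb? blowUp (lookup v)))      ≡⟨ sym (embeddings-∑ (κ g) blowUp) ⟩
    embeddings (κ g) blowUp                                  ∎
    where open ≤-Reasoning

  cycles-≥ : prod (κ g) 0 ≤ cycles (κ g) blowUp
  cycles-≥ = ≤-trans (≤-reflexive (sym (trans (cong (_/ (2 * κ g)) (*-comm (2 * κ g) (prod (κ g) 0))) (m*n/n≡m (prod (κ g) 0) (2 * κ g)))))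
    (/-monoˡ-≤ (2 * κ g) embeddings-≥)

-- Graphs that are close to a blow-up

-- `ψ₀` is total, but only its values on `U` carry information; the other vertices receive a class
-- in `class-of`. The bound `M-large` is the one that `defect-arithmetic` asks for.
record Typical (g : ℕ) {n : ℕ} (G : Graph n) : Set₁ where
  field
    ψ₀ : Fin n → Fin (κ g)
    U  : Fin n → Set
    U? : ∀ w → Dec (U w)
    K M : ℕ

  open Classes g ψ₀ U? public

  Sees : ℕ → Fin n → Set
  Sees b x = M * # (λ y → C? b y ×-dec ¬? (adj? G x y)) ≤ n

  field
    few-exceptions : M * # (λ w → ¬? (U? w)) ≤ n
    large-classes  : ∀ a → n ≤ K * size a
    sees-up        : ∀ a {w} → C a w → Sees (suc a) w
    sees-down      : ∀ a {w} → C (suc a) w → Sees a w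
    4K≤M           : 4 * K ≤ M
    0<M            : 0 < M
    M-large        : 8 * κ g * κ g * K * K ^ (5 + dbl g) < M
    large          : 2 * K * κ g < n

module Structure (g : ℕ) {n : ℕ} (G : Graph n) (free : CycleFree (5 + dbl g) G) (T : Typical g G) where
  open Typical T public
  open Walks (Adj G)

  private
    k′ : ℕ
    k′ = 6 + dbl g

  -- A class has at least n/K typical vertices, and `x` and `w` miss at most n/M ≤ n/(4K) each. At
  -- least n/(2K) > k common neighbours remain, enough to avoid any list used below.
  common : ∀ b x w → Sees b x → Sees b w → κ g < # (λ y → C? b y ×-dec (adj? G x y ×-dec adj? G w y))
  common b x w sx sw = *-cancelˡ-< (2 * K) (κ g) c (<-≤-trans large (halve c n≤))
    where
    open ≤-Reasoning
    V = allFin n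
    cx = # (λ y → C? b y ×-dec ¬? (adj? G x y))
    cw = # (λ y → C? b y ×-dec ¬? (adj? G w y))
    c  = # (λ y → C? b y ×-dec (adj? G x y ×-dec adj? G w y))
    pt : {P Q R : Set} (p : Dec P) (q : Dec Q) (r : Dec R) →
         𝟙 p ≤ 𝟙 (p ×-dec (q ×-dec r)) + (𝟙 (p ×-dec ¬? q) + 𝟙 (p ×-dec ¬? r))
    pt (no _)  q       r       = z≤n
    pt (yes _) (yes _) (yes _) = s≤s z≤n
    pt (yes _) (yes _) (no _)  = s≤s z≤n
    pt (yes _) (no _)  r       = s≤s z≤n
    size≤ : size b ≤ c + (cx + cw)
    size≤ = ≤-trans (∑-mono V λ y → pt (C? b y) (adj? G x y) (adj? G w y))
      (≤-reflexive (trans (∑-+ V _ _) (cong (c +_) (∑-+ V _ _))))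
    eq₁ : ∀ M K c s t → M * (K * (c + (s + t))) ≡ M * (K * c) + (K * (M * s) + K * (M * t))
    eq₁ = solve-∀
    n≤ : M * n ≤ M * (K * c) + (K * n + K * n)
    n≤ = begin
      M * n  ≤⟨ *-monoʳ-≤ M (≤-trans (large-classes b) (*-monoʳ-≤ K size≤)) ⟩
      M * (K * (c + (cx + cw)))  ≡⟨ eq₁ M K c cx cw ⟩
      M * (K * c) + (K * (M * cx) + K * (M * cw))  ≤⟨ +-monoʳ-≤ (M * (K * c)) (+-mono-≤ (*-monoʳ-≤ K sx) (*-monoʳ-≤ K sw)) ⟩
      M * (K * c) + (K * n + K * n)                ∎
    halve : ∀ c → M * n ≤ M * (K * c) + (K * n + K * n) → n ≤ 2 * K * c
    halve c le = *-cancelˡ-≤ M {{>-nonZero 0<M}} (+-cancelʳ-≤ (M * n) _ _ (begin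
      M * n + M * n  ≤⟨ +-mono-≤ le le ⟩
      M * (K * c) + (K * n + K * n) + (M * (K * c) + (K * n + K * n))  ≡⟨ eq₂ M K c n ⟩
      M * (2 * K * c) + 4 * K * n  ≤⟨ +-monoʳ-≤ (M * (2 * K * c)) (*-monoˡ-≤ n 4K≤M) ⟩
      M * (2 * K * c) + M * n                                                  ∎))
      where
      eq₂ : ∀ M K c n → M * (K * c) + (K * n + K * n) + (M * (K * c) + (K * n + K * n)) ≡ M * (2 * K * c) + 4 * K * n
      eq₂ = solve-∀

  pick-common : ∀ b x w L → Sees b x → Sees b w → length L ≤ κ g → ∃[ y ] (C b y × Adj G x y × Adj G w y × y ∉ L)
  pick-common b x w L sx sw l =
    case pick (λ y → C? b y ×-dec (adj? G x y ×-dec adj? G w y)) L (≤-<-trans l (common b x w sx sw)) of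
      λ (y , (c , a , a′) , y∉) → y , c , a , a′ , y∉

  -- The bound on `length L + ℓ` is an invariant of greedy construction: each step puts one vertex
  -- on the list and shortens the path by one edge. The last two edges are found together, through a
  -- common neighbour of their ends.
  Conn : ℕ → ℕ → ℕ → Set
  Conn ℓ a b = ∀ L u w → C a u → C b w → u ∉ L → w ∉ L → u ≢ w → length L + ℓ ≤ κ g → Path ℓ L u w

  conn₂ : ∀ a b c → (∀ {u} → C a u → Sees c u) → (∀ {w} → C b w → Sees c w) → Conn 2 a b
  conn₂ a b c sa sb L u w Cu Cw u∉ w∉ u≢w l =
    case pick-common c u w (w ∷ u ∷ L) (sa Cu) (sb Cw) (≤-trans (≤-reflexive (+-comm 2 (length L))) l) of
      λ (y , _ , auy , awy , y∉) → u∉ , y , auy , (λ z → y∉ (there z)) , w , Adj-sym G awy ,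
        (λ { (here e) → y∉ (here (sym e)) ; (there (here e)) → u≢w (sym e) ; (there (there z)) → w∉ z }) , refl

  extend : ∀ ℓ a c b → (∀ {u} → C a u → Sees c u) → 1 ≤ ℓ → Conn ℓ c b → Conn (suc ℓ) a b
  extend ℓ a c b sa 1≤ℓ conn L u w Cu Cw u∉ w∉ u≢w l =
    case pick-common c u u (w ∷ u ∷ L) (sa Cu) (sa Cu) (≤-trans (≤-trans (≤-reflexive (+-comm 2 (length L))) (+-monoʳ-≤ (length L) (s≤s 1≤ℓ))) l) of
      λ (y , Cy , auy , _ , y∉) → u∉ , y , auy ,
        conn (u ∷ L) y w Cy Cw (λ z → y∉ (there z)) (λ { (here e) → u≢w (sym e) ; (there z) → w∉ z })
          (λ e → y∉ (here e)) (≤-trans (≤-reflexive (sym (+-suc (length L) ℓ))) l)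

  conn-loop : ∀ f a → Conn (dbl (suc f)) a a
  conn-loop zero    a = conn₂ a a (suc a) (sees-up a) (sees-up a)
  conn-loop (suc f) a = extend (suc (dbl (suc f))) a (suc a) a (sees-up a) (s≤s z≤n)
                          (extend (dbl (suc f)) (suc a) a a (sees-down a) (s≤s z≤n) (conn-loop f a))

  -- The path climbs `e` classes and spends the other `dbl f` edges going back and forth between two
  -- consecutive classes.
  conn-up : ∀ f e a b → b ≡ a + e → 2 ≤ e + dbl f → Conn (e + dbl f) a b
  conn-up (suc f) zero    a b eq _ = subst (Conn (dbl (suc f)) a) (sym (trans eq (+-identityʳ a))) (conn-loop f a)
  conn-up (suc f) (suc e) a b eq l = extend (e + dbl (suc f)) a (suc a) b (sees-up a) (≤-trans (s≤s z≤n) (m≤n+m (dbl (suc f)) e))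
            (conn-up (suc f) e (suc a) b (trans eq (+-suc a e)) (≤-trans (s≤s (s≤s z≤n)) (m≤n+m (dbl (suc f)) e)))
  conn-up zero (suc (suc zero)) a b eq _ = subst (Conn 2 a) (trans (+-comm 2 a) (sym eq)) (conn₂ a (2 + a) (suc a) (sees-up a) (sees-down (suc a)))
  conn-up zero (suc (suc (suc e))) a b eq l = extend (2 + e + 0) a (suc a) b (sees-up a) (s≤s z≤n)
            (conn-up zero (suc (suc e)) (suc a) b (trans eq (+-suc a (2 + e))) (s≤s (s≤s z≤n)))
  conn-up zero (suc zero) a b eq (s≤s ())
  conn-up zero zero       a b eq ()

  -- Otherwise a path of length k - 4 between the two neighbours, avoiding `x`, would close through
  -- `x` to a cycle of length k - 2.
  no-link : ∀ {x u w} a e f → e + dbl f ≡ 3 + dbl g → C a u → C (a + e) w → u ≢ w → Adj G x u → ¬ Adj G x w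
  no-link {x} {u} {w} a e f len Cu Cw u≢w axu axw = free (close-path G (suc (3 + dbl g))
    ((λ ()) , u , axu , subst (λ l → Path l (x ∷ []) u w) len
      (conn-up f e a (a + e) refl (≤-trans (s≤s (s≤s z≤n)) (≤-reflexive (sym len))) (x ∷ []) u w Cu Cw (apart axu) (apart axw) u≢w
        (≤-trans (s≤s (≤-reflexive len)) (m≤n+m (4 + dbl g) 3))))
    (Adj-sym G axw))
    where
    apart : ∀ {y} → Adj G x y → y ∉ x ∷ []
    apart a (here refl) = Adj-irrefl G a

  -- For 0 < d < k exactly one of d and k - d is odd, and `no-link`, used in that direction,
  -- excludes all odd values up to k - 4. This leaves k - 2 for the odd one, that is, offset two in
  -- one of the directions.
  neighbour-classes : ∀ {x u w} a d → d < κ g → C a u → C (a + d) w → Adj G x u → Adj G x w → d ∈ 0 ∷ 2 ∷ 5 + dbl g ∷ []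
  neighbour-classes {x} {u} {w} a d d<k Cu Cw axu axw = case u ≟ᶠ w of λ
    { (yes refl) → here (trans (sym (m<n⇒m%n≡m d<k)) (trans (%-cancelˡ k′ a d 0
        (trans (sym (toℕ-mod (a + d) k′)) (trans (cong toℕ (trans (sym (proj₂ Cw)) (proj₂ Cu))) (trans (toℕ-mod a k′) (cong (_% κ g) (sym (+-identityʳ a))))))) refl))
    ; (no u≢w) → case parity d of λ
        { (inj₂ (e , refl)) → odd e u≢w d<k Cw
        ; (inj₁ (e , refl)) → even e u≢w d<k Cw } }
    where
    odd : ∀ e → u ≢ w → suc (dbl e) < κ g → C (a + suc (dbl e)) w → suc (dbl e) ∈ 0 ∷ 2 ∷ 5 + dbl g ∷ []
    odd e u≢w l Cw = case e ≤? 1 + g of λ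
      { (yes e≤) → case m≤n⇒∃[o]m+o≡n e≤ of λ (f , e+f) →
          ⊥-elim (no-link a (suc (dbl e)) f (cong suc (trans (sym (dbl-+ e f)) (cong dbl e+f))) Cu Cw u≢w axu axw)
      ; (no ¬e≤) → there (there (here (cong (suc ∘ dbl) (≤-antisym (≤-pred (dbl-cancel-≤ˢ (suc e) (3 + g) l)) (≰⇒> ¬e≤))))) }
    even : ∀ e → u ≢ w → dbl e < κ g → C (a + dbl e) w → dbl e ∈ 0 ∷ 2 ∷ 5 + dbl g ∷ []
    even zero          u≢w l Cw = here refl
    even (suc zero)    u≢w l Cw = there (here refl)
    even (suc (suc e)) u≢w l Cw = case m≤n⇒∃[o]m+o≡n (≤-pred (≤-pred (dbl-cancel-≤ (2 + e) (3 + g) (≤-pred l)))) of λ (r , e+r) →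
      ⊥-elim (no-link (a + dbl (2 + e)) (suc (dbl r)) e (cong suc (trans (trans (+-comm (dbl r) (dbl e)) (sym (dbl-+ e r))) (cong dbl e+r)))
        Cw (subst (λ z → C z u) (sym (eq r e+r)) (C-per⁻ a Cu)) (λ e → u≢w (sym e)) axw axu)
      where
      eq′ : ∀ a x y → a + (4 + x) + (1 + y) ≡ a + (5 + (x + y))
      eq′ = solve-∀
      eq : ∀ r → e + r ≡ 1 + g → a + dbl (2 + e) + suc (dbl r) ≡ a + κ g
      eq r e+r = trans (eq′ a (dbl e) (dbl r)) (cong (λ z → a + (5 + z)) (trans (sym (dbl-+ e r)) (cong dbl e+r)))

  Fits : Fin n → Fin (κ g) → Set
  Fits x c = ∀ u → U u → Adj G x u → ψ₀ u ≡ next c ⊎ c ≡ next (ψ₀ u)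

  -- Relative to class `a` a third neighbour has offset 0, 2 or -2; the last would put it at offset
  -- 4 from `u₂`.
  sandwich : ∀ {x u₁ u₂} a → C a u₁ → C (a + 2) u₂ → Adj G x u₁ → Adj G x u₂ → Fits x (suc a mod κ g)
  sandwich {x} {u₁} {u₂} a C₁ C₂ a₁ a₂ u Uu au = case locate k′ a (ψ₀ u) of λ (d , d<k , e) → go d d<k e
    where
    eq : ∀ a e → a + 2 + (7 + e) ≡ a + (5 + e) + 4
    eq = solve-∀
    go : ∀ d → d < κ g → ψ₀ u ≡ (a + d) mod κ g → ψ₀ u ≡ next (suc a mod κ g) ⊎ suc a mod κ g ≡ next (ψ₀ u)
    go d d<k e = case neighbour-classes a d d<k C₁ (Uu , e) a₁ au of λ
      { (here refl) → inj₂ (sym (trans (cong next (trans e (cong (_mod κ g) (+-identityʳ a)))) (next-mod k′ a)))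
      ; (there (here refl)) → inj₁ (trans e (trans (cong (_mod κ g) (+-comm a 2)) (sym (next-mod k′ (suc a)))))
      ; (there (there (here refl))) → ⊥-elim (case neighbour-classes (a + (5 + dbl g)) 4 (s≤s (s≤s (s≤s (s≤s (s≤s z≤n))))) (Uu , e)
            (subst (λ z → C z u₂) (eq a (dbl g)) (C-per⁻ (a + 2) C₂)) au a₂ of λ
              { (here ()) ; (there (here ())) ; (there (there (here ()))) }) }

  own-class : ∀ {w} → U w → C (toℕ (ψ₀ w)) w
  own-class {w} Uw = Uw , sym (mod-toℕ (ψ₀ w))

  class-of : ∀ x → ∃[ c ] (Fits x c × (U x → c ≡ ψ₀ x))
  class-of x = case U? x of λ { (yes Ux) → inside Ux ; (no ¬Ux) → outside ¬Ux }
    where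
    inside : U x → ∃[ c ] (Fits x c × (U x → c ≡ ψ₀ x))
    inside Ux =
      case pick-common b x x [] sees-b sees-b z≤n of λ (u₁ , C₁ , a₁ , _) →
      case pick-common (suc (suc b)) x x [] sees-b2 sees-b2 z≤n of λ (u₂ , C₂ , a₂ , _) →
      suc b mod κ g , sandwich b C₁ (subst (λ z → C z u₂) (+-comm 2 b) C₂) a₁ a₂ , λ _ → sym (proj₂ Cx)
      where
      b = toℕ (ψ₀ x) + k′
      Cx : C (suc b) x
      Cx = subst (λ z → C z x) (+-suc (toℕ (ψ₀ x)) k′) (C-per⁻ (toℕ (ψ₀ x)) (own-class Ux))
      sees-b = sees-down b Cx
      sees-b2 = sees-up (suc b) Cx
    outside : ¬ U x → ∃[ c ] (Fits x c × (U x → c ≡ ψ₀ x))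
    outside ¬Ux = case any? (λ u → U? u ×-dec adj? G x u) of λ
      -- Without typical neighbours every class fits.
      { (no none) → fzero , (λ u Uu a → ⊥-elim (none (u , Uu , a))) , λ Ux → ⊥-elim (¬Ux Ux)
      ; (yes (u₀ , Uu₀ , a₀)) → around u₀ (toℕ (ψ₀ u₀)) (own-class Uu₀) a₀ }
      where
      eq : ∀ b e → b + (7 + e) ≡ b + (5 + e) + 2
      eq = solve-∀
      around : ∀ u₀ b → C b u₀ → Adj G x u₀ → ∃[ c ] (Fits x c × (U x → c ≡ ψ₀ x))
      around u₀ b C₀ a₀ = case any? (λ u → C? (b + 2) u ×-dec adj? G x u) of λ
        { (yes (u₂ , C₂ , a₂)) → suc b mod κ g , sandwich b C₀ C₂ a₀ a₂ , λ Ux → ⊥-elim (¬Ux Ux)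
        ; (no none₂) → case any? (λ u → C? (b + (5 + dbl g)) u ×-dec adj? G x u) of λ
            { (yes (u₁ , C₁ , a₁)) → suc (b + (5 + dbl g)) mod κ g ,
                sandwich (b + (5 + dbl g)) C₁ (subst (λ z → C z u₀) (eq b (dbl g)) (C-per⁻ b C₀)) a₁ a₀ , λ Ux → ⊥-elim (¬Ux Ux)
            -- All typical neighbours lie in class `b`; both `b + 1` and `b − 1` fit, and the former
            -- is taken.
            ; (no none₁) → suc b mod κ g , (λ u Uu a → case locate k′ b (ψ₀ u) of λ (d , d<k , e) → only none₂ none₁ u Uu a d d<k e) , λ Ux → ⊥-elim (¬Ux Ux) } }
        where
        only : ¬ (∃[ u ] (C (b + 2) u × Adj G x u)) → ¬ (∃[ u ] (C (b + (5 + dbl g)) u × Adj G x u)) →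
               ∀ u → U u → Adj G x u → ∀ d → d < κ g → ψ₀ u ≡ (b + d) mod κ g → ψ₀ u ≡ next (suc b mod κ g) ⊎ suc b mod κ g ≡ next (ψ₀ u)
        only none₂ none₁ u Uu a d d<k e = case neighbour-classes b d d<k C₀ (Uu , e) a₀ a of λ
          { (here refl) → inj₂ (sym (trans (cong next (trans e (cong (_mod κ g) (+-identityʳ b)))) (next-mod k′ b)))
          ; (there (here refl)) → ⊥-elim (none₂ (u , (Uu , e) , a))
          ; (there (there (here refl))) → ⊥-elim (none₁ (u , (Uu , e) , a)) }

  ψ : Fin n → Fin (κ g)
  ψ x = proj₁ (class-of x)

  ψ-U : ∀ {u} → U u → ψ u ≡ ψ₀ u
  ψ-U {u} Uu = proj₂ (proj₂ (class-of u)) Uu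

  open BlowUp g ψ public using (Linked; linked?; Linked-sym)

  U-linked : ∀ {x u} → U u → Adj G x u → Linked x u
  U-linked {x} {u} Uu a = case proj₁ (proj₂ (class-of x)) u Uu a of λ
    { (inj₁ e) → inj₁ (trans (ψ-U Uu) e) ; (inj₂ e) → inj₂ (trans e (cong next (sym (ψ-U Uu)))) }

  nbrs? : ∀ b x u → Dec (C b u × Adj G x u)
  nbrs? b x u = C? b u ×-dec adj? G x u

  -- Typical neighbours `u` of `x` and `w` of `y` are joined by a path of length k - 5; with the
  -- edges `u x`, `x y`, `y w` it forms a cycle of length k - 2. A second neighbour of `y` is at
  -- hand in case the first one is `u`.
  no-cross : ∀ {x y} i e f → e + f ≡ 1 + g → ¬ U x → ¬ U y → Adj G x y →
             1 < # (nbrs? i x) → 1 < # (nbrs? (i + dbl e) y) → ⊥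
  no-cross {x} {y} i e f e+f ¬Ux ¬Uy axy lx ly =
    case pick (nbrs? i x) [] (<⇒≤ lx) of λ (u , (Cu , axu) , _) →
    case pick (nbrs? (i + dbl e) y) (u ∷ []) ly of λ (w , (Cw , ayw) , w∉) →
    free (close-path G (suc (suc (2 + dbl g)))
      ((λ ()) , x , Adj-sym G axy , (λ { (here refl) → Adj-irrefl G axy }) , u , axu ,
        subst (λ l → Path l (x ∷ y ∷ []) u w) len
          (conn-up f (dbl e) i (i + dbl e) refl (≤-trans (s≤s (s≤s z≤n)) (≤-reflexive (sym len))) (x ∷ y ∷ []) u w Cu Cw
            (apart (proj₁ Cu)) (apart (proj₁ Cw)) (λ e → w∉ (here (sym e))) (≤-trans (s≤s (s≤s (≤-reflexive len))) (m≤n+m (4 + dbl g) 3))))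
      (Adj-sym G ayw))
    where
    len : dbl e + dbl f ≡ 2 + dbl g
    len = trans (sym (dbl-+ e f)) (cong dbl e+f)
    apart : ∀ {z} → U z → z ∉ x ∷ y ∷ []
    apart Uz (here refl)         = ¬Ux Uz
    apart Uz (there (here refl)) = ¬Uy Uz

  -- The cut-off 1 matches `no-cross`, which needs two neighbours in a class to choose distinct
  -- ends.
  LowUp : ℕ → Fin n → Set
  LowUp a x = ψ x ≡ a mod κ g × # (nbrs? (suc a) x) ≤ 1
  LowDown : ℕ → Fin n → Set
  LowDown a x = ψ x ≡ suc a mod κ g × # (nbrs? a x) ≤ 1

  lowUp? : ∀ a x → Dec (LowUp a x)
  lowUp? a x = (ψ x ≟ᶠ a mod κ g) ×-dec (# (nbrs? (suc a) x) ≤? 1)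
  lowDown? : ∀ a x → Dec (LowDown a x)
  lowDown? a x = (ψ x ≟ᶠ suc a mod κ g) ×-dec (# (nbrs? a x) ≤? 1)

  Defective : Fin n → Set
  Defective x = ∃[ i ] (LowUp (toℕ {(κ g)} i) x ⊎ LowDown (toℕ {(κ g)} i) x)
  defective? : ∀ x → Dec (Defective x)
  defective? x = any? λ i → lowUp? (toℕ i) x ⊎-dec lowDown? (toℕ i) x

  sound-up : ∀ {x} → ¬ Defective x → 1 < # (nbrs? (suc (toℕ (ψ x))) x)
  sound-up {x} ¬d = ≰⇒> λ l → ¬d (ψ x , inj₁ (sym (mod-toℕ (ψ x)) , l))

  sound-down : ∀ {x} → ¬ Defective x → 1 < # (nbrs? (toℕ (ψ x) + k′) x)
  sound-down {x} ¬d = ≰⇒> λ l → ¬d (b mod κ g , inj₂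
    (trans (sym (mod-toℕ (ψ x))) (trans (sym (mod-+ k′ (toℕ (ψ x)))) (trans (cong (_mod κ g) (+-suc (toℕ (ψ x)) k′))
       (trans (sym (next-mod k′ b)) (trans (cong next (sym (mod-toℕ (b mod κ g)))) (next-mod k′ (toℕ (b mod κ g))))))) ,
     ≤-trans (#-mono (nbrs? (toℕ (b mod κ g)) x) (nbrs? b x) (λ u ((Uu , e) , a) → (Uu , trans e (mod-toℕ (b mod κ g))) , a)) l))
    where
    b = toℕ (ψ x) + k′

  -- Two sound vertices have enough neighbours in both adjacent classes, so the sides can be chosen
  -- to make the offset even and at most k - 5: the same side for equal classes, the facing sides
  -- for even d > 0, the outer sides for odd d. The exceptions d = 1 and d = k - 1 are linked pairs.
  bad-edge-ordered : ∀ {x y} → toℕ (ψ x) ≤ toℕ (ψ y) → Adj G x y → ¬ Linked x y → ¬ Defective x → ¬ Defective y → ⊥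
  bad-edge-ordered {x} {y} x≤y axy ¬link ¬dx ¬dy = case m≤n⇒∃[o]m+o≡n x≤y of λ (d , a+d) →
    case parity d of λ { (inj₁ (e , refl)) → even e a+d ; (inj₂ (e , refl)) → odd e a+d }
    where
    a = toℕ (ψ x)
    b = toℕ (ψ y)
    ¬Ux : ¬ U x
    ¬Ux Ux = ¬link (Linked-sym (U-linked Ux (Adj-sym G axy)))
    ¬Uy : ¬ U y
    ¬Uy Uy = ¬link (U-linked Uy axy)
    at-class : ∀ {z} i j → i % κ g ≡ j % κ g → 1 < # (nbrs? i z) → 1 < # (nbrs? j z)
    at-class {z} i j e l = ≤-trans l (#-mono (nbrs? i z) (nbrs? j z) λ u ((Uu , q) , a) → (Uu , trans q (mod-cong {k′} {i} {j} e)) , a)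
    even : ∀ e → a + dbl e ≡ b → ⊥
    even zero a+d = no-cross (suc a) 0 (1 + g) refl ¬Ux ¬Uy axy (sound-up ¬dx)
      (at-class (suc b) (suc a + 0) (cong (_% κ g) (cong suc (sym a+d))) (sound-up ¬dy))
    even (suc e) a+d = case e ≤? 1 + g of λ
      { (yes l) → case m≤n⇒∃[o]m+o≡n l of λ (f , e+f) → no-cross (suc a) e f e+f ¬Ux ¬Uy axy (sound-up ¬dx)
          (at-class (b + k′) (suc a + dbl e) (trans (cong (_% κ g) (trans (cong (_+ k′) (sym a+d)) (eq a (dbl e) k′))) ([m+n]%n≡m%n (suc a + dbl e) (κ g))) (sound-down ¬dy))
      ; (no ¬l) → ¬link (inj₂ (wrap (≤-antisym (dbl-cancel-≤ (suc e) (3 + g) (≤-trans (m≤n+m (dbl (suc e)) a) (≤-trans (≤-reflexive a+d) (≤-pred (toℕ<n (ψ y)))))) (s≤s (≰⇒> ¬l))))) }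
      where
      eq : ∀ a e k′ → a + (2 + e) + k′ ≡ 1 + a + e + (1 + k′)
      eq = solve-∀
      wrap : suc e ≡ 3 + g → ψ x ≡ next (ψ y)
      wrap q = sym (trans (cong next (sym (mod-toℕ (ψ y)))) (trans (next-mod k′ b)
        (trans (cong (λ z → suc z mod κ g) (sym (trans (cong (λ z → a + dbl z) (sym q)) a+d))) (trans (cong (_mod κ g) (sym (+-suc a k′)))
          (trans (mod-+ k′ a) (mod-toℕ (ψ x)))))))
    odd : ∀ e → a + suc (dbl e) ≡ b → ⊥
    odd zero a+d = ¬link (inj₁ (trans (sym (mod-toℕ (ψ y))) (trans (cong (_mod κ g) (trans (sym a+d) (+-comm a 1)))
                     (trans (sym (next-mod k′ a)) (cong next (mod-toℕ (ψ x)))))))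
    odd (suc e) a+d = case m≤n⇒∃[o]m+o≡n (dbl-cancel-≤ˢ e (1 + g) (+-cancelˡ-≤ 3 _ _
                        (≤-trans (m≤n+m (3 + dbl e) a) (≤-trans (≤-reflexive a+d) (≤-pred (toℕ<n (ψ y))))))) of λ (f , e+f) →
      no-cross (suc b) f e (trans (+-comm f e) e+f) ¬Uy ¬Ux (Adj-sym G axy) (sound-up ¬dy)
        (at-class (a + k′) (suc b + dbl f) (cong (_% κ g) (trans (cong (a +_) (cong (λ z → 4 + dbl z) (sym e+f))) (trans (cong (λ z → a + (4 + z)) (dbl-+ e f)) (trans (eq a (dbl e) (dbl f)) (cong (λ z → suc z + dbl f) a+d))))) (sound-down ¬dx))
      where
      eq : ∀ a e f → a + (4 + (e + f)) ≡ 1 + (a + (3 + e)) + f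
      eq = solve-∀

  bad-edge : ∀ {x y} → Adj G x y → ¬ Linked x y → Defective x ⊎ Defective y
  bad-edge {x} {y} a ¬link = case defective? x of λ
    { (yes d) → inj₁ d
    ; (no ¬d) → case defective? y of λ
        { (yes d′) → inj₂ d′
        ; (no ¬d′) → ⊥-elim (case ≤-total (toℕ (ψ x)) (toℕ (ψ y)) of λ
            { (inj₁ l) → bad-edge-ordered l a ¬link ¬d ¬d′
            ; (inj₂ l) → bad-edge-ordered l (Adj-sym G a) (λ q → ¬link (Linked-sym q)) ¬d′ ¬d }) } }

-- Comparison with the blow-up

-- A union bound over the place of the pair; rotation moves that place to the front, where the other
-- `m` entries are free.
edge-union : ∀ {n} m {B : Fin n → Fin n → Set} (B? : ∀ u v → Dec (B u v)) →
  ∑ (vecs n (2 + m)) (λ v → 𝟙 (any? λ i → B? (lookup v i) (lookup v (next i)))) ≤ (2 + m) * (∑∑ B? * n ^ m)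
edge-union {n} m {B} B? = begin
  ∑ (vecs n k) (λ v → 𝟙 (any? λ i → B? (lookup v i) (lookup v (next i))))
    ≤⟨ ∑-mono (vecs n k) (λ v → 𝟙-≤ (any? λ i → B? (lookup v i) (lookup v (next i))) λ (i , b) →
         ≤-trans (≤-reflexive (sym (𝟙-yes (B? (at v (toℕ i)) (at v (suc (toℕ i))))
                   (subst₂ B (sym (at-toℕ v i)) (cong (lookup v) (sym (trans (sym (next-mod (suc m) (toℕ i))) (cong next (mod-toℕ i))))) b))))
                 (∑-term (downFrom-∈ i) (λ i → F i v))) ⟩
  ∑ (vecs n k) (λ v → ∑ (downFrom k) (λ i → F i v))
    ≡⟨ ∑-comm (vecs n k) (downFrom k) (λ v i → F i v) ⟩
  ∑ (downFrom k) (λ i → ∑ (vecs n k) (F i))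
    ≡⟨ ∑-cong (downFrom k) shift ⟩
  ∑ (downFrom k) (λ _ → ∑∑ B? * n ^ m)
    ≡⟨ trans (∑-const (downFrom k) (∑∑ B? * n ^ m)) (cong (_* (∑∑ B? * n ^ m)) (length-downFrom k)) ⟩
  k * (∑∑ B? * n ^ m) ∎
  where
  open ≤-Reasoning
  k = 2 + m
  F : ℕ → Vec (Fin n) k → ℕ
  F i v = 𝟙 (B? (at v i) (at v (suc i)))
  shift : ∀ i → ∑ (vecs n k) (F i) ≡ ∑∑ B? * n ^ m
  shift zero = trans (∑-vecs-suc {n} {suc m} (F 0)) (trans (∑-cong (allFin n) λ x → trans (∑-vecs-suc {n} {m} (λ v → F 0 (x ∷ v)))
    (trans (∑-cong (allFin n) λ y → trans (∑-vecs-const n m (𝟙 (B? x y))) (*-comm (n ^ m) _)) (∑-*ʳ (allFin n) (n ^ m) _)))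
    (∑-*ʳ (allFin n) (n ^ m) _))
  shift (suc i) = trans (∑-cong (vecs n k) λ v → sym (cong₂ (λ x y → 𝟙 (B? x y)) (at-rot v i) (at-rot v (suc i))))
    (trans (∑-rot (suc m) (F i)) (shift i))

module _ {n : ℕ} {C : ℕ → Fin n → Set} (C? : ∀ i w → Dec (C i w)) where
  open Runs C?

  pair-extend : ∀ m a {E : Fin n → Fin n → Set} (E? : ∀ u v → Dec (E u v))
    {P : Vec (Fin n) (2 + m) → Set} (P? : ∀ v → Dec (P v)) →
    (∀ u v xs → E u v → Run a xs → P (u ∷ v ∷ xs)) → ∑∑ E? * prod m a ≤ ∑ (vecs n (2 + m)) (λ v → 𝟙 (P? v))
  pair-extend m a E? P? h = begin
    ∑∑ E? * prod m a
      ≡⟨ sym (trans (∑-cong (allFin n) λ u → trans (∑-cong (allFin n) λ v →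
           trans (∑-*ˡ (vecs n m) (𝟙 (E? u v)) (λ xs → 𝟙 (run? a xs))) (cong (𝟙 (E? u v) *_) (∑-run m a))) (∑-*ʳ (allFin n) (prod m a) _))
           (∑-*ʳ (allFin n) (prod m a) _)) ⟩
    ∑ (allFin n) (λ u → ∑ (allFin n) (λ v → ∑ (vecs n m) (λ xs → 𝟙 (E? u v) * 𝟙 (run? a xs))))
      ≤⟨ ∑-mono (allFin n) (λ u → ∑-mono (allFin n) λ v → ∑-mono (vecs n m) λ xs →
           ≤-trans (≤-reflexive (sym (𝟙-× (E? u v) (run? a xs)))) (𝟙-mono (E? u v ×-dec run? a xs) (P? (u ∷ v ∷ xs)) λ (e , r) → h u v xs e r)) ⟩
    ∑ (allFin n) (λ u → ∑ (allFin n) (λ v → ∑ (vecs n m) (λ xs → 𝟙 (P? (u ∷ v ∷ xs)))))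
      ≡⟨ sym (trans (∑-vecs-suc {n} {suc m} (λ v → 𝟙 (P? v))) (∑-cong (allFin n) λ u → ∑-vecs-suc {n} {m} (λ v → 𝟙 (P? (u ∷ v))))) ⟩
    ∑ (vecs n (2 + m)) (λ v → 𝟙 (P? v)) ∎
    where open ≤-Reasoning

exchange-< : ∀ {e s t b} → e + s ≤ t + b → b < s → e < t
exchange-< {e} {s} {t} le l = +-cancelʳ-< s e t (≤-<-trans le (+-monoʳ-< t l))

drop-zero : ∀ {e s t b} → e + s ≤ t + b → b ≡ 0 → e ≤ t
drop-zero {e} {s} {t} le refl = ≤-trans (m≤m+n e s) (≤-trans le (≤-reflexive (+-identityʳ t)))

zero-product : ∀ k {b} N → b ≡ 0 → k * (b * N) ≡ 0
zero-product k N refl = *-zeroʳ k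

-- `D` counts defective and `X` atypical vertices, `B` pairs against the classes, `d` the vertices
-- with the most frequent defect, `E` their missing pairs and `s` the missing runs. The gain is at
-- most 4k²·d·n·N/M and the loss at least d·n·N/(2KL), so M > 8k²KL decides.
defect-arithmetic : ∀ M k n D X B E N K L d s → B ≤ 2 * (D * X) → M * X ≤ n → D ≤ 2 * k * d → d * n ≤ 2 * K * E →
  E * N ≤ L * s → 0 < d → 0 < n → 0 < N → 8 * k * k * K * L < M → k * (B * N) < s
defect-arithmetic M k n D X B E N K L d s B≤ MX D≤ dn EN 0<d 0<n 0<N big = *-cancelˡ-< M _ _ (begin-strict
  M * (k * (B * N))  ≤⟨ *-monoʳ-≤ M (*-monoʳ-≤ k (*-monoˡ-≤ N B≤)) ⟩
  M * (k * (2 * (D * X) * N))      ≡⟨ eq₁ M k D X N ⟩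
  2 * k * (D * (M * X)) * N        ≤⟨ *-monoˡ-≤ N (*-monoʳ-≤ (2 * k) (*-mono-≤ D≤ MX)) ⟩
  2 * k * (2 * k * d * n) * N      ≡⟨ eq₂ k d n N ⟩
  4 * k * k * (d * n * N)  ≤⟨ *-monoʳ-≤ (4 * k * k) dnm ⟩
  4 * k * k * (2 * K * (L * s))    ≡⟨ eq₃ k K L s ⟩
  8 * k * k * K * L * s  <⟨ *-monoˡ-< s {{>-nonZero 0<s}} big ⟩
  M * s                            ∎)
  where
  open ≤-Reasoning
  eq₁ : ∀ M k d x p → M * (k * (2 * (d * x) * p)) ≡ 2 * k * (d * (M * x)) * p
  eq₁ = solve-∀
  eq₂ : ∀ k d n p → 2 * k * (2 * k * d * n) * p ≡ 4 * k * k * (d * n * p)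
  eq₂ = solve-∀
  eq₃ : ∀ k K p s → 4 * k * k * (2 * K * (p * s)) ≡ 8 * k * k * K * p * s
  eq₃ = solve-∀
  dnm : d * n * N ≤ 2 * K * (L * s)
  dnm = ≤-trans (*-monoˡ-≤ N dn) (≤-trans (≤-reflexive (*-assoc (2 * K) E N)) (*-monoʳ-≤ (2 * K) EN))
  0<s : 0 < s
  0<s = pos-right L s (pos-right (2 * K) (L * s) (≤-trans (*-mono-≤ (*-mono-≤ 0<d 0<n) 0<N) dnm))

low-degree-arithmetic : ∀ n K k c s → n ≤ K * s → s ≤ 1 + c → 2 * K * suc k < n → n ≤ 2 * K * c
low-degree-arithmetic n K k c s n≤ s≤ large = +-cancelʳ-≤ n _ _ (begin
  n + n  ≤⟨ +-mono-≤ one one ⟩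
  K * (1 + c) + K * (1 + c)    ≡⟨ eq K c ⟩
  2 * K * c + 2 * K  ≤⟨ +-monoʳ-≤ (2 * K * c) (≤-trans (m≤m*n (2 * K) (suc k)) (<⇒≤ large)) ⟩
  2 * K * c + n                ∎)
  where
  open ≤-Reasoning
  eq : ∀ K c → K * (1 + c) + K * (1 + c) ≡ 2 * K * c + 2 * K
  eq = solve-∀
  one : n ≤ K * (1 + c)
  one = ≤-trans n≤ (*-monoʳ-≤ K s≤)

weighted-count : ∀ {n} {P : Fin n → Set} (P? : ∀ x → Dec (P x)) b c (f : Fin n → ℕ) → (∀ x → P x → b ≤ c * f x) →
  # P? * b ≤ c * ∑ (allFin n) (λ x → 𝟙 (P? x) * f x)
weighted-count {n} P? b c f h = begin
  # P? * b  ≡⟨ sym (∑-*ʳ (allFin n) b (λ x → 𝟙 (P? x))) ⟩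
  ∑ (allFin n) (λ x → 𝟙 (P? x) * b)  ≤⟨ ∑-mono (allFin n) (λ x → 𝟙*-mono (P? x) (h x)) ⟩
  ∑ (allFin n) (λ x → 𝟙 (P? x) * (c * f x))      ≡⟨ trans (∑-cong (allFin n) λ x → eq (𝟙 (P? x)) c (f x)) (∑-*ˡ (allFin n) c (λ x → 𝟙 (P? x) * f x)) ⟩
  c * ∑ (allFin n) (λ x → 𝟙 (P? x) * f x)        ∎
  where
  open ≤-Reasoning
  eq : ∀ a b c → a * (b * c) ≡ b * (a * c)
  eq = solve-∀

heavy-index : ∀ k D (f h : Fin k → ℕ) → 0 < D → D ≤ ∑ (allFin k) (λ i → f i + h i) →
  ∃[ i ] ((0 < f i × D ≤ 2 * k * f i) ⊎ (0 < h i × D ≤ 2 * k * h i))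
heavy-index zero    D f h 0<D le = ⊥-elim (<⇒≱ 0<D le)
heavy-index k@(suc _) D f h 0<D le = case ∑-pigeonhole (allFin k) (λ _ → D) (λ i → 1 + k * (f i + h i)) many of λ (i , l) → i , choose i (≤-pred l)
  where
  many : ∑ (allFin k) (λ _ → D) < ∑ (allFin k) (λ i → 1 + k * (f i + h i))
  many = begin-strict
    ∑ (allFin k) (λ _ → D)  ≡⟨ ∑-allFin-const k D ⟩
    k * D  ≤⟨ *-monoʳ-≤ k le ⟩
    k * ∑ (allFin k) (λ i → f i + h i)  ≡⟨ sym (∑-*ˡ (allFin k) k (λ i → f i + h i)) ⟩
    ∑ (allFin k) (λ i → k * (f i + h i))  <⟨ m<n+m _ {k} (s≤s z≤n) ⟩
    k + ∑ (allFin k) (λ i → k * (f i + h i))  ≡⟨ cong (_+ ∑ (allFin k) (λ i → k * (f i + h i))) (sym (trans (∑-allFin-const k 1) (*-identityʳ k))) ⟩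
    ∑ (allFin k) (λ _ → 1) + ∑ (allFin k) (λ i → k * (f i + h i))  ≡⟨ sym (∑-+ (allFin k) (λ _ → 1) (λ i → k * (f i + h i))) ⟩
    ∑ (allFin k) (λ i → 1 + k * (f i + h i))                       ∎
    where open ≤-Reasoning
  twice : ∀ p q → q ≤ p → D ≤ k * (p + q) → D ≤ 2 * k * p
  twice p q q≤p l = ≤-trans l (≤-trans (*-monoʳ-≤ k (+-monoʳ-≤ p q≤p)) (≤-reflexive (eq k p)))
    where
    eq : ∀ k p → k * (p + p) ≡ 2 * k * p
    eq = solve-∀
  positive : ∀ p → D ≤ 2 * k * p → 0 < p
  positive p l = pos-right (2 * k) p (≤-trans 0<D l)
  choose : ∀ i → D ≤ k * (f i + h i) → (0 < f i × D ≤ 2 * k * f i) ⊎ (0 < h i × D ≤ 2 * k * h i)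
  choose i l = case ≤-total (h i) (f i) of λ
    { (inj₁ q) → inj₁ (positive (f i) (twice (f i) (h i) q l) , twice (f i) (h i) q l)
    ; (inj₂ q) → let l′ = twice (h i) (f i) q (subst (λ z → D ≤ k * z) (+-comm (f i) (h i)) l) in inj₂ (positive (h i) l′ , l′) }

module Comparison (g : ℕ) {n : ℕ} (G : Graph n) (free : CycleFree (5 + dbl g) G) (T : Typical g G) where
  open Structure g G free T
  module H = BlowUp g ψ

  private
    m : ℕ
    m = 5 + dbl g
    V = allFin n

  bad? : ∀ u v → Dec (Adj G u v × ¬ Linked u v)
  bad? u v = adj? G u v ×-dec ¬? (linked? u v)

  miss? : ∀ a (v : Vec (Fin n) (κ g)) → Dec (H.Run a v × ¬ Closed (Adj G) v)
  miss? a v = H.run? a v ×-dec ¬? (closed? (adj? G) v)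

  missing : ℕ → ℕ
  missing a = ∑ (vecs n (κ g)) (λ v → 𝟙 (miss? a v))

  -- A closed sequence of `G` without bad pairs is a turn of the blow-up, and a missing run is a
  -- turn that is no embedding in `G`. So the missing runs are paid for by the sequences that
  -- contain a bad pair.
  exchange : ∀ a → a < κ g → embeddings (κ g) G + missing a ≤ 2 * κ g * H.prod (κ g) 0 + κ g * (∑∑ bad? * n ^ m)
  exchange a a<k = begin
    embeddings (κ g) G + missing a
      ≡⟨ trans (cong (_+ missing a) (embeddings-∑ (κ g) G)) (sym (∑-+ (vecs n (κ g)) (λ v → 𝟙 (emb? G (lookup v))) (λ v → 𝟙 (miss? a v)))) ⟩
    ∑ (vecs n (κ g)) (λ v → 𝟙 (emb? G (lookup v)) + 𝟙 (miss? a v))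
      ≤⟨ ∑-mono (vecs n (κ g)) pt ⟩
    ∑ (vecs n (κ g)) (λ v → H.turns v + 𝟙 (anyBad? v))
      ≡⟨ ∑-+ (vecs n (κ g)) H.turns (λ v → 𝟙 (anyBad? v)) ⟩
    ∑ (vecs n (κ g)) H.turns + ∑ (vecs n (κ g)) (λ v → 𝟙 (anyBad? v))
      ≤⟨ +-mono-≤ (≤-reflexive H.∑-turns) (edge-union m bad?) ⟩
    2 * κ g * H.prod (κ g) 0 + κ g * (∑∑ bad? * n ^ m) ∎
    where
    open ≤-Reasoning
    anyBad? : ∀ (v : Vec (Fin n) (κ g)) → Dec (∃[ i ] (Adj G (lookup v i) (lookup v (next i)) × ¬ Linked (lookup v i) (lookup v (next i))))
    anyBad? v = any? λ i → bad? (lookup v i) (lookup v (next i))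
    pt : ∀ v → 𝟙 (emb? G (lookup v)) + 𝟙 (miss? a v) ≤ H.turns v + 𝟙 (anyBad? v)
    pt v = case closed? (adj? G) v of λ
      { (no ¬cl) → +-mono-≤ {x = 𝟙 (emb? G (lookup v))} {y = 0} {u = 𝟙 (miss? a v)} {v = H.turns v + 𝟙 (anyBad? v)}
          (≤-reflexive (𝟙-no (emb? G (lookup v)) λ (cl , _) → ¬cl cl))
          (≤-trans (≤-trans (𝟙-mono (miss? a v) (H.run? a v) proj₁) (H.run≤turns a v a<k)) (m≤m+n (H.turns v) (𝟙 (anyBad? v))))
      ; (yes cl) → ≤-trans (+-mono-≤ (𝟙≤1 (emb? G (lookup v))) (≤-reflexive (𝟙-no (miss? a v) λ (_ , ¬cl) → ¬cl cl)))
          (case anyBad? v of λ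
            { (yes b) → ≤-trans (≤-reflexive (sym (𝟙-yes (anyBad? v) b))) (m≤n+m (𝟙 (anyBad? v)) (H.turns v))
            ; (no ¬b) → ≤-trans (H.turns-pos v (λ _ → refl) (closed⇒at {R = Linked} v (linked v cl ¬b))) (m≤m+n (H.turns v) (𝟙 (anyBad? v))) }) }
      where
      linked : ∀ v → Closed (Adj G) v → ¬ (∃[ i ] (Adj G (lookup v i) (lookup v (next i)) × ¬ Linked (lookup v i) (lookup v (next i)))) → Closed Linked v
      linked v cl ¬b i = case linked? (lookup v i) (lookup v (next i)) of λ { (yes l) → l ; (no ¬l) → ⊥-elim (¬b (i , cl i , ¬l)) }

  U⇒H : ∀ i {w} → C i w → H.C i w
  U⇒H i (Uw , e) = refl , trans (ψ-U Uw) e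

  run⇒H : ∀ {l} a (v : Vec (Fin n) l) → Run a v → H.Run a v
  run⇒H a []       r       = refl
  run⇒H a (x ∷ xs) (c , r) = U⇒H a c , run⇒H (suc a) xs r

  -- Any runs through the k - 2 other classes complete a non-adjacent pair to a missing run; typical
  -- vertices alone give at least (n/K)^(k-2) of them.
  missing-≥ : ∀ a {E : Fin n → Fin n → Set} (E? : ∀ u v → Dec (E u v)) →
    (∀ {u v} → E u v → H.C a u × H.C (suc a) v × ¬ Adj G u v) → ∑∑ E? * n ^ m ≤ K ^ m * missing a
  missing-≥ a E? h = begin
    ∑∑ E? * n ^ m  ≤⟨ *-monoʳ-≤ (∑∑ E?) (prod-lower K large-classes m (2 + a)) ⟩
    ∑∑ E? * (K ^ m * prod m (2 + a)) ≡⟨ eq (∑∑ E?) (K ^ m) (prod m (2 + a)) ⟩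
    K ^ m * (∑∑ E? * prod m (2 + a)) ≤⟨ *-monoʳ-≤ (K ^ m) (pair-extend C? m (2 + a) E? (miss? a)
            λ u v xs e r → case h e of λ (cu , cv , ¬a) → (cu , cv , run⇒H (2 + a) xs r) , λ cl → ¬a (cl fzero)) ⟩
    K ^ m * missing a                ∎
    where
    open ≤-Reasoning
    eq : ∀ a b c → a * (b * c) ≡ b * (a * c)
    eq = solve-∀

  #D #X : ℕ
  #D = # defective?
  #X = # (λ w → ¬? (U? w))

  -- By `U-linked` both ends of a bad pair are atypical, and by `bad-edge` one of them is defective.
  bad-count : ∑∑ bad? ≤ 2 * (#D * #X)
  bad-count = begin
    ∑∑ bad?
      ≤⟨ ∑-mono V (λ u → ∑-mono V λ v → 𝟙-≤ (bad? u v) (pt u v)) ⟩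
    ∑ V (λ u → ∑ V (λ v → 𝟙 (defective? u) * 𝟙 (¬? (U? v)) + 𝟙 (¬? (U? u)) * 𝟙 (defective? v)))
      ≡⟨ trans (∑-cong V λ u → trans (∑-+ V _ _) (cong₂ _+_ (∑-*ˡ V (𝟙 (defective? u)) _) (∑-*ˡ V (𝟙 (¬? (U? u))) _))) (∑-+ V _ _) ⟩
    ∑ V (λ u → 𝟙 (defective? u) * #X) + ∑ V (λ u → 𝟙 (¬? (U? u)) * #D)
      ≡⟨ cong₂ _+_ (∑-*ʳ V #X _) (∑-*ʳ V #D _) ⟩
    #D * #X + #X * #D
      ≡⟨ eq #D #X ⟩
    2 * (#D * #X) ∎
    where
    open ≤-Reasoning
    eq : ∀ d x → d * x + x * d ≡ 2 * (d * x)
    eq = solve-∀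
    prod1 : {P Q : Set} (p : Dec P) (q : Dec Q) → P → Q → 1 ≤ 𝟙 p * 𝟙 q
    prod1 p q a b = ≤-reflexive (sym (cong₂ _*_ (𝟙-yes p a) (𝟙-yes q b)))
    pt : ∀ u v → Adj G u v × ¬ Linked u v → 1 ≤ 𝟙 (defective? u) * 𝟙 (¬? (U? v)) + 𝟙 (¬? (U? u)) * 𝟙 (defective? v)
    pt u v (a , ¬l) = case bad-edge a ¬l of λ
      { (inj₁ d) → ≤-trans (prod1 (defective? u) (¬? (U? v)) d λ Uv → ¬l (U-linked Uv a)) (m≤m+n _ (𝟙 (¬? (U? u)) * 𝟙 (defective? v)))
      ; (inj₂ d) → ≤-trans (prod1 (¬? (U? u)) (defective? v) (λ Uu → ¬l (Linked-sym (U-linked Uu (Adj-sym G a)))) d)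
                     (m≤n+m _ (𝟙 (defective? u) * 𝟙 (¬? (U? v)))) }

  0<n : 0 < n
  0<n = ≤-<-trans z≤n large

  missing⇒fewer : ∀ a → a < κ g → κ g * (∑∑ bad? * n ^ m) < missing a → embeddings (κ g) G < 2 * κ g * H.prod (κ g) 0
  missing⇒fewer a a<k l = exchange-< (exchange a a<k) l

  defect-strict : ∀ a → a < κ g → ∀ d {E : Fin n → Fin n → Set} (E? : ∀ u v → Dec (E u v)) →
    (∀ {u v} → E u v → H.C a u × H.C (suc a) v × ¬ Adj G u v) → d * n ≤ 2 * K * ∑∑ E? → 0 < d → #D ≤ 2 * κ g * d →
    embeddings (κ g) G < 2 * κ g * H.prod (κ g) 0
  defect-strict a a<k d E? h dn 0<d D≤ = missing⇒fewer a a<k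
    (defect-arithmetic M (κ g) n #D #X (∑∑ bad?) (∑∑ E?) (n ^ m) K (K ^ m) d (missing a)
      bad-count few-exceptions D≤ dn (missing-≥ a E? h) 0<d 0<n (m^n>0 n {{>-nonZero 0<n}} m) M-large)

  nonNbrs? : ∀ b x u → Dec (C b u × ¬ Adj G x u)
  nonNbrs? b x u = C? b u ×-dec ¬? (adj? G x u)

  many-nonNbrs : ∀ b x → # (nbrs? b x) ≤ 1 → n ≤ 2 * K * # (nonNbrs? b x)
  many-nonNbrs b x l = low-degree-arithmetic n K (6 + dbl g) (# (nonNbrs? b x)) (size b) (large-classes b)
    (≤-trans (#-split (C? b) (adj? G x)) (+-monoˡ-≤ (# (nonNbrs? b x)) l)) large

  up-strict : ∀ a → a < κ g → 0 < # (lowUp? a) → #D ≤ 2 * κ g * # (lowUp? a) → embeddings (κ g) G < 2 * κ g * H.prod (κ g) 0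
  up-strict a a<k 0<d D≤ = defect-strict a a<k (# (lowUp? a)) (λ u v → lowUp? a u ×-dec nonNbrs? (suc a) u v)
    (λ ((e , _) , c , ¬a) → (refl , e) , U⇒H (suc a) c , ¬a)
    (≤-trans (weighted-count (lowUp? a) n (2 * K) (λ u → # (nonNbrs? (suc a) u)) λ u (_ , l) → many-nonNbrs (suc a) u l)
      (≤-reflexive (cong (2 * K *_) (∑-cong V λ u → sym (trans (∑-cong V λ v → 𝟙-× (lowUp? a u) (nonNbrs? (suc a) u v)) (∑-*ˡ V (𝟙 (lowUp? a u)) _))))))
    0<d D≤

  down-strict : ∀ a → a < κ g → 0 < # (lowDown? a) → #D ≤ 2 * κ g * # (lowDown? a) → embeddings (κ g) G < 2 * κ g * H.prod (κ g) 0
  down-strict a a<k 0<d D≤ = defect-strict a a<k (# (lowDown? a)) (λ u v → lowDown? a v ×-dec nonNbrs? a v u)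
    (λ ((e , _) , c , ¬a) → U⇒H a c , (refl , e) , λ q → ¬a (Adj-sym G q))
    (≤-trans (weighted-count (lowDown? a) n (2 * K) (λ u → # (nonNbrs? a u)) λ u (_ , l) → many-nonNbrs a u l)
      (≤-reflexive (cong (2 * K *_) (trans (∑-cong V λ u → sym (trans (∑-cong V λ v → 𝟙-× (lowDown? a u) (nonNbrs? a u v)) (∑-*ˡ V (𝟙 (lowDown? a u)) _)))
            (∑-comm V V _)))))
    0<d D≤

  defective-sum : #D ≤ ∑ (allFin (κ g)) (λ i → # (lowUp? (toℕ i)) + # (lowDown? (toℕ i)))
  defective-sum = begin
    #D
      ≤⟨ ∑-mono V (λ x → 𝟙-≤ (defective? x) λ (i , q) → ≤-trans (one x i q) (∑-term (∈-allFin i) (λ i → 𝟙 (lowUp? (toℕ i) x) + 𝟙 (lowDown? (toℕ i) x)))) ⟩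
    ∑ V (λ x → ∑ (allFin (κ g)) (λ i → 𝟙 (lowUp? (toℕ i) x) + 𝟙 (lowDown? (toℕ i) x)))
      ≡⟨ ∑-comm V (allFin (κ g)) (λ x i → 𝟙 (lowUp? (toℕ i) x) + 𝟙 (lowDown? (toℕ i) x)) ⟩
    ∑ (allFin (κ g)) (λ i → ∑ V (λ x → 𝟙 (lowUp? (toℕ i) x) + 𝟙 (lowDown? (toℕ i) x)))
      ≡⟨ ∑-cong (allFin (κ g)) (λ i → ∑-+ V (λ x → 𝟙 (lowUp? (toℕ i) x)) (λ x → 𝟙 (lowDown? (toℕ i) x))) ⟩
    ∑ (allFin (κ g)) (λ i → # (lowUp? (toℕ i)) + # (lowDown? (toℕ i))) ∎
    where
    open ≤-Reasoning
    one : ∀ x i → LowUp (toℕ i) x ⊎ LowDown (toℕ i) x → 1 ≤ 𝟙 (lowUp? (toℕ {(κ g)} i) x) + 𝟙 (lowDown? (toℕ {(κ g)} i) x)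
    one x i (inj₁ p) = ≤-trans (≤-reflexive (sym (𝟙-yes (lowUp? (toℕ i) x) p))) (m≤m+n _ (𝟙 (lowDown? (toℕ i) x)))
    one x i (inj₂ p) = ≤-trans (≤-reflexive (sym (𝟙-yes (lowDown? (toℕ i) x) p))) (m≤n+m _ (𝟙 (lowUp? (toℕ i) x)))

  defective⇒strict : 0 < #D → embeddings (κ g) G < 2 * κ g * H.prod (κ g) 0
  defective⇒strict 0<D = case heavy-index (κ g) #D (λ i → # (lowUp? (toℕ i))) (λ i → # (lowDown? (toℕ i))) 0<D defective-sum of λ
    { (i , inj₁ (pos , le)) → up-strict (toℕ i) (toℕ<n i) pos le
    ; (i , inj₂ (pos , le)) → down-strict (toℕ i) (toℕ<n i) pos le }

  Outcome : Set
  Outcome = embeddings (κ g) G < 2 * κ g * H.prod (κ g) 0 ⊎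
            (embeddings (κ g) G ≤ 2 * κ g * H.prod (κ g) 0 × (∀ u v → (Adj G u v → Linked u v) × (Linked u v → Adj G u v)))

  module _ (sound : ∀ x → ¬ Defective x) where

    G⊆H : ∀ {u v} → Adj G u v → Linked u v
    G⊆H {u} {v} a = case linked? u v of λ { (yes l) → l ; (no ¬l) → ⊥-elim ([ sound u , sound v ]′ (bad-edge a ¬l)) }

    zero-bad : (κ g) * (∑∑ bad? * n ^ m) ≡ 0
    zero-bad = zero-product (κ g) (n ^ m)
      (trans (∑-cong V λ u → trans (∑-cong V λ v → 𝟙-no (bad? u v) λ (a , ¬l) → ¬l (G⊆H a)) (∑-zero V)) (∑-zero V))

    missing-edge : ∀ u v → ψ v ≡ next (ψ u) → ¬ Adj G u v → 0 < missing (toℕ (ψ u))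
    missing-edge u v e ¬a = pos-right (K ^ m) (missing (toℕ (ψ u))) (≤-trans (*-mono-≤ one (m^n>0 n {{>-nonZero 0<n}} m))
      (missing-≥ (toℕ (ψ u)) E? λ { (refl , refl) → (refl , sym (mod-toℕ (ψ u))) ,
        (refl , trans e (trans (cong next (sym (mod-toℕ (ψ u)))) (next-mod (6 + dbl g) (toℕ (ψ u))))) , ¬a }))
      where
      E? : ∀ x y → Dec (x ≡ u × y ≡ v)
      E? x y = (x ≟ᶠ u) ×-dec (y ≟ᶠ v)
      one : 1 ≤ ∑∑ E?
      one = ≤-trans (≤-reflexive (sym (𝟙-yes (E? u v) (refl , refl))))
        (≤-trans (∑-term (∈-allFin v) (λ y → 𝟙 (E? u y))) (∑-term (∈-allFin u) (λ x → # (E? x))))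

    -- Without defective vertices there are no bad pairs, so a single absent edge of the blow-up
    -- makes the inequality of `exchange` strict.
    sound-outcome : Dec (∃[ u ] ∃[ v ] (ψ v ≡ next (ψ u) × ¬ Adj G u v)) → Outcome
    sound-outcome (yes (u , v , e , ¬a)) = inj₁ (missing⇒fewer (toℕ (ψ u)) (toℕ<n (ψ u))
      (subst (_< missing (toℕ (ψ u))) (sym zero-bad) (missing-edge u v e ¬a)))
    sound-outcome (no complete) = inj₂ (drop-zero (exchange 0 (s≤s z≤n)) zero-bad ,
      λ u v → G⊆H , λ { (inj₁ e) → filled u v e ; (inj₂ e) → Adj-sym G (filled v u e) })
      where
      filled : ∀ u v → ψ v ≡ next (ψ u) → Adj G u v
      filled u v e = case adj? G u v of λ { (yes a) → a ; (no ¬a) → ⊥-elim (complete (u , v , e , ¬a)) }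

  outcome : Outcome
  outcome = case 0 <? #D of λ
    { (yes l) → inj₁ (defective⇒strict l)
    ; (no ¬l) → sound-outcome
        (λ x d → ¬l (≤-trans (≤-reflexive (sym (𝟙-yes (defective? x) d))) (∑-term (∈-allFin x) (λ x → 𝟙 (defective? x)))))
        (any? (λ u → any? λ v → (ψ v ≟ᶠ next (ψ u)) ×-dec ¬? (adj? G u v))) }

-- Stability

-- With `S` the sum of 4n minus the degree sum over `cnt` closed sequences, `h₁` says S ≤
-- 4kn(n/k)^k, while `cnt` is nearly 2k(n/k)^k. The average is thus close to 2n and below (2 +
-- 1/M₁)n. Deleted edges and the rounding of n/k cost k(kk + 2)N/M₅ in all, which dictates `M₅`.
long-cycle-arithmetic : ∀ k n kk Nm Q B S e cnt M₁ M₅ → let N = n * (n * Nm) in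
  kk * S ≤ 4 * k * (n * N) → e ≤ cnt + k * (B * Nm) → M₅ * B ≤ n * n → 2 * k * Q ≤ e → M₅ * N ≤ M₅ * (kk * Q) + N →
  M₅ ≡ (1 + 2 * M₁) * (kk + 2) → 0 < k → 0 < n → 0 < Nm → M₁ * S < cnt * ((1 + 2 * M₁) * n)
long-cycle-arithmetic k n kk Nm Q B S e cnt M₁ M₅ h₁ h₂ h₃ h₄ h₅ h₆ 0<k 0<n 0<Nm with M₁ * S <? cnt * ((1 + 2 * M₁) * n)
... | yes l = l
... | no ¬l = ⊥-elim (<⇒≱ positive (+-cancelˡ-≤ (4 * k * M₁ * M₅ * N + k * M₅ * N) _ _ (begin
  4 * k * M₁ * M₅ * N + k * M₅ * N + k * (M₅ * N)       ≡⟨ eq₁ k M₁ M₅ N ⟩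
  t * (2 * k * (M₅ * N))  ≤⟨ *-monoʳ-≤ t iii ⟩
  t * (M₅ * (kk * cnt) + k * (kk + 2) * N)  ≡⟨ eq₂ t M₅ (kk * cnt) k (kk + 2) N ⟩
  M₅ * (kk * cnt * t) + k * (t * (kk + 2)) * N  ≤⟨ +-mono-≤ (*-monoʳ-≤ M₅ i) (≤-reflexive (cong (λ z → k * z * N) (sym h₆))) ⟩
  M₅ * (4 * k * M₁ * N) + k * M₅ * N  ≡⟨ eq₃ M₅ k M₁ N ⟩
  4 * k * M₁ * M₅ * N + k * M₅ * N + 0                  ∎)))
  where
  open ≤-Reasoning
  N t : ℕ
  N = n * (n * Nm)
  t = 1 + 2 * M₁
  eq₁ : ∀ k M₁ M₅ N → 4 * k * M₁ * M₅ * N + k * M₅ * N + k * (M₅ * N) ≡ (1 + 2 * M₁) * (2 * k * (M₅ * N))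
  eq₁ = solve-∀
  eq₂ : ∀ t M₅ c k b N → t * (M₅ * c + k * b * N) ≡ M₅ * (c * t) + k * (t * b) * N
  eq₂ = solve-∀
  eq₃ : ∀ M₅ k M₁ N → M₅ * (4 * k * M₁ * N) + k * M₅ * N ≡ 4 * k * M₁ * M₅ * N + k * M₅ * N + 0
  eq₃ = solve-∀
  eq₄ : ∀ a b t n → n * (a * b * t) ≡ a * (b * (t * n))
  eq₄ = solve-∀
  eq₅ : ∀ k n N M → M * (4 * k * (n * N)) ≡ n * (4 * k * M * N)
  eq₅ = solve-∀
  eq₆ : ∀ a b c → a * (b * c) ≡ b * (a * c)
  eq₆ = solve-∀
  eq₇ : ∀ M₅ kk c k B Nm → M₅ * (kk * (c + k * (B * Nm))) ≡ M₅ * (kk * c) + k * kk * (M₅ * B * Nm)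
  eq₇ = solve-∀
  eq₈ : ∀ k M₅ N kk Q → 2 * k * (M₅ * (kk * Q) + N) ≡ M₅ * (kk * (2 * k * Q)) + 2 * k * N
  eq₈ = solve-∀
  eq₉ : ∀ c k kk n Nm → c + k * kk * (n * n * Nm) + 2 * k * (n * (n * Nm)) ≡ c + k * (kk + 2) * (n * (n * Nm))
  eq₉ = solve-∀
  i : kk * cnt * t ≤ 4 * k * M₁ * N
  i = *-cancelˡ-≤ n {{>-nonZero 0<n}} (begin
    n * (kk * cnt * t)  ≡⟨ eq₄ kk cnt t n ⟩
    kk * (cnt * (t * n))       ≤⟨ *-monoʳ-≤ kk (≮⇒≥ ¬l) ⟩
    kk * (M₁ * S)  ≡⟨ eq₆ kk M₁ S ⟩
    M₁ * (kk * S)  ≤⟨ *-monoʳ-≤ M₁ h₁ ⟩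
    M₁ * (4 * k * (n * N))     ≡⟨ eq₅ k n N M₁ ⟩
    n * (4 * k * M₁ * N)       ∎)
  iii : 2 * k * (M₅ * N) ≤ M₅ * (kk * cnt) + k * (kk + 2) * N
  iii = begin
    2 * k * (M₅ * N)  ≤⟨ *-monoʳ-≤ (2 * k) h₅ ⟩
    2 * k * (M₅ * (kk * Q) + N)  ≡⟨ eq₈ k M₅ N kk Q ⟩
    M₅ * (kk * (2 * k * Q)) + 2 * k * N  ≤⟨ +-monoˡ-≤ (2 * k * N) (*-monoʳ-≤ M₅ (*-monoʳ-≤ kk (≤-trans h₄ h₂))) ⟩
    M₅ * (kk * (cnt + k * (B * Nm))) + 2 * k * N  ≡⟨ cong (_+ 2 * k * N) (eq₇ M₅ kk cnt k B Nm) ⟩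
    M₅ * (kk * cnt) + k * kk * (M₅ * B * Nm) + 2 * k * N        ≤⟨ +-monoˡ-≤ (2 * k * N) (+-monoʳ-≤ (M₅ * (kk * cnt)) (*-monoʳ-≤ (k * kk) (*-monoˡ-≤ Nm h₃))) ⟩
    M₅ * (kk * cnt) + k * kk * (n * n * Nm) + 2 * k * N  ≡⟨ eq₉ (M₅ * (kk * cnt)) k kk n Nm ⟩
    M₅ * (kk * cnt) + k * (kk + 2) * N                          ∎
  0<M₅ : 0 < M₅
  0<M₅ = subst (0 <_) (sym h₆) (*-mono-≤ {1} {t} {1} {kk + 2} (s≤s z≤n) (≤-trans (s≤s z≤n) (m≤n+m 2 kk)))
  positive : 0 < k * (M₅ * N)
  positive = *-mono-≤ 0<k (*-mono-≤ 0<M₅ (*-mono-≤ 0<n (*-mono-≤ 0<n 0<Nm)))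

unclassed-arithmetic : ∀ M n ds Y → M * (4 * n ∸ ds) < (1 + 2 * M) * n → ds + Y ≤ 2 * n → M * Y ≤ n
unclassed-arithmetic M n ds Y h le = +-cancelˡ-≤ (M * (2 * n)) _ _ (<⇒≤ (begin-strict
  M * (2 * n) + M * Y    ≡⟨ sym (*-distribˡ-+ M (2 * n) Y) ⟩
  M * (2 * n + Y)        ≤⟨ *-monoʳ-≤ M (m+n≤o⇒m≤o∸n (2 * n + Y) (begin
                              2 * n + Y + ds   ≡⟨ eq₁ n Y ds ⟩
                              2 * n + (ds + Y) ≤⟨ +-monoʳ-≤ (2 * n) le ⟩
                              2 * n + 2 * n    ≡⟨ eq₂ n ⟩
                              4 * n            ∎)) ⟩
  M * (4 * n ∸ ds)       <⟨ h ⟩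
  (1 + 2 * M) * n        ≡⟨ eq₃ M n ⟩
  M * (2 * n) + n        ∎))
  where
  open ≤-Reasoning
  eq₁ : ∀ n Y ds → 2 * n + Y + ds ≡ 2 * n + (ds + Y)
  eq₁ = solve-∀
  eq₂ : ∀ n → 2 * n + 2 * n ≡ 4 * n
  eq₂ = solve-∀
  eq₃ : ∀ M n → (1 + 2 * M) * n ≡ M * (2 * n) + n
  eq₃ = solve-∀

runs-arithmetic : ∀ k n kk Nm Q B Y R e M₁ M₂ → let N = n * (n * Nm) in
  e ≤ 2 * k * R + k * (B * Nm) + k * (Y * n * Nm) → M₁ * B ≤ n * n → M₁ * Y ≤ n → 2 * k * Q ≤ e →
  M₁ * N ≤ M₁ * (kk * Q) + N → M₁ ≡ M₂ * (1 + kk) → 0 < k → M₂ * N ≤ M₂ * (kk * R) + N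
runs-arithmetic k n kk Nm Q B Y R e M₁ M₂ h₁ h₂ h₃ h₄ h₅ h₆ 0<k = *-cancelˡ-≤ (1 + kk) (begin
  (1 + kk) * (M₂ * N)  ≡⟨ eq₁ kk M₂ N ⟩
  M₂ * (1 + kk) * N  ≡⟨ cong (_* N) (sym h₆) ⟩
  M₁ * N  ≤⟨ h₅ ⟩
  M₁ * (kk * Q) + N  ≡⟨ cong (_+ N) (eq₂ M₁ kk Q) ⟩
  kk * (M₁ * Q) + N  ≤⟨ +-monoˡ-≤ N (*-monoʳ-≤ kk step) ⟩
  kk * (M₁ * R + N) + N  ≡⟨ cong (λ z → kk * (z * R + N) + N) h₆ ⟩
  kk * (M₂ * (1 + kk) * R + N) + N  ≡⟨ eq₃ kk M₂ R N ⟩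
  (1 + kk) * (M₂ * (kk * R) + N)               ∎)
  where
  open ≤-Reasoning
  N = n * (n * Nm)
  eq₁ : ∀ kk M₂ N → (1 + kk) * (M₂ * N) ≡ M₂ * (1 + kk) * N
  eq₁ = solve-∀
  eq₂ : ∀ M kk Q → M * (kk * Q) ≡ kk * (M * Q)
  eq₂ = solve-∀
  eq₃ : ∀ kk M₂ R N → kk * (M₂ * (1 + kk) * R + N) + N ≡ (1 + kk) * (M₂ * (kk * R) + N)
  eq₃ = solve-∀
  eq₄ : ∀ k M Q → 2 * k * (M * Q) ≡ M * (2 * k * Q)
  eq₄ = solve-∀
  eq₅ : ∀ M k R B Nm Y n → M * (2 * k * R + k * (B * Nm) + k * (Y * n * Nm)) ≡ 2 * k * (M * R) + k * (M * B * Nm) + k * (M * Y * n * Nm)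
  eq₅ = solve-∀
  eq₆ : ∀ k M R n Nm → 2 * k * (M * R) + k * (n * n * Nm) + k * (n * n * Nm) ≡ 2 * k * (M * R + n * (n * Nm))
  eq₆ = solve-∀
  step : M₁ * Q ≤ M₁ * R + N
  step = *-cancelˡ-≤ (2 * k) {{>-nonZero (*-mono-≤ {1} {2} (s≤s z≤n) 0<k)}} (begin
    2 * k * (M₁ * Q)  ≡⟨ eq₄ k M₁ Q ⟩
    M₁ * (2 * k * Q)  ≤⟨ *-monoʳ-≤ M₁ (≤-trans h₄ h₁) ⟩
    M₁ * (2 * k * R + k * (B * Nm) + k * (Y * n * Nm))  ≡⟨ eq₅ M₁ k R B Nm Y n ⟩
    2 * k * (M₁ * R) + k * (M₁ * B * Nm) + k * (M₁ * Y * n * Nm)     ≤⟨ +-mono-≤ (+-monoʳ-≤ (2 * k * (M₁ * R)) (*-monoʳ-≤ k (*-monoˡ-≤ Nm h₂)))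
            (*-monoʳ-≤ k (*-monoˡ-≤ Nm (*-monoˡ-≤ n h₃))) ⟩
    2 * k * (M₁ * R) + k * (n * n * Nm) + k * (n * n * Nm)  ≡⟨ eq₆ k M₁ R n Nm ⟩
    2 * k * (M₁ * R + N)                                             ∎)

missing-arithmetic : ∀ M₂ kk R s p N → M₂ * N ≤ M₂ * (kk * R) + N → R + s ≤ p → kk * p ≤ N → 0 < kk → M₂ * s ≤ N
missing-arithmetic M₂ kk R s p N h₁ h₂ h₃ 0<kk = ≤-trans (*-monoʳ-≤ M₂ (m≤n*m s kk {{>-nonZero 0<kk}}))
  (+-cancelˡ-≤ (M₂ * (kk * R)) _ _ (begin
    M₂ * (kk * R) + M₂ * (kk * s)  ≡⟨ eq M₂ kk R s ⟩
    M₂ * (kk * (R + s))  ≤⟨ *-monoʳ-≤ M₂ (≤-trans (*-monoʳ-≤ kk h₂) h₃) ⟩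
    M₂ * N  ≤⟨ h₁ ⟩
    M₂ * (kk * R) + N              ∎))
  where
  open ≤-Reasoning
  eq : ∀ M kk R s → M * (kk * R) + M * (kk * s) ≡ M * (kk * (R + s))
  eq = solve-∀

class-arithmetic : ∀ M₂ kk R c n L → M₂ * (n * L) ≤ M₂ * (kk * R) + n * L → 2 ≤ M₂ → R ≤ c * L → 0 < L → n ≤ 2 * kk * c
class-arithmetic M₂ kk R c n L h₁ 2≤M₂ h₂ 0<L = *-cancelʳ-≤ n (2 * kk * c) L {{>-nonZero 0<L}}
  (*-cancelˡ-≤ M₂ {{>-nonZero (≤-trans (s≤s z≤n) 2≤M₂)}} (+-cancelʳ-≤ (M₂ * (n * L)) _ _ (begin
    M₂ * (n * L) + M₂ * (n * L)  ≤⟨ +-mono-≤ h₁ h₁ ⟩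
    M₂ * (kk * R) + n * L + (M₂ * (kk * R) + n * L)  ≡⟨ eq₁ M₂ kk R (n * L) ⟩
    M₂ * (2 * kk * R) + 2 * (n * L)  ≤⟨ +-mono-≤ (*-monoʳ-≤ M₂ (*-monoʳ-≤ (2 * kk) h₂)) (*-monoˡ-≤ (n * L) 2≤M₂) ⟩
    M₂ * (2 * kk * (c * L)) + M₂ * (n * L)  ≡⟨ cong (λ z → M₂ * z + M₂ * (n * L)) (sym (*-assoc (2 * kk) c L)) ⟩
    M₂ * (2 * kk * c * L) + M₂ * (n * L)                            ∎)))
  where
  open ≤-Reasoning
  eq₁ : ∀ M kk R p → M * (kk * R) + p + (M * (kk * R) + p) ≡ M * (2 * kk * R) + 2 * p
  eq₁ = solve-∀

atypical-arithmetic : ∀ M M₂ t n E Nm L s → t * n ≤ M * E → E * Nm ≤ L * s → M₂ * s ≤ n * (n * Nm) → 0 < n → 0 < Nm →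
  M₂ * t ≤ M * L * n
atypical-arithmetic M M₂ t n E Nm L s h₁ h₂ h₃ 0<n 0<Nm = *-cancelʳ-≤ (M₂ * t) (M * L * n) (n * Nm) {{>-nonZero (*-mono-≤ 0<n 0<Nm)}} (begin
  M₂ * t * (n * Nm)  ≡⟨ eq₁ M₂ t n Nm ⟩
  M₂ * (t * n * Nm)  ≤⟨ *-monoʳ-≤ M₂ (*-monoˡ-≤ Nm h₁) ⟩
  M₂ * (M * E * Nm)  ≡⟨ cong (M₂ *_) (*-assoc M E Nm) ⟩
  M₂ * (M * (E * Nm))        ≤⟨ *-monoʳ-≤ M₂ (*-monoʳ-≤ M h₂) ⟩
  M₂ * (M * (L * s))  ≡⟨ eq₂ M₂ M L s ⟩
  M * L * (M₂ * s)  ≤⟨ *-monoʳ-≤ (M * L) h₃ ⟩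
  M * L * (n * (n * Nm))     ≡⟨ sym (*-assoc (M * L) n (n * Nm)) ⟩
  M * L * n * (n * Nm)       ∎)
  where
  open ≤-Reasoning
  eq₁ : ∀ a t n p → a * t * (n * p) ≡ a * (t * n * p)
  eq₁ = solve-∀
  eq₂ : ∀ a M L s → a * (M * (L * s)) ≡ M * L * (a * s)
  eq₂ = solve-∀

exceptions-arithmetic : ∀ k M M₁ M₂ L n X Y (f : Fin k → ℕ) → X ≤ Y + ∑ (allFin k) f → (∀ i → M₂ * f i ≤ 2 * (M * L * n)) →
  M₁ * Y ≤ n → 2 * M ≤ M₁ → M₂ ≡ 4 * k * M * (M * L) → 0 < k → 0 < M * L → M * X ≤ n
exceptions-arithmetic k M M₁ M₂ L n X Y f h₁ h₂ h₃ h₄ h₅ 0<k 0<ML = *-cancelˡ-≤ 2 (begin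
  2 * (M * X)  ≤⟨ *-monoʳ-≤ 2 (*-monoʳ-≤ M h₁) ⟩
  2 * (M * (Y + F))  ≡⟨ eq₁ M Y F ⟩
  2 * M * Y + 2 * M * F  ≤⟨ +-mono-≤ (≤-trans (*-monoˡ-≤ Y h₄) h₃) sum-bound ⟩
  n + n  ≡⟨ cong (n +_) (sym (+-identityʳ n)) ⟩
  2 * n                                  ∎)
  where
  open ≤-Reasoning
  F = ∑ (allFin k) f
  eq₁ : ∀ M Y F → 2 * (M * (Y + F)) ≡ 2 * M * Y + 2 * M * F
  eq₁ = solve-∀
  eq₂ : ∀ k M P F → 2 * k * P * (2 * M * F) ≡ 4 * k * M * P * F
  eq₂ = solve-∀
  eq₃ : ∀ k P n → k * (2 * (P * n)) ≡ 2 * k * P * n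
  eq₃ = solve-∀
  sum-bound : 2 * M * F ≤ n
  sum-bound = *-cancelˡ-≤ (2 * k * (M * L)) {{>-nonZero (*-mono-≤ (*-mono-≤ {1} {2} (s≤s z≤n) 0<k) 0<ML)}} (begin
    2 * k * (M * L) * (2 * M * F)  ≡⟨ eq₂ k M (M * L) F ⟩
    4 * k * M * (M * L) * F  ≡⟨ cong (_* F) (sym h₅) ⟩
    M₂ * F  ≡⟨ sym (∑-*ˡ (allFin k) M₂ f) ⟩
    ∑ (allFin k) (λ i → M₂ * f i)  ≤⟨ ∑-mono (allFin k) h₂ ⟩
    ∑ (allFin k) (λ _ → 2 * (M * L * n))   ≡⟨ ∑-allFin-const k (2 * (M * L * n)) ⟩
    k * (2 * (M * L * n))  ≡⟨ eq₃ k (M * L) n ⟩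
    2 * k * (M * L) * n                    ∎)

typical-class-arithmetic : ∀ K₀ M n c d X → n ≤ K₀ * c → c ≤ d + X → M * X ≤ n → 2 * K₀ ≤ M → n ≤ 2 * K₀ * d
typical-class-arithmetic K₀ M n c d X h₁ h₂ h₃ h₄ = +-cancelʳ-≤ n _ _ (begin
  n + n  ≤⟨ +-mono-≤ one one ⟩
  K₀ * (d + X) + K₀ * (d + X)      ≡⟨ eq K₀ d X ⟩
  2 * K₀ * d + 2 * K₀ * X  ≤⟨ +-monoʳ-≤ (2 * K₀ * d) (≤-trans (*-monoˡ-≤ X h₄) h₃) ⟩
  2 * K₀ * d + n                   ∎)
  where
  open ≤-Reasoning
  one : n ≤ K₀ * (d + X)
  one = ≤-trans h₁ (*-monoʳ-≤ K₀ h₂)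
  eq : ∀ K d X → K * (d + X) + K * (d + X) ≡ 2 * K * d + 2 * K * X
  eq = solve-∀

𝟙-cancel : {P : Set} (M : ℕ) (d : Dec P) {a b : ℕ} → M * (𝟙 d * a) < 𝟙 d * b → P × M * a < b
𝟙-cancel M (yes p) {a} {b} l = p , subst₂ _<_ (cong (M *_) (*-identityˡ a)) (*-identityˡ b) l
𝟙-cancel M (no _)  l = ⊥-elim (n≮0 l)

module LongCycles (g : ℕ) {n : ℕ} (G : Graph n) {A : Fin n → Fin n → Set} (A? : ∀ u v → Dec (A u v))
  (A-sym : ∀ {u v} → A u v → A v u) (no-odd : ∀ r u → r < 3 + g → ¬ Walks.Walk A (suc (dbl r)) u u) where

  open Weights g A? A-sym no-odd using (degree-sum; cycle-degree-bound)

  private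
    m : ℕ
    m = 5 + dbl g
    V = allFin n

  lost? : ∀ u v → Dec (Adj G u v × ¬ A u v)
  lost? u v = adj? G u v ×-dec ¬? (A? u v)

  anyLost? : ∀ (v : Vec (Fin n) (κ g)) → Dec (∃[ i ] (Adj G (lookup v i) (lookup v (next i)) × ¬ A (lookup v i) (lookup v (next i))))
  anyLost? v = any? λ i → lost? (lookup v i) (lookup v (next i))

  kept : ∀ (v : Vec (Fin n) (κ g)) → Closed (Adj G) v → ¬ (∃[ i ] (Adj G (lookup v i) (lookup v (next i)) × ¬ A (lookup v i) (lookup v (next i)))) → Closed A v
  kept v cl ¬lost i = case A? (lookup v i) (lookup v (next i)) of λ { (yes a) → a ; (no ¬a) → ⊥-elim (¬lost (i , cl i , ¬a)) }

  closed-count : ℕ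
  closed-count = ∑ (vecs n (κ g)) (λ v → 𝟙 (closed? A? v))

  embeddings-≤ : embeddings (κ g) G ≤ closed-count + κ g * (∑∑ lost? * n ^ m)
  embeddings-≤ = begin
    embeddings (κ g) G  ≡⟨ embeddings-∑ (κ g) G ⟩
    ∑ (vecs n (κ g)) (λ v → 𝟙 (emb? G (lookup v)))  ≤⟨ ∑-mono (vecs n (κ g)) (λ v → 𝟙-≤ (emb? G (lookup v)) (pt v)) ⟩
    ∑ (vecs n (κ g)) (λ v → 𝟙 (closed? A? v) + 𝟙 (anyLost? v))  ≡⟨ ∑-+ (vecs n (κ g)) (λ v → 𝟙 (closed? A? v)) (λ v → 𝟙 (anyLost? v)) ⟩
    closed-count + ∑ (vecs n (κ g)) (λ v → 𝟙 (anyLost? v))  ≤⟨ +-monoʳ-≤ closed-count (edge-union m lost?) ⟩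
    closed-count + κ g * (∑∑ lost? * n ^ m)                                     ∎
    where
    open ≤-Reasoning
    pt : ∀ v → Emb G (lookup v) → 1 ≤ 𝟙 (closed? A? v) + 𝟙 (anyLost? v)
    pt v (cl , _) = case anyLost? v of λ
      { (yes l) → ≤-trans (≤-reflexive (sym (𝟙-yes (anyLost? v) l))) (m≤n+m _ (𝟙 (closed? A? v)))
      ; (no ¬l) → ≤-trans (≤-reflexive (sym (𝟙-yes (closed? A? v) (kept v cl ¬l)))) (m≤m+n _ (𝟙 (anyLost? v))) }

  rich-cycle : ∀ M₁ M₅ Q → M₅ * ∑∑ lost? ≤ n * n → 2 * κ g * Q ≤ embeddings (κ g) G → M₅ * n ^ κ g ≤ M₅ * (κ g ^ κ g * Q) + n ^ κ g →
    M₅ ≡ (1 + 2 * M₁) * (κ g ^ κ g + 2) → 0 < n → ∃[ z ] (Closed A z × M₁ * (4 * n ∸ degree-sum z) < (1 + 2 * M₁) * n)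
  rich-cycle M₁ M₅ Q sparse dense approx eM₅ 0<n =
    case ∑-pigeonhole (vecs n (κ g)) (λ v → M₁ * (𝟙 (closed? A? v) * (4 * n ∸ degree-sum v))) (λ v → 𝟙 (closed? A? v) * ((1 + 2 * M₁) * n))
      (subst₂ _<_ (sym (∑-*ˡ (vecs n (κ g)) M₁ (λ v → 𝟙 (closed? A? v) * (4 * n ∸ degree-sum v)))) (sym (∑-*ʳ (vecs n (κ g)) ((1 + 2 * M₁) * n) (λ v → 𝟙 (closed? A? v))))
        (long-cycle-arithmetic (κ g) n (κ g ^ κ g) (n ^ m) Q (∑∑ lost?) (∑ (vecs n (κ g)) (λ v → 𝟙 (closed? A? v) * (4 * n ∸ degree-sum v)))
          (embeddings (κ g) G) closed-count M₁ M₅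
          cycle-degree-bound embeddings-≤ sparse dense approx eM₅ (s≤s z≤n) 0<n (m^n>0 n {{>-nonZero 0<n}} m))) of
      λ (z , l) → z , 𝟙-cancel M₁ (closed? A? z) l

  module Classify (z : Vec (Fin n) (κ g)) (cl : Closed A z) where

    private
      x : ℕ → Fin n
      x = at z
      step : ∀ i → A (x i) (x (suc i))
      step = closed⇒at {R = A} z cl
      per : ∀ i → x (i + κ g) ≡ x i
      per = at-+ z

    open OddGirth g A-sym no-odd using (module Cycle)
    open Cycle x step per using (arc3; module Roles)

    -- Such a vertex can take the place of `x (a + 1)` on the cycle. Classes are labelled by `a`
    -- instead of `a + 1`, a shift common to all of them.
    Between : ℕ → Fin n → Set
    Between a w = A (x a) w × A (x (a + 2)) w

    between? : ∀ a w → Dec (Between a w)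
    between? a w = A? (x a) w ×-dec A? (x (a + 2)) w

    Cl : Fin n → Set
    Cl w = ∃[ i ] Between (toℕ {(κ g)} i) w

    Cl? : ∀ w → Dec (Cl w)
    Cl? w = any? λ i → between? (toℕ i) w

    between⇒Cl : ∀ a {w} → Between a w → Cl w
    between⇒Cl a {w} (p , q) = a mod κ g , subst (λ y → A y w) (same a (toℕ (a mod κ g)) (sym e)) p ,
      subst (λ y → A y w) (same (a + 2) (toℕ (a mod κ g) + 2) (%-+ʳ (6 + dbl g) a (toℕ (a mod κ g)) 2 (sym e))) q
      where
      same : ∀ a b → a % κ g ≡ b % κ g → x a ≡ x b
      same a b e = cong (lookup z) (mod-cong {6 + dbl g} {a} {b} e)
      e : toℕ (a mod κ g) % κ g ≡ a % κ g
      e = trans (cong (_% κ g) (toℕ-mod a (6 + dbl g))) (m%n%n≡m%n a (κ g))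

    chosen : ∀ {w} → Dec (Cl w) → Fin (κ g)
    chosen (yes (i , _)) = i
    chosen (no _)        = fzero

    chosen-between : ∀ {w} (d : Dec (Cl w)) → Cl w → Between (toℕ (chosen d)) w
    chosen-between (yes (_ , b)) _ = b
    chosen-between (no ¬c)       c = ⊥-elim (¬c c)

    ψ₀ : Fin n → Fin (κ g)
    ψ₀ w = chosen (Cl? w)

    ψ₀-between : ∀ {w} → Cl w → Between (toℕ (ψ₀ w)) w
    ψ₀-between {w} = chosen-between (Cl? w)

    -- Neighbours on the cycle differ pairwise by two, and a - 2 and a + 2 differ by four, so there
    -- are at most two. Exactly two make the vertex classed; an unclassed vertex therefore lowers
    -- the degree sum.
    at-most-two : ∀ w → ∑ (downFrom (κ g)) (λ i → 𝟙 (A? (x i) w)) + 𝟙 (¬? (Cl? w)) ≤ 2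
    at-most-two w = case Cl? w of λ
      { (yes c) → ≤-trans (+-monoʳ-≤ (∑ (downFrom (κ g)) (λ i → 𝟙 (s? i))) (≤-reflexive (𝟙-no (¬? (Cl? w)) λ ¬c → ¬c c)))
                    (≤-trans (≤-reflexive (+-identityʳ _)) (classed c))
      ; (no ¬c) → +-mono-≤ (unclassed ¬c) (𝟙≤1 (¬? (Cl? w))) }
      where
      open Roles A? w
      shift : ∀ a e → a + (5 + e) + 2 ≡ a + (7 + e)
      shift = solve-∀
      shift′ : ∀ a e → a + 2 + (7 + e) ≡ a + (5 + e) + 4
      shift′ = solve-∀
      classed : Cl w → ∑ (downFrom (κ g)) (λ i → 𝟙 (s? i)) ≤ 2
      classed (i , p , q) = count-window (κ g) s? s-per s-per⁻ (toℕ i) (0 ∷ 2 ∷ []) λ d l r → case ss (toℕ i) d l p r of λ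
        { (here refl) → here refl
        ; (there (here refl)) → there (here refl)
        ; (there (there (here refl))) → ⊥-elim (case ss (toℕ i + (5 + dbl g)) 4 (s≤s (s≤s (s≤s (s≤s (s≤s z≤n))))) r
              (subst s (shift′ (toℕ i) (dbl g)) (s-per⁻ (toℕ i + 2) q)) of λ { (here ()) ; (there (here ())) ; (there (there (here ()))) }) }
      unclassed : ¬ Cl w → ∑ (downFrom (κ g)) (λ i → 𝟙 (s? i)) ≤ 1
      unclassed ¬c = case any? (λ i → s? (toℕ {(κ g)} i)) of λ
        { (no none) → ≤-trans (count-window (κ g) s? s-per s-per⁻ 0 [] λ d l r → ⊥-elim (none (fromℕ< l , subst s (sym (toℕ-fromℕ< l)) r))) z≤n
        ; (yes (i , p)) → count-window (κ g) s? s-per s-per⁻ (toℕ i) (0 ∷ []) λ d l r → case ss (toℕ i) d l p r of λ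
            { (here refl) → here refl
            ; (there (here refl)) → ⊥-elim (¬c (between⇒Cl (toℕ i) (p , r)))
            ; (there (there (here refl))) → ⊥-elim (¬c (between⇒Cl (toℕ i + (5 + dbl g))
                (r , subst s (sym (shift (toℕ i) (dbl g))) (s-per⁻ (toℕ i) p)))) } }

    unclassed-bound : degree-sum z + # (λ w → ¬? (Cl? w)) ≤ 2 * n
    unclassed-bound = begin
      degree-sum z + # (λ w → ¬? (Cl? w))
        ≡⟨ cong (_+ # (λ w → ¬? (Cl? w))) (∑-comm (downFrom (κ g)) V (λ i w → 𝟙 (A? (x i) w))) ⟩
      ∑ V (λ w → ∑ (downFrom (κ g)) (λ i → 𝟙 (A? (x i) w))) + # (λ w → ¬? (Cl? w))
        ≡⟨ sym (∑-+ V (λ w → ∑ (downFrom (κ g)) (λ i → 𝟙 (A? (x i) w))) (λ w → 𝟙 (¬? (Cl? w)))) ⟩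
      ∑ V (λ w → ∑ (downFrom (κ g)) (λ i → 𝟙 (A? (x i) w)) + 𝟙 (¬? (Cl? w)))
        ≤⟨ ∑-mono V at-most-two ⟩
      ∑ V (λ _ → 2)
        ≡⟨ trans (∑-allFin-const n 2) (*-comm n 2) ⟩
      2 * n ∎
      where open ≤-Reasoning

    -- The walk through `w` and `u` has length three, so d is 1, 3, k - 3 or k - 1. The middle
    -- values are refuted by the other cycle neighbours: `x (b + 2)` turns 3 into 5, and `x (i + 2)`
    -- turns k - 3 into k - 5, neither of which is allowed.
    consecutive : ∀ {w u} → A w u → ∀ i d (b : Fin (κ g)) → Between (toℕ i) w → Between (toℕ b) u → toℕ i + d ≡ toℕ b →
                  b ≡ next i ⊎ i ≡ next b
    consecutive {w} {u} a i d b (p , p′) (q , q′) e = case arc3 (toℕ i) d d<k (path p q i+d) of λ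
      { (here refl) → inj₁ (trans (sym (mod-toℕ b)) (trans (cong (_mod κ g) (trans (sym e) (+-comm (toℕ i) 1)))
                        (trans (sym (next-mod (6 + dbl g) (toℕ i))) (cong next (mod-toℕ i)))))
      ; (there (here refl)) → ⊥-elim (case arc3 (toℕ i) 5 (s≤s (s≤s (s≤s (s≤s (s≤s (s≤s z≤n))))))
            (path p q′ (cong x (trans (cong (_+ 2) (sym e)) (+-assoc (toℕ i) 3 2)))) of λ
              { (here ()) ; (there (here ()))
              ; (there (there (here e′))) → dbl≢odd g (0 , refl) (sym (+-cancelˡ-≡ 4 _ _ e′))
              ; (there (there (there (here ())))) })
      ; (there (there (here refl))) → ⊥-elim (case arc3 (toℕ i + 2) (2 + dbl g) (m≤n+m (3 + dbl g) 4)
            (path p′ q (cong x (trans (sym e) (sym (+-assoc (toℕ i) 2 (2 + dbl g)))))) of λ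
              { (here ())
              ; (there (here e′)) → dbl≢odd g (0 , refl) (+-cancelˡ-≡ 2 _ _ e′)
              ; (there (there (here e′))) → m≢1+n+m (2 + dbl g) {1} e′
              ; (there (there (there (here e′)))) → m≢1+n+m (2 + dbl g) {3} e′ })
      ; (there (there (there (here refl)))) → inj₂ (sym (trans (cong next (sym (mod-toℕ b))) (trans (next-mod (6 + dbl g) (toℕ b))
            (trans (cong (_mod κ g) (trans (cong suc (sym e)) (sym (+-suc (toℕ i) (6 + dbl g))))) (trans (mod-+ (6 + dbl g) (toℕ i)) (mod-toℕ i)))))) }
      where
      d<k : d < κ g
      d<k = ≤-trans (s≤s (≤-trans (m≤n+m d (toℕ i)) (≤-reflexive e))) (toℕ<n b)
      i+d : x (toℕ b) ≡ x (toℕ i + d)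
      i+d = cong x (sym e)
      path : ∀ {s t t′} → A s w → A t u → t ≡ t′ → Walks.Walk A 3 s t′
      path {t = t} p q refl = w , p , u , a , t , A-sym q , refl

    linked : ∀ {w u} → A w u → Cl w → Cl u → ψ₀ u ≡ next (ψ₀ w) ⊎ ψ₀ w ≡ next (ψ₀ u)
    linked {w} {u} a cw cu = case ≤-total (toℕ (ψ₀ w)) (toℕ (ψ₀ u)) of λ
      { (inj₁ l) → case m≤n⇒∃[o]m+o≡n l of λ (d , e) → consecutive a (ψ₀ w) d (ψ₀ u) (ψ₀-between cw) (ψ₀-between cu) e
      ; (inj₂ l) → case m≤n⇒∃[o]m+o≡n l of λ (d , e) →
          [ inj₂ , inj₁ ]′ (consecutive (A-sym a) (ψ₀ u) d (ψ₀ w) (ψ₀-between cu) (ψ₀-between cw) e) }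

    module VC = Classes g ψ₀ Cl?

    closed-runs : ℕ
    closed-runs = ∑ (vecs n (κ g)) (λ v → 𝟙 (closed? A? v) * 𝟙 (VC.run? 0 v))

    #unclassed : ℕ
    #unclassed = # (λ w → ¬? (Cl? w))

    private
      runs : Vec (Fin n) (κ g) → ℕ
      runs v = ∑ (downFrom (κ g)) (λ a → 𝟙 (VC.run? a v))
      closed-turns : Vec (Fin n) (κ g) → ℕ
      closed-turns v = 𝟙 (closed? A? v) * runs v + 𝟙 (closed? A? (reverse v)) * runs (reverse v)

      ∑-closed-runs : ∑ (vecs n (κ g)) (λ v → 𝟙 (closed? A? v) * runs v) ≡ κ g * closed-runs
      ∑-closed-runs = trans (∑-cong (vecs n (κ g)) λ v → sym (∑-*ˡ (downFrom (κ g)) (𝟙 (closed? A? v)) (λ a → 𝟙 (VC.run? a v))))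
        (trans (∑-comm (vecs n (κ g)) (downFrom (κ g)) (λ v a → 𝟙 (closed? A? v) * 𝟙 (VC.run? a v)))
          (trans (∑-cong (downFrom (κ g)) λ a → VC.∑-run-shift A? a)
            (trans (∑-const (downFrom (κ g)) closed-runs) (cong (_* closed-runs) (length-downFrom (κ g))))))

      unclassed? : ∀ (u v : Fin n) → Dec (¬ Cl u)
      unclassed? u v = ¬? (Cl? u)

      anyUnclassed? : ∀ (v : Vec (Fin n) (κ g)) → Dec (∃[ i ] ¬ Cl (lookup v i))
      anyUnclassed? v = any? λ i → unclassed? (lookup v i) (lookup v (next i))

      ∑∑-unclassed : ∑∑ unclassed? ≡ #unclassed * n
      ∑∑-unclassed = trans (∑-cong V λ u → trans (∑-allFin-const n (𝟙 (¬? (Cl? u)))) (*-comm n _)) (∑-*ʳ V n (λ u → 𝟙 (¬? (Cl? u))))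

      closed-turns-pos : ∀ v → Closed A v → (∀ i → Cl (lookup v i)) → 1 ≤ closed-turns v
      closed-turns-pos v c all = ≤-trans (VC.turns-pos v (λ i → all (i mod κ g)) st)
        (≤-reflexive (sym (cong₂ _+_ (trans (cong (_* runs v) (𝟙-yes (closed? A? v) c)) (*-identityˡ (runs v)))
          (trans (cong (_* runs (reverse v)) (𝟙-yes (closed? A? (reverse v)) (λ i → A-sym (closed-reverse {R = A} v c i)))) (*-identityˡ (runs (reverse v)))))))
        where
        st : ∀ i → VC.Up (at v i) (at v (suc i)) ⊎ VC.Down (at v i) (at v (suc i))
        st i = linked (closed⇒at {R = A} v c i) (all (i mod κ g)) (all (suc i mod κ g))

    -- An embedding that uses no lost edge and meets no unclassed vertex moves between consecutive
    -- classes, so by `monotone` it is a closed run in one direction or the other.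
    embeddings≤runs : embeddings (κ g) G ≤ 2 * κ g * closed-runs + κ g * (∑∑ lost? * n ^ m) + κ g * (#unclassed * n * n ^ m)
    embeddings≤runs = begin
      embeddings (κ g) G
        ≡⟨ embeddings-∑ (κ g) G ⟩
      ∑ (vecs n (κ g)) (λ v → 𝟙 (emb? G (lookup v)))
        ≤⟨ ∑-mono (vecs n (κ g)) (λ v → 𝟙-≤ (emb? G (lookup v)) (pt v)) ⟩
      ∑ (vecs n (κ g)) (λ v → closed-turns v + 𝟙 (anyLost? v) + 𝟙 (anyUnclassed? v))
        ≡⟨ trans (∑-+ (vecs n (κ g)) (λ v → closed-turns v + 𝟙 (anyLost? v)) (λ v → 𝟙 (anyUnclassed? v)))
             (cong (_+ ∑ (vecs n (κ g)) (λ v → 𝟙 (anyUnclassed? v))) (∑-+ (vecs n (κ g)) closed-turns (λ v → 𝟙 (anyLost? v)))) ⟩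
      ∑ (vecs n (κ g)) closed-turns + ∑ (vecs n (κ g)) (λ v → 𝟙 (anyLost? v)) + ∑ (vecs n (κ g)) (λ v → 𝟙 (anyUnclassed? v))
        ≤⟨ +-mono-≤ (+-mono-≤ (≤-reflexive turns-sum) (edge-union m lost?)) (≤-trans (edge-union m unclassed?) (≤-reflexive (cong (λ t → κ g * (t * n ^ m)) ∑∑-unclassed))) ⟩
      2 * κ g * closed-runs + κ g * (∑∑ lost? * n ^ m) + κ g * (#unclassed * n * n ^ m) ∎
      where
      open ≤-Reasoning
      eq : ∀ k r → k * r + k * r ≡ 2 * k * r
      eq = solve-∀
      turns-sum : ∑ (vecs n (κ g)) closed-turns ≡ 2 * κ g * closed-runs
      turns-sum = trans (∑-+ (vecs n (κ g)) (λ v → 𝟙 (closed? A? v) * runs v) (λ v → 𝟙 (closed? A? (reverse v)) * runs (reverse v)))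
        (trans (cong₂ _+_ ∑-closed-runs (trans (∑-reverse (κ g) (λ v → 𝟙 (closed? A? v) * runs v)) ∑-closed-runs)) (eq (κ g) closed-runs))
      pt : ∀ v → Emb G (lookup v) → 1 ≤ closed-turns v + 𝟙 (anyLost? v) + 𝟙 (anyUnclassed? v)
      pt v (c , _) = case anyLost? v of λ
        { (yes l) → ≤-trans (≤-reflexive (sym (𝟙-yes (anyLost? v) l))) (≤-trans (m≤n+m _ (closed-turns v)) (m≤m+n _ (𝟙 (anyUnclassed? v))))
        ; (no ¬l) → case anyUnclassed? v of λ
            { (yes u) → ≤-trans (≤-reflexive (sym (𝟙-yes (anyUnclassed? v) u))) (m≤n+m _ (closed-turns v + 𝟙 (anyLost? v)))
            ; (no ¬u) → ≤-trans (closed-turns-pos v (kept v c ¬l) (λ i → all v ¬u i)) (≤-trans (m≤m+n _ (𝟙 (anyLost? v))) (m≤m+n _ (𝟙 (anyUnclassed? v)))) } }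
        where
        all : ∀ (v : Vec (Fin n) (κ g)) → ¬ (∃[ i ] ¬ Cl (lookup v i)) → ∀ i → Cl (lookup v i)
        all v ¬u i = case Cl? (lookup v i) of λ { (yes c) → c ; (no ¬c) → ⊥-elim (¬u (i , ¬c)) }

    open-run? : ∀ a (v : Vec (Fin n) (κ g)) → Dec (VC.Run a v × ¬ Closed A v)
    open-run? a v = VC.run? a v ×-dec ¬? (closed? A? v)

    open-runs : ℕ → ℕ
    open-runs a = ∑ (vecs n (κ g)) (λ v → 𝟙 (open-run? a v))

    -- The right-hand side is at most (n/k)^k by AM-GM, and the closed runs nearly attain this,
    -- which makes open runs rare. Rotation lets the runs be counted from any class `a`.
    runs-split : ∀ a → closed-runs + open-runs a ≤ VC.prod (κ g) a
    runs-split a = begin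
      closed-runs + open-runs a
        ≡⟨ cong (_+ open-runs a) (sym (VC.∑-run-shift A? a)) ⟩
      ∑ (vecs n (κ g)) (λ v → 𝟙 (closed? A? v) * 𝟙 (VC.run? a v)) + open-runs a
        ≡⟨ sym (∑-+ (vecs n (κ g)) (λ v → 𝟙 (closed? A? v) * 𝟙 (VC.run? a v)) (λ v → 𝟙 (open-run? a v))) ⟩
      ∑ (vecs n (κ g)) (λ v → 𝟙 (closed? A? v) * 𝟙 (VC.run? a v) + 𝟙 (open-run? a v))
        ≤⟨ ∑-mono (vecs n (κ g)) (λ v → pt (closed? A? v) (VC.run? a v)) ⟩
      ∑ (vecs n (κ g)) (λ v → 𝟙 (VC.run? a v))
        ≡⟨ VC.∑-run (κ g) a ⟩
      VC.prod (κ g) a ∎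
      where
      open ≤-Reasoning
      pt : {P Q : Set} (p : Dec P) (q : Dec Q) → 𝟙 p * 𝟙 q + 𝟙 (q ×-dec ¬? p) ≤ 𝟙 q
      pt (yes _) (yes _) = ≤-refl
      pt (yes _) (no _)  = ≤-refl
      pt (no _)  (yes _) = ≤-refl
      pt (no _)  (no _)  = ≤-refl

    prod-upper : ∀ l a → VC.prod l a ≤ n ^ l
    prod-upper zero    a = ≤-refl
    prod-upper (suc l) a = *-mono-≤ (#≤n (VC.C? a)) (prod-upper l (suc a))

    -- This keeps every class large: one small class would leave too few closed runs.
    closed-runs≤size : ∀ a → closed-runs ≤ VC.size a * n ^ (6 + dbl g)
    closed-runs≤size a = ≤-trans (≤-trans (m≤m+n closed-runs (open-runs a)) (runs-split a)) (*-monoʳ-≤ (VC.size a) (prod-upper (6 + dbl g) (suc a)))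

module TypicalSet (g : ℕ) {n : ℕ} (G : Graph n) {A : Fin n → Fin n → Set} (A? : ∀ u v → Dec (A u v))
  (A-sym : ∀ {u v} → A u v → A v u) (A⊆Adj : ∀ {u v} → A u v → Adj G u v)
  (no-odd : ∀ r u → r < 3 + g → ¬ Walks.Walk A (suc (dbl r)) u u)
  (z : Vec (Fin n) (κ g)) (cl : Closed A z) (M : ℕ) where

  open LongCycles g G A? A-sym no-odd
  open Classify z cl

  private
    m : ℕ
    m = 5 + dbl g
    V = allFin n

  nonAdj? : ∀ b w y → Dec (VC.C b y × ¬ Adj G w y)
  nonAdj? b w y = VC.C? b y ×-dec ¬? (adj? G w y)

  BlindUp : ℕ → Fin n → Set
  BlindUp a w = VC.C a w × n < M * # (nonAdj? (suc a) w)
  BlindDown : ℕ → Fin n → Set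
  BlindDown a w = VC.C (suc a) w × n < M * # (nonAdj? a w)

  blindUp? : ∀ a w → Dec (BlindUp a w)
  blindUp? a w = VC.C? a w ×-dec (n <? M * # (nonAdj? (suc a) w))
  blindDown? : ∀ a w → Dec (BlindDown a w)
  blindDown? a w = VC.C? (suc a) w ×-dec (n <? M * # (nonAdj? a w))

  Blind : Fin n → Set
  Blind w = ∃[ i ] (BlindUp (toℕ {(κ g)} i) w ⊎ BlindDown (toℕ {(κ g)} i) w)
  blind? : ∀ w → Dec (Blind w)
  blind? w = any? λ i → blindUp? (toℕ i) w ⊎-dec blindDown? (toℕ i) w

  U : Fin n → Set
  U w = Cl w × ¬ Blind w
  U? : ∀ w → Dec (U w)
  U? w = Cl? w ×-dec ¬? (blind? w)

  module UC = Classes g ψ₀ U?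

  same-class : ∀ i j {w} → i % κ g ≡ j % κ g → VC.C i w → VC.C j w
  same-class i j e (c , q) = c , trans q (mod-cong {6 + dbl g} {i} {j} e)

  toℕ-mod% : ∀ a → toℕ (a mod κ g) % κ g ≡ a % κ g
  toℕ-mod% a = trans (cong (_% κ g) (toℕ-mod a (6 + dbl g))) (m%n%n≡m%n a (κ g))

  suc-toℕ-mod% : ∀ a → suc (toℕ (a mod κ g)) % κ g ≡ suc a % κ g
  suc-toℕ-mod% a = trans (cong (λ t → suc t % κ g) (toℕ-mod a (6 + dbl g))) (%-suc a (6 + dbl g))

  sees-up : ∀ a {w} → UC.C a w → M * # (λ y → UC.C? (suc a) y ×-dec ¬? (adj? G w y)) ≤ n
  sees-up a {w} ((c , ¬b) , e) = ≤-trans (*-monoʳ-≤ M (#-mono (λ y → UC.C? (suc a) y ×-dec ¬? (adj? G w y)) (nonAdj? (suc i) w)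
      λ y (((c′ , _) , e′) , ¬a) → same-class (suc a) (suc i) (sym (suc-toℕ-mod% a)) (c′ , e′) , ¬a))
    (≮⇒≥ λ l → ¬b (a mod κ g , inj₁ (same-class a i (sym (toℕ-mod% a)) (c , e) , l)))
    where
    i = toℕ (a mod κ g)

  sees-down : ∀ a {w} → UC.C (suc a) w → M * # (λ y → UC.C? a y ×-dec ¬? (adj? G w y)) ≤ n
  sees-down a {w} ((c , ¬b) , e) = ≤-trans (*-monoʳ-≤ M (#-mono (λ y → UC.C? a y ×-dec ¬? (adj? G w y)) (nonAdj? i w)
      λ y (((c′ , _) , e′) , ¬a) → same-class a i (sym (toℕ-mod% a)) (c′ , e′) , ¬a))
    (≮⇒≥ λ l → ¬b (a mod κ g , inj₂ (same-class (suc a) (suc i) (sym (suc-toℕ-mod% a)) (c , e) , l)))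
    where
    i = toℕ (a mod κ g)

  exceptions : # (λ w → ¬? (U? w)) ≤ #unclassed + ∑ (allFin (κ g)) (λ i → # (blindUp? (toℕ i)) + # (blindDown? (toℕ i)))
  exceptions = begin
    # (λ w → ¬? (U? w))
      ≤⟨ ∑-mono V (λ w → 𝟙-≤ (¬? (U? w)) (pt w)) ⟩
    ∑ V (λ w → 𝟙 (¬? (Cl? w)) + ∑ (allFin (κ g)) (λ i → b i w))
      ≡⟨ ∑-+ V (λ w → 𝟙 (¬? (Cl? w))) (λ w → ∑ (allFin (κ g)) (λ i → b i w)) ⟩
    #unclassed + ∑ V (λ w → ∑ (allFin (κ g)) (λ i → b i w))
      ≡⟨ cong (#unclassed +_) (∑-comm V (allFin (κ g)) (λ w i → b i w)) ⟩
    #unclassed + ∑ (allFin (κ g)) (λ i → ∑ V (b i))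
      ≡⟨ cong (#unclassed +_) (∑-cong (allFin (κ g)) λ i → ∑-+ V (λ w → 𝟙 (blindUp? (toℕ i) w)) (λ w → 𝟙 (blindDown? (toℕ i) w))) ⟩
    #unclassed + ∑ (allFin (κ g)) (λ i → # (blindUp? (toℕ i)) + # (blindDown? (toℕ i))) ∎
    where
    open ≤-Reasoning
    b : Fin (κ g) → Fin n → ℕ
    b i w = 𝟙 (blindUp? (toℕ i) w) + 𝟙 (blindDown? (toℕ i) w)
    b-pos : ∀ i w → BlindUp (toℕ i) w ⊎ BlindDown (toℕ i) w → 1 ≤ b i w
    b-pos i w (inj₁ p) = ≤-trans (≤-reflexive (sym (𝟙-yes (blindUp? (toℕ i) w) p))) (m≤m+n _ (𝟙 (blindDown? (toℕ i) w)))
    b-pos i w (inj₂ p) = ≤-trans (≤-reflexive (sym (𝟙-yes (blindDown? (toℕ i) w) p))) (m≤n+m _ (𝟙 (blindUp? (toℕ i) w)))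
    pt : ∀ w → ¬ U w → 1 ≤ 𝟙 (¬? (Cl? w)) + ∑ (allFin (κ g)) (λ i → b i w)
    pt w ¬U = case blind? w of λ
      { (yes (i , p)) → ≤-trans (≤-trans (b-pos i w p) (∑-term (∈-allFin i) (λ i → b i w))) (m≤n+m _ (𝟙 (¬? (Cl? w))))
      ; (no ¬b) → ≤-trans (≤-reflexive (sym (𝟙-yes (¬? (Cl? w)) λ c → ¬U (c , ¬b)))) (m≤m+n _ (∑ (allFin (κ g)) (λ i → b i w))) }

  size-split : ∀ a → VC.size a ≤ UC.size a + # (λ w → ¬? (U? w))
  size-split a = ≤-trans (#-split (VC.C? a) U?) (+-mono-≤
    (#-mono (λ w → VC.C? a w ×-dec U? w) (UC.C? a) λ w ((_ , e) , u) → u , e)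
    (#-mono (λ w → VC.C? a w ×-dec ¬? (U? w)) (λ w → ¬? (U? w)) λ w (_ , ¬u) → ¬u))

  module _ (K₀ : ℕ) (large-classes : ∀ a → n ≤ K₀ * VC.size a) where

    open-runs-≥ : ∀ a {E : Fin n → Fin n → Set} (E? : ∀ u v → Dec (E u v)) →
      (∀ {u v} → E u v → VC.C a u × VC.C (suc a) v × ¬ Adj G u v) → ∑∑ E? * n ^ m ≤ K₀ ^ m * open-runs a
    open-runs-≥ a E? h = begin
      ∑∑ E? * n ^ m  ≤⟨ *-monoʳ-≤ (∑∑ E?) (VC.prod-lower K₀ large-classes m (2 + a)) ⟩
      ∑∑ E? * (K₀ ^ m * VC.prod m (2 + a))   ≡⟨ eq (∑∑ E?) (K₀ ^ m) (VC.prod m (2 + a)) ⟩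
      K₀ ^ m * (∑∑ E? * VC.prod m (2 + a))   ≤⟨ *-monoʳ-≤ (K₀ ^ m) (pair-extend VC.C? m (2 + a) E? (open-run? a)
            λ u v xs e r → case h e of λ (cu , cv , ¬a) → (cu , cv , r) , λ c → ¬a (A⊆Adj (c fzero))) ⟩
      K₀ ^ m * open-runs a                   ∎
      where
      open ≤-Reasoning
      eq : ∀ a b c → a * (b * c) ≡ b * (a * c)
      eq = solve-∀

    module _ (M₂ : ℕ) (few-open : ∀ a → M₂ * open-runs a ≤ n ^ κ g) (0<n : 0 < n) where

      -- Each blind vertex gives more than n/M non-adjacent pairs, and each pair extends to at least
      -- (n/K₀)^(k-2) open runs, which are rare.
      few-blindUp : ∀ a → M₂ * # (blindUp? a) ≤ M * K₀ ^ m * n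
      few-blindUp a = atypical-arithmetic M M₂ (# (blindUp? a)) n (∑∑ E?) (n ^ m) (K₀ ^ m) (open-runs a)
        (≤-trans (weighted-count (blindUp? a) n M (λ u → # (nonAdj? (suc a) u)) λ u (_ , l) → <⇒≤ l)
          (≤-reflexive (cong (M *_) (∑-cong V λ u → sym (trans (∑-cong V λ v → 𝟙-× (blindUp? a u) (nonAdj? (suc a) u v)) (∑-*ˡ V (𝟙 (blindUp? a u)) _))))))
        (open-runs-≥ a E? λ ((c , _) , c′ , ¬a) → c , c′ , ¬a) (few-open a) 0<n (m^n>0 n {{>-nonZero 0<n}} m)
        where
        E? : ∀ u v → Dec (BlindUp a u × (VC.C (suc a) v × ¬ Adj G u v))
        E? u v = blindUp? a u ×-dec nonAdj? (suc a) u v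

      few-blindDown : ∀ a → M₂ * # (blindDown? a) ≤ M * K₀ ^ m * n
      few-blindDown a = atypical-arithmetic M M₂ (# (blindDown? a)) n (∑∑ E?) (n ^ m) (K₀ ^ m) (open-runs a)
        (≤-trans (weighted-count (blindDown? a) n M (λ v → # (nonAdj? a v)) λ v (_ , l) → <⇒≤ l)
          (≤-reflexive (cong (M *_) (trans (∑-cong V λ v → sym (trans (∑-cong V λ u → 𝟙-× (blindDown? a v) (nonAdj? a v u)) (∑-*ˡ V (𝟙 (blindDown? a v)) _)))
            (∑-comm V V (λ v u → 𝟙 (E? u v)))))))
        (open-runs-≥ a E? λ ((c , _) , c′ , ¬a) → c′ , c , λ q → ¬a (Adj-sym G q)) (few-open a) 0<n (m^n>0 n {{>-nonZero 0<n}} m)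
        where
        E? : ∀ u v → Dec (BlindDown a v × (VC.C a u × ¬ Adj G v u))
        E? u v = blindDown? a v ×-dec nonAdj? a v u

      few-exceptions : ∀ M₁ → M₁ * #unclassed ≤ n → 2 * M ≤ M₁ → M₂ ≡ 4 * κ g * M * (M * K₀ ^ m) → 0 < M * K₀ ^ m →
        M * # (λ w → ¬? (U? w)) ≤ n
      few-exceptions M₁ h₁ h₂ h₃ h₄ = exceptions-arithmetic (κ g) M M₁ M₂ (K₀ ^ m) n (# (λ w → ¬? (U? w))) #unclassed
        (λ i → # (blindUp? (toℕ i)) + # (blindDown? (toℕ i))) exceptions
        (λ i → ≤-trans (≤-reflexive (*-distribˡ-+ M₂ (# (blindUp? (toℕ i))) (# (blindDown? (toℕ i)))))
                 (≤-trans (+-mono-≤ (few-blindUp (toℕ i)) (few-blindDown (toℕ i))) (≤-reflexive (cong (M * K₀ ^ m * n +_) (sym (+-identityʳ (M * K₀ ^ m * n)))))))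
        h₁ h₂ h₃ (s≤s z≤n) h₄

-- 1/M₅, 1/M₁, 1/M₂ and 1/M bound the proportions of deleted edges, of vertices outside the classes, of runs
-- through the classes that are not cycles, and of atypical vertices.
record Constants (k kk m : ℕ) : Set where
  field
    K₀ M M₁ M₂ M₅ : ℕ
    K₀≡     : K₀ ≡ 2 * kk
    8K₀≤M   : 4 * (2 * K₀) ≤ M
    0<M     : 0 < M
    M-large : 8 * k * k * (2 * K₀) * (2 * K₀) ^ m < M
    M₂≡     : M₂ ≡ 4 * k * M * (M * K₀ ^ m)
    M₁≡     : M₁ ≡ M₂ * (1 + kk)
    M₅≡     : M₅ ≡ (1 + 2 * M₁) * (kk + 2)
    2≤M₂    : 2 ≤ M₂
    2M≤M₁   : 2 * M ≤ M₁
    M₁≤M₅   : M₁ ≤ M₅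
    0<MK    : 0 < M * K₀ ^ m

module Dense (g : ℕ) (c : Constants (κ g) (κ g ^ κ g) (5 + dbl g)) {n : ℕ} (G : Graph n) {A : Fin n → Fin n → Set} (A? : ∀ u v → Dec (A u v))
  (A-sym : ∀ {u v} → A u v → A v u) (A⊆Adj : ∀ {u v} → A u v → Adj G u v)
  (no-odd : ∀ r u → r < 3 + g → ¬ Walks.Walk A (suc (dbl r)) u u) (Q : ℕ) where

  open Constants c
  open LongCycles g G A? A-sym no-odd using (lost?; rich-cycle; module Classify)

  private
    m : ℕ
    m = 5 + dbl g

  typical : M₅ * ∑∑ lost? ≤ n * n → 2 * κ g * Q ≤ embeddings (κ g) G →
    M₅ * n ^ κ g ≤ M₅ * (κ g ^ κ g * Q) + n ^ κ g → M₁ * n ^ κ g ≤ M₁ * (κ g ^ κ g * Q) + n ^ κ g → 2 * (2 * K₀) * κ g < n → Typical g G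
  typical sparse dense approx₅ approx₁ large = build (rich-cycle M₁ M₅ Q sparse dense approx₅ M₅≡ 0<n)
    where
    open Weights g A? A-sym no-odd using (degree-sum)
    0<n : 0 < n
    0<n = ≤-<-trans z≤n large
    build : ∃[ z ] (Closed A z × M₁ * (4 * n ∸ degree-sum z) < (1 + 2 * M₁) * n) → Typical g G
    build (z , cl , rich) = record
      -- The class constant doubles because discarding the atypical vertices takes away at most half
      -- of a class.
      { ψ₀ = ψ₀ ; U = S.U ; U? = S.U? ; K = 2 * K₀ ; M = M
      ; few-exceptions = few
      ; large-classes = λ a → typical-class-arithmetic K₀ M n (VC.size a) (S.UC.size a) (# (λ w → ¬? (S.U? w)))
          (classes a) (S.size-split a) few (≤-trans (m≤n*m (2 * K₀) 4) 8K₀≤M)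
      ; sees-up = S.sees-up ; sees-down = S.sees-down
      ; 4K≤M = 8K₀≤M ; 0<M = 0<M ; M-large = M-large ; large = large }
      where
      open Classify z cl
      module S = TypicalSet g G A? A-sym A⊆Adj no-odd z cl M
      unclassed : M₁ * #unclassed ≤ n
      unclassed = unclassed-arithmetic M₁ n (degree-sum z) #unclassed rich unclassed-bound
      many-runs : M₂ * n ^ κ g ≤ M₂ * (κ g ^ κ g * closed-runs) + n ^ κ g
      many-runs = runs-arithmetic (κ g) n (κ g ^ κ g) (n ^ m) Q (∑∑ lost?) #unclassed closed-runs (embeddings (κ g) G) M₁ M₂
        embeddings≤runs (≤-trans (*-monoˡ-≤ (∑∑ lost?) M₁≤M₅) sparse) unclassed dense approx₁ M₁≡ (s≤s z≤n)
      classes : ∀ a → n ≤ K₀ * VC.size a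
      classes a = subst (λ t → n ≤ t * VC.size a) (sym K₀≡)
        (class-arithmetic M₂ (κ g ^ κ g) closed-runs (VC.size a) n (n ^ (6 + dbl g)) many-runs 2≤M₂ (closed-runs≤size a) (m^n>0 n {{>-nonZero 0<n}} (6 + dbl g)))
      few-open : ∀ a → M₂ * open-runs a ≤ n ^ κ g
      few-open a = missing-arithmetic M₂ (κ g ^ κ g) closed-runs (open-runs a) (VC.prod (κ g) a) (n ^ κ g) many-runs (runs-split a) (VC.prod≤ a) (m^n>0 (κ g) (κ g))
      few : M * # (λ w → ¬? (S.U? w)) ≤ n
      few = S.few-exceptions K₀ classes M₂ few-open 0<n M₁ unclassed 2M≤M₁ M₂≡ 0<MK

-- Balanced blow-ups

∑-change : ∀ {n} (v : Fin n) (f h : Fin n → ℕ) → (∀ x → x ≢ v → f x ≡ h x) → ∑ (allFin n) f + h v ≡ ∑ (allFin n) h + f v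
∑-change {n} v f h e = begin
  ∑ V f + h v  ≡⟨ cong (∑ V f +_) (sym (spot (h v))) ⟩
  ∑ V f + ∑ V (λ x → 𝟙 (x ≟ᶠ v) * h v)  ≡⟨ sym (∑-+ V f _) ⟩
  ∑ V (λ x → f x + 𝟙 (x ≟ᶠ v) * h v)  ≡⟨ ∑-cong V pt ⟩
  ∑ V (λ x → h x + 𝟙 (x ≟ᶠ v) * f v)  ≡⟨ ∑-+ V h _ ⟩
  ∑ V h + ∑ V (λ x → 𝟙 (x ≟ᶠ v) * f v)  ≡⟨ cong (∑ V h +_) (spot (f v)) ⟩
  ∑ V h + f v                                  ∎
  where
  open ≡-Reasoning
  V = allFin n
  spot : ∀ c → ∑ V (λ x → 𝟙 (x ≟ᶠ v) * c) ≡ c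
  spot c = trans (∑-*ʳ V c (λ x → 𝟙 (x ≟ᶠ v))) (trans (cong (_* c) (#-singleton v)) (*-identityˡ c))
  pt : ∀ x → f x + 𝟙 (x ≟ᶠ v) * h v ≡ h x + 𝟙 (x ≟ᶠ v) * f v
  pt x with x ≟ᶠ v
  ... | yes refl = swap (f x) (h x)
    where
    swap : ∀ a b → a + 1 * b ≡ b + 1 * a
    swap = solve-∀
  ... | no x≢v = cong (_+ 0) (e x x≢v)

∏ : (ℕ → ℕ) → ℕ → ℕ → ℕ
∏ s zero    a = 1
∏ s (suc m) a = s a * ∏ s m (suc a)

∏-cong : ∀ s t m a → (∀ i → a ≤ i → i < a + m → s i ≡ t i) → ∏ s m a ≡ ∏ t m a
∏-cong s t zero    a e = refl
∏-cong s t (suc m) a e = cong₂ _*_ (e a ≤-refl (m<m+n a (s≤s z≤n)))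
  (∏-cong s t m (suc a) λ i l l′ → e i (<⇒≤ l) (≤-trans l′ (≤-reflexive (sym (+-suc a m)))))

∏-change : ∀ s t j m a → (∀ i → i < a + m → i ≢ j → s i ≡ t i) → a ≤ j → j < a + m → ∏ s m a * t j ≡ ∏ t m a * s j
∏-change s t j zero    a e l l′ = ⊥-elim (<⇒≱ (subst (j <_) (+-identityʳ a) l′) l)
∏-change s t j (suc m) a e l l′ = case a ≟ j of λ
  { (yes refl) → trans (cong (λ z → s a * z * t a) (∏-cong s t m (suc a) λ i l″ l‴ → e i (bound l‴) (λ { refl → <-irrefl refl l″ })))
                   (swap (s a) (∏ t m (suc a)) (t a))
  ; (no a≢j) → trans (*-assoc (s a) _ (t j)) (trans (cong₂ _*_ (e a (m<m+n a (s≤s z≤n)) a≢j)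
                   (∏-change s t j m (suc a) (λ i l″ → e i (bound l″)) (≤∧≢⇒< l a≢j) (≤-trans l′ (≤-reflexive (+-suc a m)))))
                   (sym (*-assoc (t a) _ (s j)))) }
  where
  bound : ∀ {i} → i < suc a + m → i < a + suc m
  bound l = ≤-trans l (≤-reflexive (sym (+-suc a m)))
  swap : ∀ a b c → a * b * c ≡ c * b * a
  swap = solve-∀

-- One unit moves from the larger factor `a` to the smaller factor `b`. The two factors are changed
-- one after the other, through `mid`, and the identities are cross-multiplied to avoid division.
∏-balance : ∀ s t a b m → a ≢ b → a < m → b < m → s a ≡ suc (t a) → t b ≡ suc (s b) → s b < t a →
  (∀ i → i < m → i ≢ a → i ≢ b → s i ≡ t i) → 0 < ∏ s m 0 → ∏ s m 0 < ∏ t m 0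
∏-balance s t a b m a≢b a<m b<m sa tb lt same pos = ≰⇒> λ le → <⇒≱
  (*-monoʳ-< (∏ s m 0) {{>-nonZero pos}} strict′)
  (≤-trans (≤-reflexive product) (*-monoˡ-≤ (s a * s b) le))
  where
  mid : ℕ → ℕ
  mid i with i ≟ a
  ... | yes _ = t i
  ... | no _  = s i
  mid-a : mid a ≡ t a
  mid-a with a ≟ a
  ... | yes _ = refl
  ... | no ¬e = ⊥-elim (¬e refl)
  mid-≢ : ∀ {i} → i ≢ a → mid i ≡ s i
  mid-≢ {i} i≢a with i ≟ a
  ... | yes e = ⊥-elim (i≢a e)
  ... | no _  = refl
  step₁ : ∏ s m 0 * t a ≡ ∏ mid m 0 * s a
  step₁ = trans (cong (∏ s m 0 *_) (sym mid-a)) (∏-change s mid a m 0 (λ i _ i≢a → sym (mid-≢ i≢a)) z≤n a<m)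
  step₂ : ∏ mid m 0 * t b ≡ ∏ t m 0 * s b
  step₂ = trans (∏-change mid t b m 0 (λ i i<m i≢b → case i ≟ a of λ
      { (yes refl) → mid-a ; (no i≢a) → trans (mid-≢ i≢a) (same i i<m i≢a i≢b) }) z≤n b<m)
    (cong (∏ t m 0 *_) (mid-≢ (λ e → a≢b (sym e))))
  eq₁ : ∀ p x y → p * (x * y) ≡ p * x * y
  eq₁ = solve-∀
  eq₂ : ∀ p x y → p * x * y ≡ p * y * x
  eq₂ = solve-∀
  product : ∏ s m 0 * (t a * t b) ≡ ∏ t m 0 * (s a * s b)
  product = trans (eq₁ (∏ s m 0) (t a) (t b)) (trans (cong (_* t b) step₁) (trans (eq₂ (∏ mid m 0) (s a) (t b))
    (trans (cong (_* s a) step₂) (trans (eq₂ (∏ t m 0) (s b) (s a)) (sym (eq₁ (∏ t m 0) (s a) (s b)))))))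
  strict′ : s a * s b < t a * t b
  strict′ = subst₂ _<_ (cong (_* s b) (sym sa)) (trans (*-comm (suc (s b)) (t a)) (cong (t a *_) (sym tb)))
    (<-≤-trans (+-monoˡ-< (t a * s b) lt) (≤-reflexive (eq₃ (t a) (s b))))
    where
    eq₃ : ∀ x y → x + x * y ≡ (1 + y) * x
    eq₃ = solve-∀

∑-allFin-downFrom : ∀ n (f : ℕ → ℕ) → ∑ (allFin n) (f ∘ toℕ) ≡ ∑ (downFrom n) f
∑-allFin-downFrom zero    f = refl
∑-allFin-downFrom (suc n) f = trans (∑-allFin-suc n (f ∘ toℕ))
  (trans (cong (f 0 +_) (∑-allFin-downFrom n (f ∘ suc))) (∑-downFrom-shift n f))

∑-downFrom-+ : ∀ m N (f : ℕ → ℕ) → ∑ (downFrom (m + N)) f ≡ ∑ (downFrom m) (λ d → f (N + d)) + ∑ (downFrom N) f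
∑-downFrom-+ zero    N f = refl
∑-downFrom-+ (suc m) N f = trans (cong₂ _+_ (cong f (+-comm m N)) (∑-downFrom-+ m N f)) (sym (+-assoc (f (N + m)) _ _))

residue-count : ∀ k′ (c : Fin (suc k′)) q n → q * suc k′ ≤ n → q ≤ # {n} (λ v → (toℕ v mod suc k′) ≟ᶠ c)
residue-count k′ c q n le = case m≤n⇒∃[o]m+o≡n le of λ (r , e) → ≤-trans (blocks q)
  (≤-trans (m≤n+m (∑ (downFrom (q * suc k′)) f) (∑ (downFrom r) (λ d → f (q * suc k′ + d))))
    (≤-reflexive (trans (sym (∑-downFrom-+ r (q * suc k′) f)) (trans (cong (λ z → ∑ (downFrom z) f) (trans (+-comm r (q * suc k′)) e))
      (sym (∑-allFin-downFrom n f))))))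
  where
  f : ℕ → ℕ
  f j = 𝟙 ((j mod suc k′) ≟ᶠ c)
  blocks : ∀ q → q ≤ ∑ (downFrom (q * suc k′)) f
  blocks zero    = z≤n
  blocks (suc q) = ≤-trans (+-mono-≤ one (blocks q)) (≤-reflexive (sym (∑-downFrom-+ (suc k′) (q * suc k′) f)))
    where
    one : 1 ≤ ∑ (downFrom (suc k′)) (λ d → f (q * suc k′ + d))
    one = case locate k′ (q * suc k′) c of λ (d , d<k , e) →
      ≤-trans (≤-reflexive (sym (𝟙-yes (((q * suc k′ + d) mod suc k′) ≟ᶠ c) (sym e))))
        (∑-term (subst (_∈ downFrom (suc k′)) (toℕ-fromℕ< d<k) (downFrom-∈ (fromℕ< d<k))) (λ d → f (q * suc k′ + d)))

prod≡∏ : ∀ {n} {C : ℕ → Fin n → Set} (C? : ∀ i w → Dec (C i w)) m a → Runs.prod C? m a ≡ ∏ (Runs.size C?) m a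
prod≡∏ C? zero    a = refl
prod≡∏ C? (suc m) a = cong (Runs.size C? a *_) (prod≡∏ C? m (suc a))

cycles-< : ∀ k {n} (G : Graph n) p → embeddings (suc k) G < 2 * suc k * p → cycles (suc k) G < p
cycles-< k G p l = m<n*o⇒m/o<n (≤-trans l (≤-reflexive (*-comm (2 * suc k) p)))

cycles-≤ : ∀ k {n} (G : Graph n) p → embeddings (suc k) G ≤ 2 * suc k * p → cycles (suc k) G ≤ p
cycles-≤ k G p l = ≤-trans (/-monoˡ-≤ (2 * suc k) (≤-trans l (≤-reflexive (*-comm (2 * suc k) p)))) (≤-reflexive (m*n/n≡m p (2 * suc k)))

module Balance (g : ℕ) where

  module Bu = BlowUp g

  P : ∀ {n} → (Fin n → Fin (κ g)) → ℕ
  P ψ = Bu.prod ψ (κ g) 0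

  sz : ∀ {n} → (Fin n → Fin (κ g)) → ℕ → ℕ
  sz ψ i = Bu.size ψ i

  partSize≡ : ∀ {n} (ψ : Fin n → Fin (κ g)) (a : Fin (κ g)) → partSize ψ a ≡ sz ψ (toℕ a)
  partSize≡ {n} ψ a = trans (length-filterᵇ (λ v → ψ v == a) (allFin n)) (∑-cong (allFin n) λ v →
    𝟙ᵇ-dec (ψ v == a) (Bu.C? ψ (toℕ a) v) (λ e → refl , trans (==-sound (ψ v) a e) (sym (mod-toℕ a)))
      λ (_ , e) → subst (λ z → (z == a) ≡ true) (sym (trans e (mod-toℕ a))) (==-refl a))

  -- The classes are the residues of the vertex numbers. The blow-up on them is what a graph with
  -- few cycles is measured against.
  equitable : ∀ n q → q * κ g ≤ n → ∃[ ψ ] (q ^ κ g ≤ P {n} ψ)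
  equitable n q le = ψ , ≤-trans (Bu.prod-lower ψ 1 {q} (λ a → ≤-trans (bound a) (≤-reflexive (sym (*-identityˡ (sz ψ a))))) (κ g) 0)
      (≤-reflexive (trans (cong (_* P ψ) (^-zeroˡ (κ g))) (*-identityˡ (P ψ))))
    where
    ψ : Fin n → Fin (κ g)
    ψ v = toℕ v mod κ g
    bound : ∀ a → q ≤ sz ψ a
    bound a = ≤-trans (residue-count (6 + dbl g) (a mod κ g) q n le)
      (#-mono (λ v → (toℕ v mod κ g) ≟ᶠ (a mod κ g)) (Bu.C? ψ a) λ v e → refl , e)

  module Move {n : ℕ} (ψ : Fin n → Fin (κ g)) (a b : Fin (κ g)) (v₀ : Fin n) (v₀∈a : ψ v₀ ≡ a) (a≢b : a ≢ b) where

    ψ′ : Fin n → Fin (κ g)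
    ψ′ v with v ≟ᶠ v₀
    ... | yes _ = b
    ... | no _  = ψ v

    ψ′-v₀ : ψ′ v₀ ≡ b
    ψ′-v₀ with v₀ ≟ᶠ v₀
    ... | yes _ = refl
    ... | no ¬e = ⊥-elim (¬e refl)

    ψ′-≢ : ∀ {v} → v ≢ v₀ → ψ′ v ≡ ψ v
    ψ′-≢ {v} v≢ with v ≟ᶠ v₀
    ... | yes e = ⊥-elim (v≢ e)
    ... | no _  = refl

    change : ∀ i → sz ψ i + 𝟙 (Bu.C? ψ′ i v₀) ≡ sz ψ′ i + 𝟙 (Bu.C? ψ i v₀)
    change i = ∑-change v₀ (λ v → 𝟙 (Bu.C? ψ i v)) (λ v → 𝟙 (Bu.C? ψ′ i v)) λ v v≢ →
      𝟙-cong (Bu.C? ψ i v) (Bu.C? ψ′ i v) (λ (_ , e) → refl , trans (ψ′-≢ v≢) e) (λ (_ , e) → refl , trans (sym (ψ′-≢ v≢)) e)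

    in-old : ∀ i → ψ v₀ ≡ i mod κ g → 𝟙 (Bu.C? ψ i v₀) ≡ 1
    in-old i e = 𝟙-yes (Bu.C? ψ i v₀) (refl , e)
    in-new : ∀ i → b ≡ i mod κ g → 𝟙 (Bu.C? ψ′ i v₀) ≡ 1
    in-new i e = 𝟙-yes (Bu.C? ψ′ i v₀) (refl , trans ψ′-v₀ e)
    not-old : ∀ i → a ≢ i mod κ g → 𝟙 (Bu.C? ψ i v₀) ≡ 0
    not-old i ¬e = 𝟙-no (Bu.C? ψ i v₀) λ (_ , e) → ¬e (trans (sym v₀∈a) e)
    not-new : ∀ i → b ≢ i mod κ g → 𝟙 (Bu.C? ψ′ i v₀) ≡ 0
    not-new i ¬e = 𝟙-no (Bu.C? ψ′ i v₀) λ (_ , e) → ¬e (trans (sym ψ′-v₀) e)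

    size-a : sz ψ (toℕ a) ≡ suc (sz ψ′ (toℕ a))
    size-a = trans (sym (+-identityʳ _)) (trans (cong (sz ψ (toℕ a) +_) (sym (not-new (toℕ a) λ e → a≢b (sym (trans e (mod-toℕ a))))))
      (trans (change (toℕ a)) (trans (cong (sz ψ′ (toℕ a) +_) (in-old (toℕ a) (trans v₀∈a (sym (mod-toℕ a))))) (+-comm (sz ψ′ (toℕ a)) 1))))

    size-b : sz ψ′ (toℕ b) ≡ suc (sz ψ (toℕ b))
    size-b = trans (sym (+-identityʳ _)) (trans (cong (sz ψ′ (toℕ b) +_) (sym (not-old (toℕ b) λ e → a≢b (trans e (mod-toℕ b)))))
      (trans (sym (change (toℕ b))) (trans (cong (sz ψ (toℕ b) +_) (in-new (toℕ b) (sym (mod-toℕ b)))) (+-comm (sz ψ (toℕ b)) 1))))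

    size-other : ∀ i → i < κ g → i ≢ toℕ a → i ≢ toℕ b → sz ψ i ≡ sz ψ′ i
    size-other i l i≢a i≢b = trans (sym (+-identityʳ _)) (trans (cong (sz ψ i +_) (sym (not-new i (away b i≢b))))
      (trans (change i) (trans (cong (sz ψ′ i +_) (not-old i (away a i≢a))) (+-identityʳ _))))
      where
      away : ∀ c → i ≢ toℕ c → c ≢ i mod κ g
      away c i≢c e = i≢c (sym (trans (cong toℕ e) (trans (toℕ-mod i (6 + dbl g)) (m<n⇒m%n≡m l))))

    increase : suc (sz ψ (toℕ b)) < sz ψ (toℕ a) → 0 < P ψ → P ψ < P ψ′
    increase l pos = subst₂ _<_ (sym (prod≡∏ (Bu.C? ψ) (κ g) 0)) (sym (prod≡∏ (Bu.C? ψ′) (κ g) 0))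
      (∏-balance (sz ψ) (sz ψ′) (toℕ a) (toℕ b) (κ g) (λ e → a≢b (toℕ-injective e)) (toℕ<n a) (toℕ<n b) size-a size-b
        (≤-pred (≤-trans l (≤-reflexive size-a))) size-other (subst (0 <_) (prod≡∏ (Bu.C? ψ) (κ g) 0) pos))

  unbalanced⇒larger : ∀ {n} (ψ : Fin n → Fin (κ g)) (a b : Fin (κ g)) → 0 < P ψ →
    suc (partSize ψ b) < partSize ψ a → ∃[ ψ′ ] (P ψ < P {n} ψ′)
  unbalanced⇒larger ψ a b pos l = case pick (Bu.C? ψ (toℕ a)) [] (≤-trans (s≤s z≤n) l′) of λ (v₀ , (_ , e) , _) →
    Move.ψ′ ψ a b v₀ (trans e (mod-toℕ a)) a≢b , Move.increase ψ a b v₀ (trans e (mod-toℕ a)) a≢b l′ pos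
    where
    l′ : suc (sz ψ (toℕ b)) < sz ψ (toℕ a)
    l′ = subst₂ (λ x y → suc x < y) (partSize≡ ψ b) (partSize≡ ψ a) l
    a≢b : a ≢ b
    a≢b refl = <⇒≱ l (n≤1+n _)

-- Constants, threshold and conclusion

constants : ∀ k kk m → 0 < k → 0 < kk → Constants k kk m
constants k kk m 0<k 0<kk = record
  { K₀ = K₀ ; M = M ; M₁ = M₁ ; M₂ = M₂ ; M₅ = M₅
  ; K₀≡ = refl ; M₂≡ = refl ; M₁≡ = refl ; M₅≡ = refl
  ; 8K₀≤M = ≤-trans (m≤m+n (4 * (2 * K₀)) L) (n≤1+n _)
  ; 0<M = s≤s z≤n
  ; M-large = s≤s (m≤n+m L (4 * (2 * K₀)))
  ; 2≤M₂ = ≤-trans (*-monoʳ-≤ 2 (s≤s z≤n)) 2M≤M₂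
  ; 2M≤M₁ = ≤-trans 2M≤M₂ (m≤m*n M₂ (1 + kk))
  ; M₁≤M₅ = ≤-trans (≤-trans (m≤n*m M₁ 2) (n≤1+n (2 * M₁))) (m≤m*n (1 + 2 * M₁) (kk + 2) {{>-nonZero (≤-trans (s≤s z≤n) (m≤n+m 2 kk))}})
  ; 0<MK = 0<MK }
  where
  K₀ L M M₁ M₂ M₅ : ℕ
  K₀ = 2 * kk
  L = 8 * k * k * (2 * K₀) * (2 * K₀) ^ m
  M = 1 + (4 * (2 * K₀) + L)
  M₂ = 4 * k * M * (M * K₀ ^ m)
  M₁ = M₂ * (1 + kk)
  M₅ = (1 + 2 * M₁) * (kk + 2)
  0<K₀ : 0 < K₀
  0<K₀ = *-mono-≤ {1} {2} (s≤s z≤n) 0<kk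
  0<MK : 0 < M * K₀ ^ m
  0<MK = *-mono-≤ {1} {M} (s≤s z≤n) (m^n>0 K₀ {{>-nonZero 0<K₀}} m)
  2M≤M₂ : 2 * M ≤ M₂
  2M≤M₂ = ≤-trans (*-monoˡ-≤ M (≤-trans (m≤m+n 2 2) (m≤m*n 4 k {{>-nonZero 0<k}}))) (m≤m*n (4 * k * M) (M * K₀ ^ m) {{>-nonZero 0<MK}})

-- By the tangent bound `bernoulli⁻`, rounding n down to kq changes the k-th power by at most
-- k·r·n^(k-1), a fraction 1/M of n^k for large n.
division-approximation : ∀ M k′ q r n → n ≡ suc k′ * q + r → M * (suc k′ * r) ≤ n →
  M * n ^ suc k′ ≤ M * (suc k′ ^ suc k′ * q ^ suc k′) + n ^ suc k′
division-approximation M k′ q r n e le = begin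
  M * n ^ k  ≡⟨ cong (λ t → M * t ^ k) e ⟩
  M * (k * q + r) ^ k  ≤⟨ *-monoʳ-≤ M (bernoulli⁻ (k * q) r k′) ⟩
  M * ((k * q) ^ k + k * r * (k * q + r) ^ k′) ≡⟨ cong₂ (λ s t → M * (s + k * r * t ^ k′)) (*-^ k q k) (sym e) ⟩
  M * (k ^ k * q ^ k + k * r * n ^ k′)       ≡⟨ eq M (k ^ k * q ^ k) (k * r) (n ^ k′) ⟩
  M * (k ^ k * q ^ k) + M * (k * r) * n ^ k′ ≤⟨ +-monoʳ-≤ (M * (k ^ k * q ^ k)) (*-monoˡ-≤ (n ^ k′) le) ⟩
  M * (k ^ k * q ^ k) + n ^ k                ∎
  where
  open ≤-Reasoning
  k = suc k′
  eq : ∀ M a b c → M * (a + b * c) ≡ M * a + M * b * c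
  eq = solve-∀

-- The sum of all lower bounds on n used below, so that each of them is read off as a summand.
threshold : ℕ → ℕ → ℕ → ℕ → ℕ
threshold k K₀ M₁ M₅ = 1 + (4 * (2 * M₅) * k + (2 * (2 * M₅) * ((4 * (2 * M₅)) ^ k * k) + (2 * (2 * K₀) * k + (M₅ * (k * k) + (M₁ * (k * k) + k)))))

record AboveThreshold (k K₀ M₁ M₅ n : ℕ) : Set where
  field
    biclique-small : 4 * (2 * M₅) * k ≤ n
    biclique-large : 2 * (2 * M₅) * ((4 * (2 * M₅)) ^ k * k) < n
    classes-large  : 2 * (2 * K₀) * k < n
    approx₅        : M₅ * (k * k) ≤ n
    approx₁        : M₁ * (k * k) ≤ n
    k≤n            : k ≤ n

above-threshold : ∀ k K₀ M₁ M₅ n → threshold k K₀ M₁ M₅ ≤ n → AboveThreshold k K₀ M₁ M₅ n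
above-threshold k K₀ M₁ M₅ n l = record
  { biclique-small = ≤-trans (≤-trans (m≤m+n a _) (n≤1+n _)) l
  ; biclique-large = ≤-trans (s≤s (≤-trans (m≤m+n b _) (m≤n+m _ a))) l
  ; classes-large  = ≤-trans (s≤s (≤-trans (m≤m+n c _) tail₁)) l
  ; approx₅        = ≤-trans (≤-trans (≤-trans (m≤m+n d _) tail₂) (n≤1+n _)) l
  ; approx₁        = ≤-trans (≤-trans (≤-trans (m≤m+n e _) tail₃) (n≤1+n _)) l
  ; k≤n            = ≤-trans (≤-trans (≤-trans (m≤n+m k e) tail₃) (n≤1+n _)) l }
  where
  a b c d e : ℕ
  a = 4 * (2 * M₅) * k
  b = 2 * (2 * M₅) * ((4 * (2 * M₅)) ^ k * k)
  c = 2 * (2 * K₀) * k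
  d = M₅ * (k * k)
  e = M₁ * (k * k)
  tail₁ : c + (d + (e + k)) ≤ a + (b + (c + (d + (e + k))))
  tail₁ = ≤-trans (m≤n+m _ b) (m≤n+m _ a)
  tail₂ : d + (e + k) ≤ a + (b + (c + (d + (e + k))))
  tail₂ = ≤-trans (m≤n+m _ c) tail₁
  tail₃ : e + k ≤ a + (b + (c + (d + (e + k))))
  tail₃ = ≤-trans (m≤n+m _ d) tail₂

module Main (g : ℕ) (cs : Constants (κ g) (κ g ^ κ g) (5 + dbl g)) where

  open Balance g
  open Constants cs

  n₀ : ℕ
  n₀ = threshold (κ g) K₀ M₁ M₅

  module _ {n : ℕ} (n≥ : n₀ ≤ n) (G : Graph n) (free : CycleFree (5 + dbl g) G) where

    open AboveThreshold (above-threshold (κ g) K₀ M₁ M₅ n n≥)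
    open ShortCycles g G

    private
      q : ℕ
      q = n / κ g

    q*κ≤n : q * κ g ≤ n
    q*κ≤n = m/n*n≤m n (κ g)

    n≡ : n ≡ κ g * q + n % κ g
    n≡ = trans (m≡m%n+[m/n]*n n (κ g)) (trans (+-comm (n % κ g) (q * κ g)) (cong (_+ n % κ g) (*-comm q (κ g))))

    0<q : 0 < q
    0<q = n≢0⇒n>0 λ e → <⇒≱ (≤-<-trans (≤-reflexive (trans n≡ (cong (_+ n % κ g) (trans (cong (κ g *_) e) (*-zeroʳ (κ g)))))) (m%n<n n (κ g))) k≤n

    0<n : 0 < n
    0<n = ≤-trans (s≤s z≤n) k≤n

    approximate : ∀ M → M * (κ g * κ g) ≤ n → M * n ^ κ g ≤ M * (κ g ^ κ g * q ^ κ g) + n ^ κ g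
    approximate M l = division-approximation M (6 + dbl g) q (n % κ g) n n≡
      (≤-trans (*-monoʳ-≤ M (*-monoʳ-≤ (κ g) (<⇒≤ (m%n<n n (κ g))))) l)

    sparse : M₅ * ∑∑ (λ u v → adj? G u v ×-dec ¬? (good? u v)) ≤ n * n
    sparse = *-cancelˡ-≤ 2 (≤-trans (≤-reflexive (sym (*-assoc 2 M₅ _))) (bad-pairs free (2 * M₅) 0<n biclique-small biclique-large))

    near-blow-up : 2 * κ g * q ^ κ g ≤ embeddings (κ g) G → Typical g G
    near-blow-up dense = Dense.typical g cs G good? (λ {u} {v} → Good-sym {u} {v}) proj₁ (Good-no-odd free) (q ^ κ g)
      sparse dense (approximate M₅ approx₅) (approximate M₁ approx₁) classes-large

    -- One case distinction serves both claims. Each case bounds the number of cycles by q^k or by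
    -- `P ψ`, hence by (n/k)^k; and a maximiser can only be in the case `equal`, with classes that
    -- no move of a vertex improves.
    data Verdict : Set where
      few   : cycles (κ g) G < q ^ κ g → Verdict
      fewer : ∀ ψ → cycles (κ g) G < P {n} ψ → Verdict
      equal : ∀ ψ → cycles (κ g) G ≤ P {n} ψ → 0 < P ψ →
              (∀ u v → (Adj G u v → Bu.Linked ψ u v) × (Bu.Linked ψ u v → Adj G u v)) → Verdict

    compare : Verdict
    compare = case 2 * κ g * q ^ κ g ≤? embeddings (κ g) G of λ
      { (no ¬l) → few (cycles-< (6 + dbl g) G (q ^ κ g) (≰⇒> ¬l))
      ; (yes l) → dense l (near-blow-up l) }
      where
      dense : 2 * κ g * q ^ κ g ≤ embeddings (κ g) G → Typical g G → Verdict
      dense l T = case Comparison.outcome g G free T of λ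
        { (inj₁ less) → fewer ψ (cycles-< (6 + dbl g) G (P ψ) less)
        ; (inj₂ (le , iff)) → equal ψ (cycles-≤ (6 + dbl g) G (P ψ) le)
            (≤-trans (m^n>0 q {{>-nonZero 0<q}} (κ g)) (*-cancelˡ-≤ (2 * κ g) (≤-trans l le))) iff }
        where
        ψ = Structure.ψ g G free T

    balanced : IsMaximiser (κ g) (5 + dbl g) G → BalancedBlowUp (κ g) G
    balanced maximal = case compare of λ
      { (few l) → case equitable n q q*κ≤n of λ (ψ , le) → ⊥-elim (beaten ψ (<-≤-trans l le))
      ; (fewer ψ l) → ⊥-elim (beaten ψ l)
      ; (equal ψ le pos iff) → ψ , (λ a b → ≮⇒≥ λ l → case unbalanced⇒larger ψ a b pos l of λ (ψ′ , l′) → beaten ψ′ (≤-<-trans le l′)) , iff }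
      where
      beaten : ∀ ψ → ¬ cycles (κ g) G < P {n} ψ
      beaten ψ l = <⇒≱ l (≤-trans (Bu.cycles-≥ ψ) (maximal (Bu.blowUp ψ) (Bu.blowUp-free ψ)))

    bounded : κ g ^ κ g * cycles (κ g) G ≤ n ^ κ g
    bounded = case compare of λ
      { (few l) → ≤-trans (*-monoʳ-≤ (κ g ^ κ g) (<⇒≤ l)) (≤-trans (≤-reflexive (sym (*-^ (κ g) q (κ g))))
                    (^-monoˡ-≤ (κ g) (≤-trans (≤-reflexive (*-comm (κ g) q)) q*κ≤n)))
      ; (fewer ψ l) → ≤-trans (*-monoʳ-≤ (κ g ^ κ g) (<⇒≤ l)) (Bu.prod≤ ψ 0)
      ; (equal ψ le _ _) → ≤-trans (*-monoʳ-≤ (κ g ^ κ g) le) (Bu.prod≤ ψ 0) }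

odd-≥7 : ∀ k → k % 2 ≡ 1 → 7 ≤ k → ∃[ g ] κ g ≡ k
odd-≥7 k odd 7≤k = case m≤n⇒∃[o]m+o≡n 7≤k of λ (o , e) → case parity o of λ
  { (inj₁ (g , refl)) → g , e
  ; (inj₂ (g , refl)) → ⊥-elim (case trans (sym (even (4 + g))) (trans (cong (_% 2) e) odd) of λ ()) }
  where
  even : ∀ g → dbl g % 2 ≡ 0
  even g = trans (cong (_% 2) (trans (dbl≡+ g) (trans (cong (g +_) (sym (+-identityʳ g))) (*-comm 2 g)))) (m*n%n≡0 g 2)

theorem1p1 : (k : ℕ) → k % 2 ≡ 1 → 7 ≤ k →
    ∃[ n₀ ] (((n : ℕ) → n₀ ≤ n → (G : Graph n) →
    CycleFree (k ∸ 2) G → IsMaximiser k (k ∸ 2) G → BalancedBlowUp k G) ×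
    ((n : ℕ) → n₀ ≤ n → (G : Graph n) →
    CycleFree (k ∸ 2) G → k ^ k * cycles k G ≤ n ^ k))
theorem1p1 k odd 7≤k with odd-≥7 k odd 7≤k
... | g , refl = n₀ , (λ n n≥ G free maximal → balanced n≥ G free maximal) , (λ n n≥ G free → bounded n≥ G free)
  where open Main g (constants (κ g) (κ g ^ κ g) (5 + dbl g) (s≤s z≤n) (m^n>0 (κ g) (κ g)))
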